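{- For all integers $n\geq 0$ and $m\geq 0$, $$B_{5,11}\left(5^{12m}n+\frac{7\cdot 5^{12m}-7}{12}\right)\equiv 2^m B_{5,11}(n)\pmod{11},$$ and, for each $k\in\{4,5\}$, $$B_{5,11}\left(5^{12m+12}n+\frac{(12k+11)\cdot 5^{12m+11}-7}{12}\right)\equiv 0\pmod{11}.$$
   Context: For integers $l,m>1$, an $l$-regular partition is a partition none of whose parts is divisible by $l$. A $(l,m)$-regular bipartition of $n$ is a pair of partitions $(\lambda,\mu)$ such that the sum of all parts of $\lambda$ and $\mu$ is $n$, $\lambda$ is $l$-regular and $\mu$ is $m$-regular. $B_{l,m}(n)$ denotes the number of $(l,m)$-regular bipartitions of $n$; equivalently $\sum_{n\ge 0}B_{l,m}(n)q^n=\frac{f_lf_m}{f_1^2}$, where $f_k=\prod_{j\ge1}(1-q^{jk})$. -}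

module Defs where

open import Data.List.Base using (List; []; _∷_; length; upTo; filter; cartesianProduct; cartesianProductWith)
open import Data.List.Membership.Propositional using (_∈_)
open import Data.List.Membership.Propositional.Properties using (∈-filter⁺; ∈-filter⁻; ∈-upTo⁺; ∈-cartesianProduct⁺; ∈-cartesianProductWith⁺; ∈-cartesianProductWith⁻)
open import Data.List.Properties using (∷-injective)
open import Data.List.Relation.Unary.All as All using (All; []; _∷_)
open import Data.List.Relation.Unary.AllPairs using ([]; _∷_)
open import Data.List.Relation.Unary.Any using (here; there)
open import Data.List.Relation.Unary.Linked using (Linked; linked?)
open import Data.List.Relation.Unary.Unique.Propositional using (Unique)
import Data.List.Relation.Unary.Unique.Propositional.Properties as Unique
open import Data.Nat.Base using (ℕ; zero; suc; _+_; _≤_; _<_; _≥_; z≤n; s≤s)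
open import Data.Nat.Divisibility using (_∣_; _∣?_)
open import Data.Nat.ListAction using (sum)
open import Data.Nat.Properties using (_≟_; _<?_; _≥?_; ≤-trans; ≤-reflexive; m≤m+n; m≤n+m; +-mono-≤)
open import Data.Product.Base using (_×_; _,_; proj₂)
open import Function.Bundles using (_⇔_; mk⇔)
open import Relation.Binary.PropositionalEquality using (_≡_; refl)
open import Relation.Nullary using (¬_; ¬?; _×-dec_)
open import Relation.Unary using (Decidable)

-- A partition is the list of its parts, in weakly decreasing order.
IsPartition : List ℕ → Set
IsPartition p = Linked _≥_ p × All (0 <_) p

IsRegular : ℕ → List ℕ → Set
IsRegular l p = All (λ x → ¬ (l ∣ x)) p

IsRegularBipartition : (l m n : ℕ) → List ℕ × List ℕ → Set
IsRegularBipartition l m n (p , q) =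
  (IsPartition p × IsPartition q) ×
  (sum p + sum q ≡ n) ×
  (IsRegular l p × IsRegular m q)

isPartition? : Decidable IsPartition
isPartition? p = linked? _≥?_ p ×-dec All.all? (0 <?_) p

isRegular? : ∀ l → Decidable (IsRegular l)
isRegular? l = All.all? (λ x → ¬? (l ∣? x))

isRegularBipartition? : ∀ l m n → Decidable (IsRegularBipartition l m n)
isRegularBipartition? l m n (p , q) =
  (isPartition? p ×-dec isPartition? q) ×-dec
  (sum p + sum q ≟ n) ×-dec
  (isRegular? l p ×-dec isRegular? m q)

-- All lists of length at most k with entries at most b.
boundedLists : (b k : ℕ) → List (List ℕ)
boundedLists b zero    = [] ∷ []
boundedLists b (suc k) = [] ∷ cartesianProductWith _∷_ (upTo (suc b)) (boundedLists b k)

-- In a bipartition of n, both partitions have at most n parts, each at most n,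
-- so searching bounded lists misses none (see ∈-regularBipartitions).
regularBipartitions : (l m n : ℕ) → List (List ℕ × List ℕ)
regularBipartitions l m n =
  filter (isRegularBipartition? l m n)
         (cartesianProduct (boundedLists n n) (boundedLists n n))

B : (l m n : ℕ) → ℕ
B l m n = length (regularBipartitions l m n)

-- B l m n is a genuine cardinality: regularBipartitions l m n lists exactly
-- the (l, m)-regular bipartitions of n, each of them once.

∈-boundedLists : ∀ {b k p} → length p ≤ k → All (_≤ b) p → p ∈ boundedLists b k
∈-boundedLists {k = zero}  {[]}    _         _          = here refl
∈-boundedLists {k = suc k} {[]}    _         _          = here refl
∈-boundedLists {k = suc k} {x ∷ p} (s≤s len) (x≤b ∷ ps) =
  there (∈-cartesianProductWith⁺ _∷_ (∈-upTo⁺ (s≤s x≤b)) (∈-boundedLists len ps))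

boundedLists-unique : ∀ b k → Unique (boundedLists b k)
boundedLists-unique b zero    = [] ∷ []
boundedLists-unique b (suc k) =
  All.tabulate []≢ ∷
  Unique.cartesianProductWith⁺ _∷_ ∷-injective (Unique.upTo⁺ (suc b)) (boundedLists-unique b k)
  where
  []≢ : ∀ {p} → p ∈ cartesianProductWith _∷_ (upTo (suc b)) (boundedLists b k) → ¬ ([] ≡ p)
  []≢ p∈ refl with ∈-cartesianProductWith⁻ _∷_ (upTo (suc b)) (boundedLists b k) p∈
  ... | _ , _ , _ , _ , ()

length≤sum : ∀ {p} → All (0 <_) p → length p ≤ sum p
length≤sum []        = z≤n
length≤sum (0<x ∷ p) = +-mono-≤ 0<x (length≤sum p)

parts≤sum : ∀ p → All (_≤ sum p) p
parts≤sum []      = []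
parts≤sum (x ∷ p) = m≤m+n x (sum p) ∷ All.map (λ y≤ → ≤-trans y≤ (m≤n+m (sum p) x)) (parts≤sum p)

∈-regularBipartitions : ∀ l m n pq → pq ∈ regularBipartitions l m n ⇔ IsRegularBipartition l m n pq
∈-regularBipartitions l m n (p , q) = mk⇔
  (λ pq∈ → proj₂ (∈-filter⁻ (isRegularBipartition? l m n)
                            {xs = cartesianProduct (boundedLists n n) (boundedLists n n)} pq∈))
  complete
  where
  bounded : ∀ {r} → All (0 <_) r → sum r ≤ n → r ∈ boundedLists n n
  bounded {r} 0<r r≤n = ∈-boundedLists (≤-trans (length≤sum 0<r) r≤n)
                                       (All.map (λ x≤ → ≤-trans x≤ r≤n) (parts≤sum r))

  complete : IsRegularBipartition l m n (p , q) → (p , q) ∈ regularBipartitions l m n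
  complete h@(((_ , 0<p) , (_ , 0<q)) , sum≡n , _) =
    ∈-filter⁺ (isRegularBipartition? l m n)
      (∈-cartesianProduct⁺ (bounded 0<p (≤-trans (m≤m+n (sum p) (sum q)) (≤-reflexive sum≡n)))
                           (bounded 0<q (≤-trans (m≤n+m (sum q) (sum p)) (≤-reflexive sum≡n))))
      h

regularBipartitions-unique : ∀ l m n → Unique (regularBipartitions l m n)
regularBipartitions-unique l m n =
  Unique.filter⁺ (isRegularBipartition? l m n)
    (Unique.cartesianProduct⁺ (boundedLists-unique n n) (boundedLists-unique n n))

{-# OPTIONS --safe #-}

-- Modulo 11 one has f₁₁ ≡ f₁¹¹, so the generating function of B 5 11 is v₁ = f₁⁹ f₅. Let E s extract
-- the coefficients of q^(5n+s), and let α be the part 0 of f₁. Euler's pentagonal number theorem, together with the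
-- absence of exponents 2 modulo 5 in f₁³ (Jacobi), gives f₁ = α(q⁵) (1 - x - x²) with x = q w(q⁵) and f₅ = α w.
-- As 𝔽₁₁ contains the fifth roots of unity k, multiplying the twists f₁(kq) yields
-- f₁⁶ = α⁶ w (1 - q² w¹⁰). Hence E 4 and E 2 are linear maps between the span of v₁, v₂ = q f₁³ f₅⁷ and the span of
-- w₁ = f₁⁷ f₅³, w₂ = q f₁ f₅⁹, and a 2 × 2 matrix computation gives (E 2 ∘ E 4)⁶ v₁ = 2 v₁ and
-- E 4 ((E 2 ∘ E 4)⁵ v₁) = 9 w₂, where w₂ has no exponents 0 or 4 modulo 5.
module Submission where

open import Defs
open import Algebra.Bundles using (CommutativeRing; RawRing)
import Algebra.Solver.Ring as RingSolver
open import Algebra.Solver.Ring.AlmostCommutativeRing using (AlmostCommutativeRing; Induced-equivalence; fromCommutativeRing; _-Raw-AlmostCommutative⟶_)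
open import Algebra.Structures using (IsCommutativeRing)
open import Data.Bool.Base using (if_then_else_)
open import Data.Empty using (⊥-elim)
open import Data.Integer.Base as ℤ using (ℤ; +_)
import Data.Integer.DivMod as ℤ
open import Data.Integer.Divisibility.Signed as ∣ using () renaming (_∣_ to _∣ℤ_)
import Data.Integer.Properties as ℤ
import Data.Integer.Solver as ℤ
open import Data.List.Base using (List; []; _∷_; _++_; map; length; upTo; applyUpTo; filter; cartesianProduct; cartesianProductWith)
open import Data.List.Membership.Propositional using (_∈_)
open import Data.List.Membership.Propositional.Properties using (∈-cartesianProductWith⁻; ∈-upTo⁻)
open import Data.List.Properties using (filter-accept; filter-reject)
open import Data.List.Relation.Unary.All as All using (All; []; _∷_)
open import Data.List.Relation.Unary.Any using (here; there)
open import Data.List.Relation.Unary.Linked as Linked using (Linked; [-]; _∷_)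
open import Data.Maybe.Base as Maybe using (Maybe)
open import Data.Nat.Base as ℕ using (ℕ; zero; suc; _≤_; _<_; _≥_; z≤n; s≤s)
open import Data.Nat.Divisibility as ℕ∣ using (_∣_; _∣?_)
import Data.Nat.DivMod as ℕ
open import Data.Nat.ListAction using (sum)
import Data.Nat.Properties as ℕ
import Data.Nat.Solver as ℕ
open import Data.Product using (_×_; _,_; proj₁)
open import Data.Sum using (_⊎_; inj₁; inj₂)
open import Function.Base using (_∘_)
open import Relation.Binary.Bundles using (Setoid)
open import Relation.Binary.Definitions using (WeaklyDecidable)
open import Relation.Binary.PropositionalEquality as ≡ using (_≡_; _≢_)
import Relation.Binary.Reasoning.Setoid as SetoidReasoning
open import Relation.Nullary using (¬_; ¬?; _×-dec_; Dec; does; yes; no)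
open import Relation.Nullary.Decidable using (dec⇒maybe)

-- Formal power series

-- The series `x` is the Rogers-Ramanujan continued fraction at q⁵, and `z` is the fifth power of
-- that fraction at q. Classically f₁⁶ / (q f₅⁶) = 1/z - 11 - z. Modulo 11 the middle term drops
-- out, and this is why f₁⁷ and f₁⁹ behave well: the three contributions to the extracted residue
-- class recombine into only two products of powers of f₁ and f₅. The classes 4 and 2 are forced by
-- 12(5n + 4) + 7 = 5(12n + 11) and 12(5n + 2) + 11 = 5(12n + 7), so a pair of extractions
-- multiplies 12n + 7 by 25. Six pairs are taken because the sixth power of the matrix is the first
-- one that sends `v₁` to a multiple of itself, which accounts for the exponent 12m. Limits are
-- avoided throughout: identities of series are checked modulo q^N for every N, and an equation
-- whose recursive occurrence stands behind a factor q is proved by induction on N.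

module PowerSeries {c ℓ} (R : CommutativeRing c ℓ) where

  private
    module R = CommutativeRing R
  open R using (Carrier) renaming (_≈_ to _≈ᵣ_; _+_ to _+ᵣ_; _*_ to _*ᵣ_; -_ to -ᵣ_; 0# to 0ᵣ; 1# to 1ᵣ)
  open import Algebra.Properties.Ring R.ring using (-0#≈0#)
  open import Algebra.Properties.CommutativeSemigroup R.+-commutativeSemigroup
    using () renaming (interchange to +ᵣ-interchange; x∙yz≈y∙xz to +ᵣ-swap)
  private module ≈ᵣ-Reasoning = SetoidReasoning R.setoid

  Series : Set c
  Series = ℕ → Carrier

  infix 4 _≈_ _≈_mod-q^_
  infixl 6 _+_
  infixl 7 _*_
  infix 8 -_

  record _≈_ (f g : Series) : Set ℓ where
    constructor ⟨_⟩
    field at : ∀ n → f n ≈ᵣ g n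
  open _≈_ public

  -- Stands in for convergence: infinite products and sums are compared through their truncations,
  -- and `mod-all` recovers equality.
  record _≈_mod-q^_ (f g : Series) (N : ℕ) : Set ℓ where
    constructor ⟨_⟩ₘ
    field below : ∀ {n} → n < N → f n ≈ᵣ g n
  open _≈_mod-q^_ public

  const : Carrier → Series
  const x zero    = x
  const x (suc n) = 0ᵣ

  tail : Series → Series
  tail f n = f (suc n)

  opaque
    _+_ _*_ : Series → Series → Series
    (f + g) n = f n +ᵣ g n
    (f * g) zero    = f 0 *ᵣ g 0
    (f * g) (suc n) = f 0 *ᵣ g (suc n) +ᵣ (tail f * g) n

    -_ : Series → Series
    (- f) n = -ᵣ f n

  0# 1# q : Series
  0# _ = 0ᵣ
  1# = const 1ᵣ
  q zero    = 0ᵣ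
  q (suc n) = 1# n

  ≈-refl : ∀ {f} → f ≈ f
  ≈-refl = ⟨ (λ _ → R.refl) ⟩
  ≈-sym : ∀ {f g} → f ≈ g → g ≈ f
  ≈-sym p = ⟨ (λ n → R.sym (at p n)) ⟩
  ≈-trans : ∀ {f g h} → f ≈ g → g ≈ h → f ≈ h
  ≈-trans p r = ⟨ (λ n → R.trans (at p n) (at r n)) ⟩

  opaque
    unfolding _+_

    -- Coefficient `n` of a product only sees the coefficients of its factors up to `n`. This local
    -- form serves both `*-cong` and the truncated `*-mod`.
    *-cong-≤ : ∀ {f f′ g g′} n → (∀ {k} → k ≤ n → f k ≈ᵣ f′ k) → (∀ {k} → k ≤ n → g k ≈ᵣ g′ k) →
               (f * g) n ≈ᵣ (f′ * g′) n
    *-cong-≤ zero    p r = R.*-cong (p z≤n) (r z≤n)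
    *-cong-≤ (suc n) p r = R.+-cong (R.*-cong (p z≤n) (r ℕ.≤-refl))
      (*-cong-≤ n (λ k≤n → p (s≤s k≤n)) (λ k≤n → r (ℕ.m≤n⇒m≤1+n k≤n)))

    *-cong : ∀ {f f′ g g′} → f ≈ f′ → g ≈ g′ → f * g ≈ f′ * g′
    *-cong p r = ⟨ (λ n → *-cong-≤ n (λ _ → at p _) (λ _ → at r _)) ⟩

    +-at : ∀ f g n → (f + g) n ≡ f n +ᵣ g n
    +-at f g n = ≡.refl

    neg-at : ∀ f n → (- f) n ≡ -ᵣ f n
    neg-at f n = ≡.refl

    +-cong : ∀ {f f′ g g′} → f ≈ f′ → g ≈ g′ → f + g ≈ f′ + g′
    +-cong p r = ⟨ (λ n → R.+-cong (at p n) (at r n)) ⟩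

  private opaque
    unfolding _+_

    zero-left : ∀ {f} g n → (∀ k → f k ≈ᵣ 0ᵣ) → (f * g) n ≈ᵣ 0ᵣ
    zero-left g zero    p = R.trans (R.*-congʳ (p 0)) (R.zeroˡ _)
    zero-left g (suc n) p = R.trans
      (R.+-cong (R.trans (R.*-congʳ (p 0)) (R.zeroˡ _)) (zero-left g n (λ k → p (suc k))))
      (R.+-identityˡ _)

  opaque
    unfolding _+_

    const-*-at : ∀ x f n → (const x * f) n ≈ᵣ x *ᵣ f n
    const-*-at x f zero    = R.refl
    const-*-at x f (suc n) = R.trans (R.+-congˡ (zero-left f n (λ _ → R.refl))) (R.+-identityʳ _)

  private opaque
    unfolding _+_

    -- The product is defined by peeling its left factor; the induction for commutativity also has
    -- to peel the right one.
    *-tailʳ : ∀ f g n → (f * g) (suc n) ≈ᵣ f (suc n) *ᵣ g 0 +ᵣ (f * tail g) n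
    *-tailʳ f g zero    = R.+-comm _ _
    *-tailʳ f g (suc n) = R.trans (R.+-congˡ (*-tailʳ (tail f) g n)) (+ᵣ-swap _ _ _)

    comm : ∀ n f g → (f * g) n ≈ᵣ (g * f) n
    comm zero    f g = R.*-comm _ _
    comm (suc n) f g = R.trans (R.+-cong (R.*-comm _ _) (comm n (tail f) g)) (R.sym (*-tailʳ g f n))

    distribʳ : ∀ n h f g → ((f + g) * h) n ≈ᵣ (f * h) n +ᵣ (g * h) n
    distribʳ zero    h f g = R.distribʳ _ _ _
    distribʳ (suc n) h f g = R.trans (R.+-cong (R.distribʳ _ _ _) (distribʳ n h (tail f) (tail g)))
      (+ᵣ-interchange _ _ _ _)

    scale : ∀ n x f g → ((λ k → x *ᵣ f k) * g) n ≈ᵣ x *ᵣ (f * g) n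
    scale zero    x f g = R.*-assoc _ _ _
    scale (suc n) x f g = R.trans (R.+-cong (R.*-assoc _ _ _) (scale n x (tail f) g)) (R.sym (R.distribˡ _ _ _))

    assoc : ∀ n f g h → ((f * g) * h) n ≈ᵣ (f * (g * h)) n
    assoc zero    f g h = R.*-assoc _ _ _
    assoc (suc n) f g h = begin
      f 0 *ᵣ g 0 *ᵣ h (suc n) +ᵣ (tail (f * g) * h) n
        ≈⟨ R.+-cong (R.*-assoc _ _ _) (distribʳ n h (λ k → f 0 *ᵣ g (suc k)) (tail f * g)) ⟩
      f 0 *ᵣ (g 0 *ᵣ h (suc n)) +ᵣ (((λ k → f 0 *ᵣ g (suc k)) * h) n +ᵣ ((tail f * g) * h) n)
        ≈⟨ R.+-congˡ (R.+-cong (scale n (f 0) (tail g) h) (assoc n (tail f) g h)) ⟩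
      f 0 *ᵣ (g 0 *ᵣ h (suc n)) +ᵣ (f 0 *ᵣ (tail g * h) n +ᵣ (tail f * (g * h)) n)
        ≈⟨ R.+-assoc _ _ _ ⟨
      f 0 *ᵣ (g 0 *ᵣ h (suc n)) +ᵣ f 0 *ᵣ (tail g * h) n +ᵣ (tail f * (g * h)) n
        ≈⟨ R.+-congʳ (R.distribˡ _ _ _) ⟨
      f 0 *ᵣ (g * h) (suc n) +ᵣ (tail f * (g * h)) n ∎
      where open ≈ᵣ-Reasoning

    *-comm′ : ∀ f g → f * g ≈ g * f
    *-comm′ f g = ⟨ (λ n → comm n f g) ⟩

    *-idˡ : ∀ f → 1# * f ≈ f
    *-idˡ f = ⟨ (λ n → R.trans (const-*-at 1ᵣ f n) (R.*-identityˡ _)) ⟩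

  opaque
    unfolding _+_

    isCommutativeRing : IsCommutativeRing _≈_ _+_ _*_ -_ 0# 1#
    isCommutativeRing = record
        { isRing = record
          { +-isAbelianGroup = record
            { isGroup = record
              { isMonoid = record
                { isSemigroup = record
                  { isMagma = record
                    { isEquivalence = record { refl = ≈-refl ; sym = ≈-sym ; trans = ≈-trans }
                    ; ∙-cong = +-cong }
                  ; assoc = λ _ _ _ → ⟨ (λ _ → R.+-assoc _ _ _) ⟩ }
                ; identity = (λ _ → ⟨ (λ _ → R.+-identityˡ _) ⟩) , (λ _ → ⟨ (λ _ → R.+-identityʳ _) ⟩) }
              ; inverse = (λ _ → ⟨ (λ _ → R.-‿inverseˡ _) ⟩) , (λ _ → ⟨ (λ _ → R.-‿inverseʳ _) ⟩)
              ; ⁻¹-cong = λ p → ⟨ (λ n → R.-‿cong (at p n)) ⟩ }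
            ; comm = λ _ _ → ⟨ (λ _ → R.+-comm _ _) ⟩ }
          ; *-cong = *-cong
          ; *-assoc = λ f g h → ⟨ (λ n → assoc n f g h) ⟩
          ; *-identity = *-idˡ , (λ f → ≈-trans (*-comm′ f 1#) (*-idˡ f))
          ; distrib = (λ f g h → ≈-trans (*-comm′ f (g + h)) (≈-trans ⟨ (λ n → distribʳ n f g h) ⟩
                                   (+-cong (*-comm′ g f) (*-comm′ h f))))
                    , (λ h f g → ⟨ (λ n → distribʳ n h f g) ⟩) }
        ; *-comm = *-comm′ }

  commutativeRing : CommutativeRing c ℓ
  commutativeRing = record { isCommutativeRing = isCommutativeRing }

  private module S = CommutativeRing commutativeRing
  open S public using (setoid; semiring; commutativeSemiring; *-assoc; *-comm; *-identityˡ; *-identityʳ; *-congˡ; *-congʳ;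
    +-congˡ; +-congʳ; +-assoc; +-comm; +-identityˡ; +-identityʳ; zeroˡ; zeroʳ; distribˡ; -‿cong; -‿inverseʳ)
  open import Algebra.Properties.Semiring.Exp semiring public
    using (_^_; ^-congˡ; ^-congʳ; ^-homo-*; ^-assocʳ)

  module ≈-Reasoning = SetoidReasoning setoid

  opaque
    unfolding _+_

    const-cong : ∀ {x y} → x ≈ᵣ y → const x ≈ const y
    const-cong x≈y = ⟨ (λ { zero → x≈y ; (suc _) → R.refl }) ⟩

    const-+-homo : ∀ x y → const (x +ᵣ y) ≈ const x + const y
    const-+-homo x y = ⟨ (λ { zero → R.refl ; (suc _) → R.sym (R.+-identityˡ _) }) ⟩

    const-*-homo : ∀ x y → const (x *ᵣ y) ≈ const x * const y
    const-*-homo x y = ⟨ (λ { zero → R.refl ; (suc n) → R.sym (R.trans (const-*-at x (const y) (suc n)) (R.zeroʳ x)) }) ⟩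

    const-neg : ∀ x → const (-ᵣ x) ≈ - const x
    const-neg x = ⟨ (λ { zero → R.refl ; (suc _) → R.sym -0#≈0# }) ⟩

    const-0 : const 0ᵣ ≈ 0#
    const-0 = ⟨ (λ { zero → R.refl ; (suc _) → R.refl }) ⟩

    q*-zero : ∀ f → (q * f) 0 ≈ᵣ 0ᵣ
    q*-zero f = R.zeroˡ _

    q*-suc : ∀ f n → (q * f) (suc n) ≈ᵣ f n
    q*-suc f n = R.trans (R.+-cong (R.zeroˡ _) (at (*-idˡ f) n)) (R.+-identityˡ _)

    head-tail : ∀ f → f ≈ const (f 0) + q * tail f
    head-tail f = ⟨ (λ { zero    → R.sym (R.trans (R.+-congˡ (q*-zero (tail f))) (R.+-identityʳ _))
                       ; (suc n) → R.sym (R.trans (R.+-identityˡ _) (q*-suc (tail f) n)) }) ⟩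

    tail-* : ∀ f g → tail (f * g) ≈ const (f 0) * tail g + tail f * g
    tail-* f g = ⟨ (λ n → R.+-congʳ (R.sym (const-*-at (f 0) (tail g) n))) ⟩

  module _ {N : ℕ} where
    m-refl : ∀ {f} → f ≈ f mod-q^ N
    m-refl = ⟨ (λ _ → R.refl) ⟩ₘ
    m-sym : ∀ {f g} → f ≈ g mod-q^ N → g ≈ f mod-q^ N
    m-sym p = ⟨ (λ l → R.sym (below p l)) ⟩ₘ
    m-trans : ∀ {f g h} → f ≈ g mod-q^ N → g ≈ h mod-q^ N → f ≈ h mod-q^ N
    m-trans p r = ⟨ (λ l → R.trans (below p l) (below r l)) ⟩ₘ
    ≈⇒mod : ∀ {f g} → f ≈ g → f ≈ g mod-q^ N
    ≈⇒mod p = ⟨ (λ _ → at p _) ⟩ₘ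
    opaque
      unfolding _+_

      +-mod : ∀ {f f′ g g′} → f ≈ f′ mod-q^ N → g ≈ g′ mod-q^ N → f + g ≈ f′ + g′ mod-q^ N
      +-mod p r = ⟨ (λ l → R.+-cong (below p l) (below r l)) ⟩ₘ
      neg-mod : ∀ {f f′} → f ≈ f′ mod-q^ N → - f ≈ - f′ mod-q^ N
      neg-mod p = ⟨ (λ l → R.-‿cong (below p l)) ⟩ₘ
      *-mod : ∀ {f f′ g g′} → f ≈ f′ mod-q^ N → g ≈ g′ mod-q^ N → f * g ≈ f′ * g′ mod-q^ N
      *-mod p r = ⟨ (λ {n} l → *-cong-≤ n (λ k≤n → below p (ℕ.≤-<-trans k≤n l))
                                          (λ k≤n → below r (ℕ.≤-<-trans k≤n l))) ⟩ₘ

  mod-setoid : ℕ → Setoid c ℓ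
  mod-setoid N = record { Carrier = Series ; _≈_ = λ f g → f ≈ g mod-q^ N
    ; isEquivalence = record { refl = m-refl ; sym = m-sym ; trans = m-trans } }

  module mod-Reasoning (N : ℕ) = SetoidReasoning (mod-setoid N)

  mod-weaken : ∀ {M N f g} → M ≤ N → f ≈ g mod-q^ N → f ≈ g mod-q^ M
  mod-weaken M≤N p = ⟨ (λ l → below p (ℕ.≤-trans l M≤N)) ⟩ₘ

  mod-all : ∀ {f g} → (∀ N → f ≈ g mod-q^ N) → f ≈ g
  mod-all p = ⟨ (λ n → below (p (suc n)) ℕ.≤-refl) ⟩

  -- The order gained here drives the inductions on `N`: a recursive occurrence behind a factor `q`
  -- is needed to one order less.
  q*-mod : ∀ {N f g} → f ≈ g mod-q^ N → q * f ≈ q * g mod-q^ suc N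
  q*-mod {f = f} {g} p = ⟨ (λ { {zero} _ → R.trans (q*-zero f) (R.sym (q*-zero g))
    ; {suc n} (s≤s l) → R.trans (q*-suc f n) (R.trans (below p l) (R.sym (q*-suc g n))) }) ⟩ₘ

  q^*-mod : ∀ k {N f g} → f ≈ g mod-q^ N → q ^ k * f ≈ q ^ k * g mod-q^ (k ℕ.+ N)
  q^*-mod zero    p = *-mod m-refl p
  q^*-mod (suc k) {f = f} {g} p = m-trans (≈⇒mod (*-assoc q (q ^ k) f))
    (m-trans (q*-mod (q^*-mod k p)) (m-sym (≈⇒mod (*-assoc q (q ^ k) g))))

  q^-small : ∀ {N k} f → N ≤ k → q ^ k * f ≈ 0# mod-q^ N
  q^-small {N} {k} f N≤k = mod-weaken (ℕ.≤-trans N≤k (ℕ.m≤m+n k 0))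
    (m-trans (q^*-mod k {0} {f} {0#} ⟨ (λ ()) ⟩ₘ) (≈⇒mod (zeroʳ (q ^ k))))

  q^-shift : ∀ k f n → (q ^ k * f) (k ℕ.+ n) ≈ᵣ f n
  q^-shift zero    f n = at (*-idˡ f) n
  q^-shift (suc k) f n = R.trans (at (*-assoc q (q ^ k) f) (suc k ℕ.+ n))
    (R.trans (q*-suc (q ^ k * f) (k ℕ.+ n)) (q^-shift k f n))

  q^-below : ∀ k f {n} → n < k → (q ^ k * f) n ≈ᵣ 0ᵣ
  q^-below k f n<k = below (q^-small f n<k) ℕ.≤-refl

  q^-at≢ : ∀ k {n} → n ≢ k → (q ^ k) n ≈ᵣ 0ᵣ
  q^-at≢ zero    {zero}  n≢k = ⊥-elim (n≢k ≡.refl)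
  q^-at≢ zero    {suc n} n≢k = R.refl
  q^-at≢ (suc k) {zero}  n≢k = q*-zero (q ^ k)
  q^-at≢ (suc k) {suc n} n≢k = R.trans (q*-suc (q ^ k) n) (q^-at≢ k (λ n≡k → n≢k (≡.cong suc n≡k)))

  -- subst y f is f (q y): every substitution with zero constant term has this form.
  private
    horner : Series → ℕ → Series → Series
    horner y zero    f = 0#
    horner y (suc N) f = const (f 0) + q * (y * horner y N (tail f))

    horner-suc : ∀ y N f → horner y N f ≈ horner y (suc N) f mod-q^ N
    horner-suc y zero    f = ⟨ (λ ()) ⟩ₘ
    horner-suc y (suc N) f = +-mod m-refl (q*-mod (*-mod m-refl (horner-suc y N (tail f))))

    horner-+ : ∀ y N f d → horner y N f ≈ horner y (d ℕ.+ N) f mod-q^ N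
    horner-+ y N f zero    = m-refl
    horner-+ y N f (suc d) = m-trans (horner-+ y N f d) (mod-weaken (ℕ.m≤n+m N d) (horner-suc y (d ℕ.+ N) f))

  opaque
    subst : Series → Series → Series
    subst y f n = horner y (suc n) f n

  private opaque
    unfolding subst

    subst-horner : ∀ y N f → subst y f ≈ horner y N f mod-q^ N
    subst-horner y N f = ⟨ (λ {n} n<N → R.trans (below (horner-+ y (suc n) f (N ℕ.∸ suc n)) ℕ.≤-refl)
      (R.reflexive (≡.cong (λ k → horner y k f n) (ℕ.m∸n+n≡m n<N)))) ⟩ₘ

  -- This equation determines `subst y f`, since the recursive occurrence stands behind a factor
  -- `q`. Compatibility with sums, products and composition is derived from it.
  subst-unfold : ∀ y f → subst y f ≈ const (f 0) + q * (y * subst y (tail f))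
  subst-unfold y f = mod-all (λ N → m-trans (subst-horner y N f) (m-trans (horner-suc y N f)
    (+-mod m-refl (mod-weaken (ℕ.n≤1+n N) (q*-mod (*-mod m-refl (m-sym (subst-horner y N (tail f)))))))))

  module _ (y : Series) where
    private σ = subst y

    subst-mod : ∀ {N f g} → f ≈ g mod-q^ N → σ f ≈ σ g mod-q^ N
    subst-mod {zero}          p = ⟨ (λ ()) ⟩ₘ
    subst-mod {suc N} {f} {g} p = m-trans (≈⇒mod (subst-unfold y f)) (m-trans
      (+-mod (≈⇒mod (const-cong (below p (s≤s z≤n))))
        (q*-mod (*-mod m-refl (subst-mod {N} {tail f} {tail g} ⟨ (λ n<N → below p (s≤s n<N)) ⟩ₘ))))
      (m-sym (≈⇒mod (subst-unfold y g))))

    subst-cong : ∀ {f g} → f ≈ g → σ f ≈ σ g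
    subst-cong p = mod-all (λ _ → subst-mod (≈⇒mod p))

    subst-0# : σ 0# ≈ 0#
    subst-0# = mod-all go
      where
      go : ∀ N → σ 0# ≈ 0# mod-q^ N
      go zero    = ⟨ (λ ()) ⟩ₘ
      go (suc N) = m-trans (≈⇒mod (subst-unfold y 0#)) (m-trans
        (+-mod (≈⇒mod const-0) (q*-mod (*-mod (m-refl {f = y}) (go N))))
        (≈⇒mod (≈-trans (+-identityˡ _) (≈-trans (*-congˡ (zeroʳ y)) (zeroʳ q)))))

    subst-const : ∀ x → σ (const x) ≈ const x
    subst-const x = begin
      σ (const x)                   ≈⟨ subst-unfold y (const x) ⟩
      const x + q * (y * σ 0#)      ≈⟨ +-congˡ (*-congˡ (*-congˡ subst-0#)) ⟩
      const x + q * (y * 0#)        ≈⟨ +-congˡ (≈-trans (*-congˡ (zeroʳ y)) (zeroʳ q)) ⟩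
      const x + 0#                  ≈⟨ +-identityʳ _ ⟩
      const x                       ∎
      where open ≈-Reasoning

    opaque
      unfolding _+_

      subst-+ : ∀ f g → σ (f + g) ≈ σ f + σ g
      subst-+ f g = mod-all (λ N → go N f g)
        where
        go : ∀ N f g → σ (f + g) ≈ σ f + σ g mod-q^ N
        go zero    f g = ⟨ (λ ()) ⟩ₘ
        go (suc N) f g = begin
          σ (f + g)
            ≈⟨ ≈⇒mod (subst-unfold y (f + g)) ⟩
          const (f 0 +ᵣ g 0) + q * (y * σ (tail f + tail g))
            ≈⟨ +-mod (≈⇒mod (const-+-homo _ _)) (q*-mod (*-mod m-refl (go N (tail f) (tail g)))) ⟩
          const (f 0) + const (g 0) + q * (y * (σ (tail f) + σ (tail g)))
            ≈⟨ ≈⇒mod (+-congˡ (≈-trans (*-congˡ (distribˡ _ _ _)) (distribˡ _ _ _))) ⟩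
          const (f 0) + const (g 0) + (q * (y * σ (tail f)) + q * (y * σ (tail g)))
            ≈⟨ ≈⇒mod (interchange _ _ _ _) ⟩
          const (f 0) + q * (y * σ (tail f)) + (const (g 0) + q * (y * σ (tail g)))
            ≈⟨ ≈⇒mod (+-cong (subst-unfold y f) (subst-unfold y g)) ⟨
          σ f + σ g ∎
          where
          open mod-Reasoning (suc N)
          open import Algebra.Properties.CommutativeSemigroup S.+-commutativeSemigroup using (interchange)

    subst-q : σ q ≈ q * y
    subst-q = begin
      σ q                           ≈⟨ subst-unfold y q ⟩
      const 0ᵣ + q * (y * σ 1#)     ≈⟨ +-cong const-0 (*-congˡ (*-congˡ (subst-const 1ᵣ))) ⟩
      0# + q * (y * 1#)             ≈⟨ +-identityˡ _ ⟩
      q * (y * 1#)                  ≈⟨ *-congˡ (*-identityʳ y) ⟩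
      q * y                         ∎
      where open ≈-Reasoning

    opaque
      unfolding _+_

      subst-scale : ∀ x f → σ (const x * f) ≈ const x * σ f
      subst-scale x f = mod-all (λ N → go N f)
        where
        go : ∀ N f → σ (const x * f) ≈ const x * σ f mod-q^ N
        go zero    f = ⟨ (λ ()) ⟩ₘ
        go (suc N) f = begin
          σ (const x * f)
            ≈⟨ ≈⇒mod (subst-unfold y (const x * f)) ⟩
          const (x *ᵣ f 0) + q * (y * σ (tail (const x * f)))
            ≈⟨ ≈⇒mod (+-cong (const-*-homo x (f 0)) (*-congˡ (*-congˡ (subst-cong tail-const)))) ⟩
          const x * const (f 0) + q * (y * σ (const x * tail f))
            ≈⟨ +-mod m-refl (q*-mod (*-mod m-refl (go N (tail f)))) ⟩
          const x * const (f 0) + q * (y * (const x * σ (tail f)))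
            ≈⟨ ≈⇒mod (+-congˡ (≈-trans (*-congˡ (swap _ _ _)) (swap _ _ _))) ⟩
          const x * const (f 0) + const x * (q * (y * σ (tail f)))
            ≈⟨ ≈⇒mod (distribˡ _ _ _) ⟨
          const x * (const (f 0) + q * (y * σ (tail f)))
            ≈⟨ ≈⇒mod (*-congˡ (subst-unfold y f)) ⟨
          const x * σ f ∎
          where
          open mod-Reasoning (suc N)
          open import Algebra.Properties.CommutativeSemigroup S.*-commutativeSemigroup using () renaming (x∙yz≈y∙xz to swap)
          tail-const : tail (const x * f) ≈ const x * tail f
          tail-const = ⟨ (λ n → R.trans (const-*-at x f (suc n)) (R.sym (const-*-at x (tail f) n))) ⟩

      subst-* : ∀ f g → σ (f * g) ≈ σ f * σ g
      subst-* f g = mod-all (λ N → go N f)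
        where
        go : ∀ N f → σ (f * g) ≈ σ f * σ g mod-q^ N
        go zero    f = ⟨ (λ ()) ⟩ₘ
        go (suc N) f = begin
          σ (f * g)
            ≈⟨ ≈⇒mod (subst-unfold y (f * g)) ⟩
          const (f 0 *ᵣ g 0) + q * (y * σ (tail (f * g)))
            ≈⟨ ≈⇒mod (+-cong (const-*-homo (f 0) (g 0)) (*-congˡ (*-congˡ
                 (≈-trans (subst-cong (tail-* f g)) (≈-trans (subst-+ (const (f 0) * tail g) (tail f * g)) (+-congʳ (subst-scale
                     (f 0) (tail g)))))))) ⟩
          const (f 0) * const (g 0) + q * (y * (const (f 0) * σ (tail g) + σ (tail f * g)))
            ≈⟨ +-mod m-refl (q*-mod (*-mod m-refl (+-mod m-refl (go N (tail f))))) ⟩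
          const (f 0) * const (g 0) + q * (y * (const (f 0) * σ (tail g) + σ (tail f) * σ g))
            ≈⟨ ≈⇒mod (+-congˡ (≈-trans (*-congˡ (distribˡ _ _ _)) (distribˡ _ _ _))) ⟩
          const (f 0) * const (g 0) + (q * (y * (const (f 0) * σ (tail g))) + q * (y * (σ (tail f) * σ g)))
            ≈⟨ ≈⇒mod (+-assoc _ _ _) ⟨
          const (f 0) * const (g 0) + q * (y * (const (f 0) * σ (tail g))) + q * (y * (σ (tail f) * σ g))
            ≈⟨ ≈⇒mod (+-cong (+-congˡ (≈-trans (*-congˡ (swap _ _ _)) (swap _ _ _)))
                             (≈-trans (*-congˡ (≈-sym (*-assoc _ _ _))) (≈-sym (*-assoc _ _ _)))) ⟩
          const (f 0) * const (g 0) + const (f 0) * (q * (y * σ (tail g))) + q * (y * σ (tail f)) * σ g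
            ≈⟨ ≈⇒mod (+-congʳ (distribˡ _ _ _)) ⟨
          const (f 0) * (const (g 0) + q * (y * σ (tail g))) + q * (y * σ (tail f)) * σ g
            ≈⟨ ≈⇒mod (+-congʳ (*-congˡ (subst-unfold y g))) ⟨
          const (f 0) * σ g + q * (y * σ (tail f)) * σ g
            ≈⟨ ≈⇒mod (S.distribʳ _ _ _) ⟨
          (const (f 0) + q * (y * σ (tail f))) * σ g
            ≈⟨ ≈⇒mod (*-congʳ (subst-unfold y f)) ⟨
          σ f * σ g ∎
          where
          open mod-Reasoning (suc N)
          open import Algebra.Properties.CommutativeSemigroup S.*-commutativeSemigroup using () renaming (x∙yz≈y∙xz to swap)

    subst-neg : ∀ f → σ (- f) ≈ - σ f
    subst-neg f = inverseʳ-unique (σ f) (σ (- f))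
      (≈-trans (≈-sym (subst-+ f (- f))) (≈-trans (subst-cong (-‿inverseʳ f)) subst-0#))
      where open import Algebra.Properties.Group S.+-group using (inverseʳ-unique)

    subst-^ : ∀ f n → σ (f ^ n) ≈ σ f ^ n
    subst-^ f zero    = subst-const 1ᵣ
    subst-^ f (suc n) = ≈-trans (subst-* f (f ^ n)) (*-congˡ (subst-^ f n))

  subst-congˡ : ∀ {y z} f → y ≈ z → subst y f ≈ subst z f
  subst-congˡ {y} {z} f p = mod-all (λ N → go N f)
    where
    go : ∀ N f → subst y f ≈ subst z f mod-q^ N
    go zero    f = ⟨ (λ ()) ⟩ₘ
    go (suc N) f = m-trans (≈⇒mod (subst-unfold y f)) (m-trans
      (+-mod m-refl (q*-mod (*-mod (≈⇒mod p) (go N (tail f)))))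
      (m-sym (≈⇒mod (subst-unfold z f))))

  -- Sending `q` to `q * x` turns `q * y` into `q * (x * subst x y)`. With a constant for `x` and
  -- `q ^ 4` for `y` this computes a twist of a series in q⁵.
  subst-subst : ∀ x y f → subst x (subst y f) ≈ subst (x * subst x y) f
  subst-subst x y f = mod-all (λ N → go N f)
    where
    go : ∀ N f → subst x (subst y f) ≈ subst (x * subst x y) f mod-q^ N
    go zero    f = ⟨ (λ ()) ⟩ₘ
    go (suc N) f = begin
      subst x (subst y f)
        ≈⟨ ≈⇒mod (≈-trans (subst-cong x (subst-unfold y f)) (≈-trans (subst-+ x (const (f 0)) (q * (y * subst y (tail f))))
             (+-cong (subst-const x (f 0)) (≈-trans (subst-* x q (y * subst y (tail f))) (*-cong (subst-q x) (subst-* x y (subst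
                 y (tail f)))))))) ⟩
      const (f 0) + q * x * (subst x y * subst x (subst y (tail f)))
        ≈⟨ ≈⇒mod (+-congˡ (≈-trans (*-assoc _ _ _) (*-congˡ (≈-sym (*-assoc _ _ _))))) ⟩
      const (f 0) + q * (x * subst x y * subst x (subst y (tail f)))
        ≈⟨ +-mod m-refl (q*-mod (*-mod m-refl (go N (tail f)))) ⟩
      const (f 0) + q * (x * subst x y * subst (x * subst x y) (tail f))
        ≈⟨ ≈⇒mod (subst-unfold (x * subst x y) f) ⟨
      subst (x * subst x y) f ∎
      where open mod-Reasoning (suc N)

  -- The geometric series in 1 - f.
  inv : Series → Series
  inv f = subst (- tail f) (λ _ → 1ᵣ)

  inv-inverse : ∀ f → f 0 ≈ᵣ 1ᵣ → f * inv f ≈ 1#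
  inv-inverse f f₀ = begin
    f * g                             ≈⟨ *-congʳ (head-tail f) ⟩
    (const (f 0) + q * tail f) * g    ≈⟨ *-congʳ (+-congʳ (const-cong f₀)) ⟩
    (1# + q * tail f) * g             ≈⟨ S.distribʳ _ _ _ ⟩
    1# * g + q * tail f * g           ≈⟨ +-cong (*-identityˡ g) (*-assoc _ _ _) ⟩
    g + q * (tail f * g)              ≈⟨ +-congʳ (subst-unfold (- tail f) (λ _ → 1ᵣ)) ⟩
    1# + q * (- tail f * g) + q * (tail f * g) ≈⟨ +-assoc _ _ _ ⟩
    1# + (q * (- tail f * g) + q * (tail f * g)) ≈⟨ +-congˡ (distribˡ _ _ _) ⟨
    1# + q * (- tail f * g + tail f * g) ≈⟨ +-congˡ (*-congˡ (S.distribʳ _ _ _)) ⟨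
    1# + q * ((- tail f + tail f) * g) ≈⟨ +-congˡ (*-congˡ (*-congʳ (S.-‿inverseˡ _))) ⟩
    1# + q * (0# * g)                 ≈⟨ +-congˡ (≈-trans (*-congˡ (zeroˡ g)) (zeroʳ q)) ⟩
    1# + 0#                           ≈⟨ +-identityʳ _ ⟩
    1#                                ∎
    where
    open ≈-Reasoning
    g = inv f

  *-cancelˡ-mod : ∀ {N} f {g h} → f 0 ≈ᵣ 1ᵣ → f * g ≈ f * h mod-q^ N → g ≈ h mod-q^ N
  *-cancelˡ-mod f {g} {h} f₀ p = m-trans (m-sym (≈⇒mod (absorb g))) (m-trans (*-mod m-refl p) (≈⇒mod (absorb h)))
    where
    absorb : ∀ g → inv f * (f * g) ≈ g
    absorb g = ≈-trans (≈-sym (*-assoc _ _ _)) (≈-trans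
      (*-congʳ (≈-trans (*-comm _ _) (inv-inverse f f₀))) (*-identityˡ g))

  *-cancelˡ : ∀ f {g h} → f 0 ≈ᵣ 1ᵣ → f * g ≈ f * h → g ≈ h
  *-cancelˡ f f₀ p = mod-all (λ N → *-cancelˡ-mod f f₀ (≈⇒mod p))

-- Integers modulo p, and series over them

module Residues (p : ℕ) where

  infix 4 _≈_
  record _≈_ (x y : ℤ) : Set where
    constructor ⟨_⟩
    field p∣x-y : + p ∣ℤ x ℤ.- y
  open _≈_ public

  private
    via : ∀ {x y} z → z ≡ x ℤ.- y → + p ∣ℤ z → x ≈ y
    via _ z≡ d = ⟨ ≡.subst (+ p ∣ℤ_) z≡ d ⟩

    open ℤ.+-*-Solver

    ≡⇒≈ : ∀ {x y} → x ≡ y → x ≈ y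
    ≡⇒≈ {x} ≡.refl = via (+ 0 ℤ.* + p) (solve 1 (λ x → con (+ 0) := x :- x) ≡.refl x) (∣.divides (+ 0) ≡.refl)

    ≈-sym : ∀ {x y} → x ≈ y → y ≈ x
    ≈-sym {x} {y} ⟨ d ⟩ = via ((ℤ.- + 1) ℤ.* (x ℤ.- y))
      (solve 2 (λ x y → :- con (+ 1) :* (x :- y) := y :- x) ≡.refl x y) (∣.∣n⇒∣m*n (ℤ.- + 1) d)

    ≈-trans : ∀ {x y z} → x ≈ y → y ≈ z → x ≈ z
    ≈-trans {x} {y} {z} ⟨ d ⟩ ⟨ e ⟩ = via ((x ℤ.- y) ℤ.+ (y ℤ.- z))
      (solve 3 (λ x y z → (x :- y) :+ (y :- z) := x :- z) ≡.refl x y z) (∣.∣m∣n⇒∣m+n d e)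

    +-cong : ∀ {x x′ y y′} → x ≈ x′ → y ≈ y′ → x ℤ.+ y ≈ x′ ℤ.+ y′
    +-cong {x} {x′} {y} {y′} ⟨ d ⟩ ⟨ e ⟩ = via ((x ℤ.- x′) ℤ.+ (y ℤ.- y′))
      (solve 4 (λ x x′ y y′ → (x :- x′) :+ (y :- y′) := (x :+ y) :- (x′ :+ y′)) ≡.refl x x′ y y′) (∣.∣m∣n⇒∣m+n d e)

    *-cong : ∀ {x x′ y y′} → x ≈ x′ → y ≈ y′ → x ℤ.* y ≈ x′ ℤ.* y′
    *-cong {x} {x′} {y} {y′} ⟨ d ⟩ ⟨ e ⟩ = via (y ℤ.* (x ℤ.- x′) ℤ.+ x′ ℤ.* (y ℤ.- y′))
      (solve 4 (λ x x′ y y′ → y :* (x :- x′) :+ x′ :* (y :- y′) := (x :* y) :- (x′ :* y′)) ≡.refl x x′ y y′)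
      (∣.∣m∣n⇒∣m+n (∣.∣n⇒∣m*n y d) (∣.∣n⇒∣m*n x′ e))

    -‿cong : ∀ {x x′} → x ≈ x′ → ℤ.- x ≈ ℤ.- x′
    -‿cong {x} {x′} p = ≈-trans (≡⇒≈ (≡.sym (ℤ.-1*i≡-i x))) (≈-trans (*-cong {ℤ.- + 1} (≡⇒≈ ≡.refl) p) (≡⇒≈ (ℤ.-1*i≡-i x′)))

  commutativeRing : CommutativeRing _ _
  commutativeRing = record
    { Carrier = ℤ ; _≈_ = _≈_ ; _+_ = ℤ._+_ ; _*_ = ℤ._*_ ; -_ = ℤ.-_ ; 0# = + 0 ; 1# = + 1
    ; isCommutativeRing = record
      { isRing = record
        { +-isAbelianGroup = record
          { isGroup = record
            { isMonoid = record
              { isSemigroup = record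
                { isMagma = record
                  { isEquivalence = record { refl = ≡⇒≈ ≡.refl ; sym = ≈-sym ; trans = ≈-trans }
                  ; ∙-cong = +-cong }
                ; assoc = λ x y z → ≡⇒≈ (ℤ.+-assoc x y z) }
              ; identity = (λ x → ≡⇒≈ (ℤ.+-identityˡ x)) , (λ x → ≡⇒≈ (ℤ.+-identityʳ x)) }
            ; inverse = (λ x → ≡⇒≈ (ℤ.+-inverseˡ x)) , (λ x → ≡⇒≈ (ℤ.+-inverseʳ x))
            ; ⁻¹-cong = -‿cong }
          ; comm = λ x y → ≡⇒≈ (ℤ.+-comm x y) }
        ; *-cong = *-cong
        ; *-assoc = λ x y z → ≡⇒≈ (ℤ.*-assoc x y z)
        ; *-identity = (λ x → ≡⇒≈ (ℤ.*-identityˡ x)) , (λ x → ≡⇒≈ (ℤ.*-identityʳ x))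
        ; distrib = (λ x y z → ≡⇒≈ (ℤ.*-distribˡ-+ x y z)) , (λ x y z → ≡⇒≈ (ℤ.*-distribʳ-+ x y z)) }
      ; *-comm = λ x y → ≡⇒≈ (ℤ.*-comm x y) }
    }

  _≟_ : ∀ x y → Maybe (x ≈ y)
  x ≟ y = Maybe.map ≡⇒≈ (dec⇒maybe (x ℤ.≟ y))

  %-≈ : .{{_ : ℕ.NonZero p}} → ∀ x → + (x ℤ.%ℕ p) ≈ x
  %-≈ x = ≈-sym (via (x ℤ./ℕ p ℤ.* + p) eq (∣.divides (x ℤ./ℕ p) ≡.refl))
    where
    eq : x ℤ./ℕ p ℤ.* + p ≡ x ℤ.- + (x ℤ.%ℕ p)
    eq = ≡.trans (solve 2 (λ r m → m := (r :+ m) :- r) ≡.refl (+ (x ℤ.%ℕ p)) (x ℤ./ℕ p ℤ.* + p))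
      (≡.cong (ℤ._- + (x ℤ.%ℕ p)) (≡.sym (ℤ.a≡a%ℕn+[a/ℕn]*n x p)))

module Series (p : ℕ) where
  open Residues p
  open PowerSeries commutativeRing public hiding (commutativeRing)

  private
    coefficients : RawRing _ _
    coefficients = CommutativeRing.rawRing commutativeRing

    target : AlmostCommutativeRing _ _
    target = fromCommutativeRing (PowerSeries.commutativeRing commutativeRing)

    constants : coefficients -Raw-AlmostCommutative⟶ target
    constants = record
      { ⟦_⟧ = const
      ; +-homo = const-+-homo
      ; *-homo = const-*-homo
      ; -‿homo = const-neg
      ; 0-homo = const-0
      ; 1-homo = ≈-refl }

    decide : WeaklyDecidable (Induced-equivalence constants)
    decide x y = Maybe.map const-cong (x ≟ y)

  open RingSolver coefficients target constants decide
    public using (solve; _:=_; _:+_; _:*_; _:-_; :-_; _:^_; con)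

  -- The solver compares coefficients syntactically, so they are kept reduced modulo p.
  module ModularSolver .{{_ : ℕ.NonZero p}} where
    private
      residues : RawRing _ _
      residues = record
        { Carrier = ℤ ; _≈_ = _≡_
        ; _+_ = λ x y → + ((x ℤ.+ y) ℤ.%ℕ p)
        ; _*_ = λ x y → + ((x ℤ.* y) ℤ.%ℕ p)
        ; -_ = λ x → + ((ℤ.- x) ℤ.%ℕ p)
        ; 0# = + 0 ; 1# = + 1 }

      reduced : residues -Raw-AlmostCommutative⟶ target
      reduced = record
        { ⟦_⟧ = const
        ; +-homo = λ x y → ≈-trans (const-cong (%-≈ (x ℤ.+ y))) (const-+-homo x y)
        ; *-homo = λ x y → ≈-trans (const-cong (%-≈ (x ℤ.* y))) (const-*-homo x y)
        ; -‿homo = λ x → ≈-trans (const-cong (%-≈ (ℤ.- x))) (const-neg x)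
        ; 0-homo = const-0
        ; 1-homo = ≈-refl }

      decide-reduced : WeaklyDecidable (Induced-equivalence reduced)
      decide-reduced x y = Maybe.map const-cong (x ≟ y)

    open RingSolver residues target reduced decide-reduced
      public using (solve; _:=_; _:+_; _:*_; _:-_; :-_; _:^_; con)

module Sums (p : ℕ) where
  open Series p

  ∑ : ℕ → (ℕ → Series) → Series
  ∑ zero    f = 0#
  ∑ (suc n) f = ∑ n f + f n

  ∑-cong : ∀ n {f g : ℕ → Series} → (∀ {i} → i < n → f i ≈ g i) → ∑ n f ≈ ∑ n g
  ∑-cong zero    p = ≈-refl
  ∑-cong (suc n) p = +-cong (∑-cong n (λ i<n → p (ℕ.m≤n⇒m≤1+n i<n))) (p ℕ.≤-refl)

  ∑-mod : ∀ n {N} {f g : ℕ → Series} → (∀ {i} → i < n → f i ≈ g i mod-q^ N) → ∑ n f ≈ ∑ n g mod-q^ N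
  ∑-mod zero    p = m-refl
  ∑-mod (suc n) p = +-mod (∑-mod n (λ i<n → p (ℕ.m≤n⇒m≤1+n i<n))) (p ℕ.≤-refl)

  ∑-+ : ∀ n f g → ∑ n (λ i → f i + g i) ≈ ∑ n f + ∑ n g
  ∑-+ zero    f g = ≈-sym (+-identityˡ 0#)
  ∑-+ (suc n) f g = ≈-trans (+-congʳ (∑-+ n f g))
    (solve 4 (λ a b c d → (a :+ b) :+ (c :+ d) := (a :+ c) :+ (b :+ d)) ≈-refl (∑ n f) (∑ n g) (f n) (g n))

  ∑-*ˡ : ∀ n x f → ∑ n (λ i → x * f i) ≈ x * ∑ n f
  ∑-*ˡ zero    x f = ≈-sym (zeroʳ x)
  ∑-*ˡ (suc n) x f = ≈-trans (+-congʳ (∑-*ˡ n x f)) (≈-sym (distribˡ x (∑ n f) (f n)))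

-- Dissection of a series by the residue of the exponent modulo k

module Dissection (p k-1 : ℕ) where
  open Series p
  open Sums p
  private module R = CommutativeRing (Residues.commutativeRing p)

  private k = suc k-1

  -- As `subst y` inserts `q * y`, this is f(q) ↦ f(q^k).
  V : Series → Series
  V = subst (q ^ k-1)

  E : ℕ → Series → Series
  E s f n = f (n ℕ.* k ℕ.+ s)

  V-cong : ∀ {f g} → f ≈ g → V f ≈ V g
  V-cong = subst-cong (q ^ k-1)
  V-mod : ∀ {N f g} → f ≈ g mod-q^ N → V f ≈ V g mod-q^ N
  V-mod = subst-mod (q ^ k-1)
  V-+ : ∀ f g → V (f + g) ≈ V f + V g
  V-+ = subst-+ (q ^ k-1)
  V-* : ∀ f g → V (f * g) ≈ V f * V g
  V-* = subst-* (q ^ k-1)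
  V-neg : ∀ f → V (- f) ≈ - V f
  V-neg = subst-neg (q ^ k-1)
  V-^ : ∀ f n → V (f ^ n) ≈ V f ^ n
  V-^ = subst-^ (q ^ k-1)
  V-const : ∀ x → V (const x) ≈ const x
  V-const = subst-const (q ^ k-1)
  V-q : V q ≈ q ^ k
  V-q = subst-q (q ^ k-1)
  V-q^ : ∀ n → V (q ^ n) ≈ q ^ (k ℕ.* n)
  V-q^ n = ≈-trans (V-^ q n) (≈-trans (^-congˡ n V-q) (^-assocʳ q k n))

  V-unfold : ∀ f → V f ≈ const (f 0) + q ^ k * V (tail f)
  V-unfold f = ≈-trans (subst-unfold (q ^ k-1) f) (+-congˡ (≈-sym (*-assoc q (q ^ k-1) (V (tail f)))))

  E-cong : ∀ s {f g} → f ≈ g → E s f ≈ E s g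
  E-cong s p = ⟨ (λ n → at p (n ℕ.* k ℕ.+ s)) ⟩

  E-mod : ∀ s {N f g} → f ≈ g mod-q^ (N ℕ.* k ℕ.+ s) → E s f ≈ E s g mod-q^ N
  E-mod s p = ⟨ (λ n<N → below p (ℕ.+-monoˡ-< s (ℕ.*-monoˡ-< k n<N))) ⟩ₘ

  E-+ : ∀ s f g → E s (f + g) ≈ E s f + E s g
  E-+ s f g = ⟨ (λ n → R.trans (R.reflexive (+-at f g (n ℕ.* k ℕ.+ s))) (R.reflexive (≡.sym (+-at (E s f) (E s g) n)))) ⟩

  E-neg : ∀ s f → E s (- f) ≈ - E s f
  E-neg s f = ⟨ (λ n → R.trans (R.reflexive (neg-at f (n ℕ.* k ℕ.+ s))) (R.reflexive (≡.sym (neg-at (E s f) n)))) ⟩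

  E-1-zero : E 0 1# ≈ 1#
  E-1-zero = ⟨ (λ { zero → R.refl ; (suc n) → R.refl }) ⟩

  E-1-suc : ∀ s → E (suc s) 1# ≈ 0#
  E-1-suc s = ⟨ (λ n → R.reflexive (≡.cong 1# (ℕ.+-suc (n ℕ.* k) s))) ⟩

  E-q-suc : ∀ s f → E (suc s) (q * f) ≈ E s f
  E-q-suc s f = ⟨ (λ n → R.trans (R.reflexive (≡.cong (q * f) (ℕ.+-suc (n ℕ.* k) s))) (q*-suc f (n ℕ.* k ℕ.+ s))) ⟩

  -- A shift by one carries the last class into class 0 of the next block; the factor `q` on the
  -- right is that carry.
  E-q-zero : ∀ f → E 0 (q * f) ≈ q * E k-1 f
  E-q-zero f = ⟨ (λ { zero → R.trans (q*-zero f) (R.sym (q*-zero (E k-1 f)))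
    ; (suc n) → R.trans (R.reflexive (≡.cong (q * f) (ℕ.+-identityʳ (suc n ℕ.* k))))
        (R.trans (q*-suc f (k-1 ℕ.+ n ℕ.* k))
        (R.trans (R.reflexive (≡.cong f (ℕ.+-comm k-1 (n ℕ.* k)))) (R.sym (q*-suc (E k-1 f) n)))) }) ⟩

  private
    drop : Series → Series
    drop f n = f (k ℕ.+ n)

    tail-E : ∀ s f → tail (E s f) ≈ E s (drop f)
    tail-E s f = ⟨ (λ n → R.reflexive (≡.cong f (ℕ.+-assoc k (n ℕ.* k) s))) ⟩

    split : ∀ j f → f ≈ ∑ j (λ s → q ^ s * const (f s)) + q ^ j * (λ n → f (j ℕ.+ n))
    split zero    f = ≈-sym (≈-trans (+-identityˡ (1# * f)) (*-identityˡ f))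
    split (suc j) f = begin
      f
        ≈⟨ split j f ⟩
      A + q ^ j * f′
        ≈⟨ +-congˡ (*-congˡ (head-tail f′)) ⟩
      A + q ^ j * (const (f (j ℕ.+ 0)) + q * tail f′)
        ≈⟨ +-congˡ (*-congˡ (+-cong (const-cong (R.reflexive (≡.cong f (ℕ.+-identityʳ j))))
             (*-congˡ ⟨ (λ n → R.reflexive (≡.cong f (ℕ.+-suc j n))) ⟩))) ⟩
      A + q ^ j * (const (f j) + q * f″)
        ≈⟨ solve 5 (λ a x c q g → a :+ x :* (c :+ q :* g) := a :+ x :* c :+ q :* x :* g) ≈-refl A (q ^ j) (const (f j)) q f″ ⟩
      A + q ^ j * const (f j) + q * q ^ j * f″ ∎
      where
      open ≈-Reasoning
      A = ∑ j (λ s → q ^ s * const (f s))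
      f′ f″ : Series
      f′ n = f (j ℕ.+ n)
      f″ n = f (suc j ℕ.+ n)

    E-q^k : ∀ {s} f → s < k → E s (q ^ k * f) ≈ q * E s f
    E-q^k {s} f s<k = ⟨ (λ { zero → R.trans (q^-below k f s<k) (R.sym (q*-zero (E s f)))
      ; (suc n) → R.trans (R.reflexive (≡.cong (q ^ k * f) (ℕ.+-assoc k (n ℕ.* k) s)))
          (R.trans (q^-shift k f (n ℕ.* k ℕ.+ s)) (R.sym (q*-suc (E s f) n))) }) ⟩

  E-const* : ∀ s x f → E s (const x * f) ≈ const x * E s f
  E-const* s x f = ⟨ (λ n → R.trans (const-*-at x f (n ℕ.* k ℕ.+ s)) (R.sym (const-*-at x (E s f) n))) ⟩

  -- Series in q^k are scalars for `E s`: once the constant term of `g` is split off, the rest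
  -- carries `q ^ k`, which leaves `E s` as a single `q`.
  E-V* : ∀ {s} g f → s < k → E s (V g * f) ≈ g * E s f
  E-V* {s} g f s<k = mod-all (λ N → go N g)
    where
    go : ∀ N g → E s (V g * f) ≈ g * E s f mod-q^ N
    go zero    g = ⟨ (λ ()) ⟩ₘ
    go (suc N) g = begin
      E s (V g * f)
        ≈⟨ ≈⇒mod (E-cong s (≈-trans (*-congʳ (V-unfold g))
             (solve 4 (λ c x v f → (c :+ x :* v) :* f := c :* f :+ x :* (v :* f)) ≈-refl (const (g 0)) (q ^ k) (V (tail g)) f))) ⟩
      E s (const (g 0) * f + q ^ k * (V (tail g) * f))
        ≈⟨ ≈⇒mod (E-+ s (const (g 0) * f) (q ^ k * (V (tail g) * f))) ⟩
      E s (const (g 0) * f) + E s (q ^ k * (V (tail g) * f))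
        ≈⟨ ≈⇒mod (+-cong (E-const* s (g 0) f) (E-q^k (V (tail g) * f) s<k)) ⟩
      const (g 0) * E s f + q * E s (V (tail g) * f)
        ≈⟨ +-mod m-refl (q*-mod (go N (tail g))) ⟩
      const (g 0) * E s f + q * (tail g * E s f)
        ≈⟨ ≈⇒mod (solve 4 (λ c q t e → c :* e :+ q :* (t :* e) := (c :+ q :* t) :* e) ≈-refl (const (g 0)) q (tail g) (E s f)) ⟩
      (const (g 0) + q * tail g) * E s f
        ≈⟨ ≈⇒mod (*-congʳ (head-tail g)) ⟨
      g * E s f ∎
      where open mod-Reasoning (suc N)

  E-V : ∀ g → E 0 (V g) ≈ g
  E-V g = ≈-trans (E-cong 0 (≈-sym (*-identityʳ (V g)))) (≈-trans (E-V* g 1# (s≤s z≤n)) (≈-trans (*-congˡ E-1-zero) (*-identityʳ g)))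

  -- `split` takes off the first `k` coefficients and the remainder carries `q ^ k`, so each round
  -- of the induction gains at least one order.
  dissect : ∀ f → f ≈ ∑ k (λ s → q ^ s * V (E s f))
  dissect f = mod-all (λ N → go N f)
    where
    go : ∀ N f → f ≈ ∑ k (λ s → q ^ s * V (E s f)) mod-q^ N
    go zero    f = ⟨ (λ ()) ⟩ₘ
    go (suc N) f = begin
      f
        ≈⟨ ≈⇒mod (split k f) ⟩
      ∑ k (λ s → q ^ s * const (f s)) + q ^ k * drop f
        ≈⟨ +-mod m-refl (mod-weaken (s≤s (ℕ.m≤n+m N k-1)) (q^*-mod k (go N (drop f)))) ⟩
      ∑ k (λ s → q ^ s * const (f s)) + q ^ k * ∑ k (λ s → q ^ s * V (E s (drop f)))
        ≈⟨ ≈⇒mod (+-congˡ (∑-*ˡ k (q ^ k) (λ s → q ^ s * V (E s (drop f))))) ⟨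
      ∑ k (λ s → q ^ s * const (f s)) + ∑ k (λ s → q ^ k * (q ^ s * V (E s (drop f))))
        ≈⟨ ≈⇒mod (∑-+ k (λ s → q ^ s * const (f s)) (λ s → q ^ k * (q ^ s * V (E s (drop f))))) ⟨
      ∑ k (λ s → q ^ s * const (f s) + q ^ k * (q ^ s * V (E s (drop f))))
        ≈⟨ ≈⇒mod (∑-cong k (λ {s} _ → fold s)) ⟩
      ∑ k (λ s → q ^ s * V (E s f)) ∎
      where
      open mod-Reasoning (suc N)
      fold : ∀ s → q ^ s * const (f s) + q ^ k * (q ^ s * V (E s (drop f))) ≈ q ^ s * V (E s f)
      fold s = ≈-trans (solve 4 (λ x c y v → x :* c :+ y :* (x :* v) := x :* (c :+ y :* v)) ≈-refl (q ^ s) (const (f s)) (q ^ k)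
          (V (E s (drop f))))
        (*-congˡ (≈-sym (≈-trans (V-unfold (E s f)) (+-congˡ (*-congˡ (V-cong (tail-E s f)))))))

-- Euler products and generating functions of regular partitions

module EulerProducts (p : ℕ) where
  open Series p
  open Sums p
  private module R = CommutativeRing (Residues.commutativeRing p)

  infixl 7 _/_
  P : ℕ → ℕ → Series
  P l zero    = 1#
  P l (suc n) = P l n * (1# + - q ^ (l ℕ.* suc n))

  *-[1-q^]-mod : ∀ {N e} x → N ≤ e → x * (1# + - q ^ e) ≈ x mod-q^ N
  *-[1-q^]-mod {N} {e} x N≤e = begin
    x * (1# + - q ^ e)    ≈⟨ ≈⇒mod (solve 2 (λ x y → x :* (con (+ 1) :- y) := x :- y :* x) ≈-refl x (q ^ e)) ⟩
    x + - (q ^ e * x)     ≈⟨ +-mod m-refl (neg-mod (q^-small x N≤e)) ⟩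
    x + - 0#              ≈⟨ ≈⇒mod (≈-trans (+-congˡ (-‿cong (≈-sym const-0)))
                              (solve 1 (λ x → x :- con (+ 0) := x) ≈-refl x)) ⟩
    x                     ∎
    where open mod-Reasoning N

  stable : ∀ (F : ℕ → Series) {M} → (∀ {n} → M ≤ n → F (suc n) ≈ F n mod-q^ suc M) → ∀ d → F (d ℕ.+ M) ≈ F M mod-q^ suc M
  stable F step zero    = m-refl
  stable F step (suc d) = m-trans (step (ℕ.m≤n+m _ d)) (stable F step d)

  module _ (l : ℕ) .{{_ : ℕ.NonZero l}} where

    -- f l is the product of (1 - q^{lj}) over j ≥ 1.
    f : Series
    f n = P l n n

    -- A factor of index above `n` differs from 1 only at an exponent of at least l(n + 1), beyond
    -- `n`. Hence coefficient `n` is final after `n` factors, which justifies the diagonal in the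
    -- definition of `f`.
    P-stable : ∀ n d → P l (d ℕ.+ n) ≈ P l n mod-q^ suc n
    P-stable n = stable (P l) (λ {k} n≤k → *-[1-q^]-mod (P l k) (ℕ.≤-trans (s≤s n≤k) (ℕ.m≤n*m (suc k) l)))

    f≈P : ∀ n → f ≈ P l n mod-q^ suc n
    f≈P n = ⟨ (λ { {k} (s≤s k≤n) → R.sym (R.trans
      (R.reflexive (≡.cong (λ j → P l j k) (≡.sym (ℕ.m∸n+n≡m k≤n)))) (below (P-stable k (n ℕ.∸ k)) ℕ.≤-refl)) }) ⟩ₘ

    P-head : ∀ n → P l n 0 R.≈ + 1
    P-head n = R.sym (below (f≈P n) (s≤s z≤n))

  f-head : ∀ l .{{_ : ℕ.NonZero l}} → f l 0 R.≈ + 1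
  f-head l = R.refl

  _/_ : Series → Series → Series
  x / y = x * inv y

-- From lists of parts to generating functions

module GeneratingFunction (p : ℕ) where
  open Series p
  open Sums p
  open EulerProducts p
  private module R = CommutativeRing (Residues.commutativeRing p)

  private variable
    A C T : Set

  -- The Iverson bracket, as a constant series so that it can multiply powers of `q`.
  ⟦_⟧ : Dec A → Series
  ⟦ d ⟧ = const (if does d then + 1 else + 0)

  ⟦⟧-cong : (a : Dec A) (c : Dec C) → (A → C) → (C → A) → ⟦ a ⟧ ≈ ⟦ c ⟧
  ⟦⟧-cong (yes a) (yes c) f g = ≈-refl
  ⟦⟧-cong (yes a) (no ¬c) f g = ⊥-elim (¬c (f a))
  ⟦⟧-cong (no ¬a) (yes c) f g = ⊥-elim (¬a (g c))
  ⟦⟧-cong (no ¬a) (no ¬c) f g = ≈-refl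

  ⟦⟧-× : (a : Dec A) (c : Dec C) → ⟦ a ×-dec c ⟧ ≈ ⟦ a ⟧ * ⟦ c ⟧
  ⟦⟧-× (yes a) (yes c) = const-*-homo (+ 1) (+ 1)
  ⟦⟧-× (yes a) (no ¬c) = const-*-homo (+ 1) (+ 0)
  ⟦⟧-× (no ¬a) (yes c) = const-*-homo (+ 0) (+ 1)
  ⟦⟧-× (no ¬a) (no ¬c) = const-*-homo (+ 0) (+ 0)

  ∑ₗ : (A → Series) → List A → Series
  ∑ₗ t []       = 0#
  ∑ₗ t (x ∷ xs) = t x + ∑ₗ t xs

  ∑ₗ-cong : {t u : A → Series} → ∀ xs → (∀ {x} → x ∈ xs → t x ≈ u x) → ∑ₗ t xs ≈ ∑ₗ u xs
  ∑ₗ-cong []       e = ≈-refl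
  ∑ₗ-cong (x ∷ xs) e = +-cong (e (here ≡.refl)) (∑ₗ-cong xs (λ x∈ → e (there x∈)))

  ∑ₗ-*ˡ : ∀ a {t : A → Series} xs → ∑ₗ (λ x → a * t x) xs ≈ a * ∑ₗ t xs
  ∑ₗ-*ˡ a []           = ≈-sym (zeroʳ a)
  ∑ₗ-*ˡ a {t} (x ∷ xs) = ≈-trans (+-congˡ (∑ₗ-*ˡ a xs)) (≈-sym (distribˡ a (t x) (∑ₗ t xs)))

  ∑ₗ-*ʳ : ∀ a {t : A → Series} xs → ∑ₗ (λ x → t x * a) xs ≈ ∑ₗ t xs * a
  ∑ₗ-*ʳ a {t} xs = ≈-trans (∑ₗ-cong xs (λ _ → *-comm _ a)) (≈-trans (∑ₗ-*ˡ a xs) (*-comm a (∑ₗ t xs)))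

  ∑ₗ-++ : ∀ (t : A → Series) xs ys → ∑ₗ t (xs ++ ys) ≈ ∑ₗ t xs + ∑ₗ t ys
  ∑ₗ-++ t []       ys = ≈-sym (+-identityˡ (∑ₗ t ys))
  ∑ₗ-++ t (x ∷ xs) ys = ≈-trans (+-congˡ (∑ₗ-++ t xs ys)) (≈-sym (+-assoc (t x) (∑ₗ t xs) (∑ₗ t ys)))

  ∑ₗ-map : ∀ (t : A → Series) (g : C → A) xs → ∑ₗ t (map g xs) ≈ ∑ₗ (t ∘ g) xs
  ∑ₗ-map t g []       = ≈-refl
  ∑ₗ-map t g (x ∷ xs) = +-congˡ (∑ₗ-map t g xs)

  ∑ₗ-product : ∀ (t : T → Series) (g : A → C → T) xs ys →
               ∑ₗ t (cartesianProductWith g xs ys) ≈ ∑ₗ (λ x → ∑ₗ (λ y → t (g x y)) ys) xs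
  ∑ₗ-product t g []       ys = ≈-refl
  ∑ₗ-product t g (x ∷ xs) ys = ≈-trans (∑ₗ-++ t (map (g x) ys) (cartesianProductWith g xs ys))
    (+-cong (∑ₗ-map t (g x) ys) (∑ₗ-product t g xs ys))

  ∑ₗ-applyUpTo : ∀ (t : A → Series) g n → ∑ₗ t (applyUpTo g n) ≈ ∑ n (t ∘ g)
  ∑ₗ-applyUpTo t g zero    = ≈-refl
  ∑ₗ-applyUpTo t g (suc n) = ≈-trans (+-congˡ (∑ₗ-applyUpTo t (g ∘ suc) n)) (shift n)
    where
    shift : ∀ n → t (g 0) + ∑ n (t ∘ g ∘ suc) ≈ ∑ (suc n) (t ∘ g)
    shift zero    = +-comm (t (g 0)) 0#
    shift (suc n) = ≈-trans (≈-sym (+-assoc (t (g 0)) (∑ n (t ∘ g ∘ suc)) (t (g (suc n))))) (+-congʳ (shift n))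

  module _ (l : ℕ) where

    isRegularPartition? : ∀ xs → Dec (IsPartition xs × IsRegular l xs)
    isRegularPartition? xs = isPartition? xs ×-dec isRegular? l xs

    weight : List ℕ → Series
    weight xs = ⟦ isRegularPartition? xs ⟧ * q ^ sum xs

    partWeight : ℕ → Series
    partWeight x = ⟦ (0 ℕ.<? x) ×-dec ¬? (l ∣? x) ⟧ * q ^ x

    -- The head becomes the bound for the remaining parts. The order condition is thus tested one
    -- part at a time, and sums over lists satisfy a recursion.
    weight≤ : ℕ → List ℕ → Series
    weight≤ h []       = 1#
    weight≤ h (x ∷ xs) = ⟦ x ℕ.≤? h ⟧ * (partWeight x * weight≤ x xs)

    weight≤-correct : ∀ h xs (good? : Dec (Linked _≥_ (h ∷ xs) × All (0 <_) xs × IsRegular l xs)) →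
                      weight≤ h xs ≈ ⟦ good? ⟧ * q ^ sum xs
    weight≤-correct h []       good? = ≈-trans (≈-sym (*-identityˡ 1#))
      (*-congʳ (⟦⟧-cong (yes ([-] {R = _≥_} {x = h})) good? (λ l → l , [] , []) proj₁))
    weight≤-correct h (x ∷ xs) good? = begin
      ⟦ x≤h ⟧ * (⟦ ok ⟧ * q ^ x * weight≤ x xs)
        ≈⟨ *-congˡ (*-congˡ (weight≤-correct x xs rest)) ⟩
      ⟦ x≤h ⟧ * (⟦ ok ⟧ * q ^ x * (⟦ rest ⟧ * q ^ sum xs))
        ≈⟨ solve 5 (λ a b c d e → a :* (b :* c :* (d :* e)) := a :* (b :* d) :* (c :* e)) ≈-refl
             ⟦ x≤h ⟧ ⟦ ok ⟧ (q ^ x) ⟦ rest ⟧ (q ^ sum xs) ⟩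
      ⟦ x≤h ⟧ * (⟦ ok ⟧ * ⟦ rest ⟧) * (q ^ x * q ^ sum xs)
        ≈⟨ *-cong (≈-trans (*-congˡ (≈-sym (⟦⟧-× ok rest))) (≈-sym (⟦⟧-× x≤h (ok ×-dec rest)))) (≈-sym (^-homo-* q x (sum xs))) ⟩
      ⟦ x≤h ×-dec (ok ×-dec rest) ⟧ * q ^ sum (x ∷ xs)
        ≈⟨ *-congʳ (⟦⟧-cong (x≤h ×-dec (ok ×-dec rest)) good? to from) ⟩
      ⟦ good? ⟧ * q ^ sum (x ∷ xs) ∎
      where
      open ≈-Reasoning
      x≤h = x ℕ.≤? h
      ok = (0 ℕ.<? x) ×-dec ¬? (l ∣? x)
      rest = Linked.linked? ℕ._≥?_ (x ∷ xs) ×-dec (All.all? (0 ℕ.<?_) xs ×-dec isRegular? l xs)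
      to : x ≤ h × (0 < x × ¬ l ∣ x) × Linked _≥_ (x ∷ xs) × All (0 <_) xs × IsRegular l xs →
           Linked _≥_ (h ∷ x ∷ xs) × All (0 <_) (x ∷ xs) × IsRegular l (x ∷ xs)
      to (x≤h , (0<x , l∤x) , L , 0<xs , r) = x≤h ∷ L , 0<x ∷ 0<xs , l∤x ∷ r
      from : Linked _≥_ (h ∷ x ∷ xs) × All (0 <_) (x ∷ xs) × IsRegular l (x ∷ xs) →
             x ≤ h × (0 < x × ¬ l ∣ x) × Linked _≥_ (x ∷ xs) × All (0 <_) xs × IsRegular l xs
      from (x≤h ∷ L , 0<x ∷ 0<xs , l∤x ∷ r) = x≤h , (0<x , l∤x) , L , 0<xs , r

    weight≤≈weight : ∀ {b xs} → All (_≤ b) xs → weight≤ b xs ≈ weight xs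
    weight≤≈weight {b} {xs} xs≤b = ≈-trans
      (weight≤-correct b xs good?)
      (*-congʳ (⟦⟧-cong good? (isRegularPartition? xs)
        (λ { (L , 0<xs , r) → (Linked.tail L , 0<xs) , r })
        (λ { ((L , 0<xs) , r) → cons xs≤b L , 0<xs , r })))
      where
      good? = Linked.linked? ℕ._≥?_ (b ∷ xs) ×-dec (All.all? (0 ℕ.<?_) xs ×-dec isRegular? l xs)
      cons : ∀ {xs} → All (_≤ b) xs → Linked _≥_ xs → Linked _≥_ (b ∷ xs)
      cons []        L = [-]
      cons (x≤b ∷ _) L = x≤b ∷ L

    boundedLists-≤ : ∀ b k {xs} → xs ∈ boundedLists b k → All (_≤ b) xs
    boundedLists-≤ b zero    (here ≡.refl) = []
    boundedLists-≤ b (suc k) (here ≡.refl) = []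
    boundedLists-≤ b (suc k) (there xs∈)
      with ∈-cartesianProductWith⁻ _∷_ (upTo (suc b)) (boundedLists b k) xs∈
    ... | _ , _ , x∈ , ys∈ , ≡.refl = ℕ.≤-pred (∈-upTo⁻ x∈) ∷ boundedLists-≤ b k ys∈

    module _ (b : ℕ) where
      -- For `h` at most `b`: the generating function of `l`-regular partitions into at most `k`
      -- parts, all of them at most `h`.
      W : ℕ → ℕ → Series
      W h k = ∑ₗ (weight≤ h) (boundedLists b k)

      private
        term : ℕ → ℕ → Series
        term k x = partWeight x * W x k

        truncate : ∀ h d k → ∑ (d ℕ.+ suc h) (λ x → ⟦ x ℕ.≤? h ⟧ * term k x) ≈ ∑ (suc h) (term k)
        truncate h zero    k = ∑-cong (suc h) (λ {x} x≤h → ≈-trans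
          (*-congʳ (⟦⟧-cong (x ℕ.≤? h) (yes x≤h) (λ _ → x≤h) ℕ.≤-pred)) (*-identityˡ (term k x)))
        truncate h (suc d) k = begin
          ∑ (d ℕ.+ suc h) (λ x → ⟦ x ℕ.≤? h ⟧ * term k x) + ⟦ d ℕ.+ suc h ℕ.≤? h ⟧ * term k (d ℕ.+ suc h)
            ≈⟨ +-cong (truncate h d k) (≈-trans (*-congʳ (≈-trans
                 (⟦⟧-cong (d ℕ.+ suc h ℕ.≤? h) (no (λ le → ℕ.<-irrefl ≡.refl (ℕ.≤-trans (ℕ.m≤n+m (suc h) d) le))) (λ x → x) (λ x → x))
                 const-0)) (zeroˡ (term k (d ℕ.+ suc h)))) ⟩
          ∑ (suc h) (term k) + 0#
            ≈⟨ +-identityʳ _ ⟩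
          ∑ (suc h) (term k) ∎
          where open ≈-Reasoning

        W-suc : ∀ h k → h ≤ b → W h (suc k) ≈ 1# + ∑ (suc h) (term k)
        W-suc h k h≤b = +-congˡ (begin
          ∑ₗ (weight≤ h) (cartesianProductWith _∷_ (upTo (suc b)) L)
            ≈⟨ ∑ₗ-product (weight≤ h) _∷_ (upTo (suc b)) L ⟩
          ∑ₗ (λ x → ∑ₗ (λ xs → ⟦ x ℕ.≤? h ⟧ * (partWeight x * weight≤ x xs)) L) (upTo (suc b))
            ≈⟨ ∑ₗ-cong (upTo (suc b)) (λ {x} _ → ≈-trans (∑ₗ-*ˡ ⟦ x ℕ.≤? h ⟧ L) (*-congˡ (∑ₗ-*ˡ (partWeight x) L))) ⟩
          ∑ₗ (λ x → ⟦ x ℕ.≤? h ⟧ * term k x) (upTo (suc b))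
            ≈⟨ ∑ₗ-applyUpTo (λ x → ⟦ x ℕ.≤? h ⟧ * term k x) (λ x → x) (suc b) ⟩
          ∑ (suc b) (λ x → ⟦ x ℕ.≤? h ⟧ * term k x)
            ≡⟨ ≡.cong (λ n → ∑ n (λ x → ⟦ x ℕ.≤? h ⟧ * term k x)) (ℕ.m∸n+n≡m (s≤s h≤b)) ⟨
          ∑ ((suc b ℕ.∸ suc h) ℕ.+ suc h) (λ x → ⟦ x ℕ.≤? h ⟧ * term k x)
            ≈⟨ truncate h (suc b ℕ.∸ suc h) k ⟩
          ∑ (suc h) (term k) ∎)
          where
          open ≈-Reasoning
          L = boundedLists b k

      D : ℕ → Series
      D zero    = 1#
      D (suc h) = D h * (1# + - partWeight (suc h))

      private
        D-head : ∀ h → D h ≈ 1# mod-q^ 1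
        D-head zero    = m-refl
        D-head (suc h) = begin
          D h * (1# + - partWeight (suc h))
            ≈⟨ *-mod (D-head h) (+-mod m-refl (neg-mod (m-trans (≈⇒mod (*-comm _ _)) (q^-small {k = suc h} ⟦ (0 ℕ.<? suc h) ×-dec
                 ¬? (l ∣? suc h) ⟧ (s≤s z≤n))))) ⟩
          1# * (1# + - 0#)
            ≈⟨ ≈⇒mod (*-congˡ (+-congˡ (-‿cong (≈-sym const-0)))) ⟩
          1# * (1# + - const (+ 0))
            ≈⟨ ≈⇒mod (solve 0 (con (+ 1) :* (con (+ 1) :- con (+ 0)) := con (+ 1)) ≈-refl) ⟩
          1# ∎
          where open mod-Reasoning 1

      -- A partition counted by W (h+1) (k+1) either avoids the part h+1 or has one copy of it
      -- removed, so W (h+1) (k+1) = W h (k+1) + i q^(h+1) W (h+1) k. Removing a part lowers `k` by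
      -- one, and the power of `q` makes up for the lost order. The order is right because a
      -- partition of size at most `k` has at most `k` parts.
      W*D≈1 : ∀ k h → h ≤ b → W h k * D h ≈ 1# mod-q^ suc k
      W*D≈1 zero h h≤b = begin
        (1# + 0#) * D h ≈⟨ ≈⇒mod (*-congʳ (+-identityʳ 1#)) ⟩
        1# * D h        ≈⟨ ≈⇒mod (*-identityˡ (D h)) ⟩
        D h             ≈⟨ D-head h ⟩
        1#              ∎
        where open mod-Reasoning 1
      W*D≈1 (suc k) zero h≤b = ≈⇒mod (begin
        W 0 (suc k) * 1#       ≈⟨ *-congʳ (W-suc 0 k h≤b) ⟩
        -- The only candidate part is 0, and its bracket evaluates to `const (+ 0)` because `0 < 0`
        -- fails.
        (1# + (0# + const (+ 0) * 1# * W 0 k)) * 1#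
          ≈⟨ *-congʳ (+-congˡ (+-congʳ (≈-sym const-0))) ⟩
        (1# + (const (+ 0) + const (+ 0) * 1# * W 0 k)) * 1#
          ≈⟨ solve 1 (λ w → (con (+ 1) :+ (con (+ 0) :+ con (+ 0) :* con (+ 1) :* w)) :* con (+ 1) := con (+ 1)) ≈-refl (W 0 k) ⟩
        1# ∎)
        where open ≈-Reasoning
      W*D≈1 (suc k) (suc h) h<b = begin
        W (suc h) (suc k) * (D h * (1# + - (i * q ^ suc h)))
          ≈⟨ ≈⇒mod (*-congʳ (W-suc (suc h) k h<b)) ⟩
        (1# + (S + i * q ^ suc h * w)) * (D h * (1# + - (i * q ^ suc h)))
          ≈⟨ ≈⇒mod (solve 6 (λ i q x s w d → (con (+ 1) :+ (s :+ i :* (q :* x) :* w)) :* (d :* (con (+ 1) :- i :* (q :* x)))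
               := (con (+ 1) :+ s) :* d :* (con (+ 1) :- i :* (q :* x)) :+ q :* (i :* x :* (w :* (d :* (con (+ 1) :- i :* (q :* x))))))
               ≈-refl i q (q ^ h) S w (D h)) ⟩
        (1# + S) * D h * (1# + - (i * q ^ suc h)) + q * (i * q ^ h * (w * D (suc h)))
          ≈⟨ +-mod (*-mod (m-trans (≈⇒mod (*-congʳ (≈-sym (W-suc h k (ℕ.<⇒≤ h<b))))) (W*D≈1 (suc k) h (ℕ.<⇒≤ h<b))) m-refl)
               (q*-mod (*-mod m-refl (W*D≈1 k (suc h) h<b))) ⟩
        1# * (1# + - (i * q ^ suc h)) + q * (i * q ^ h * 1#)
          ≈⟨ ≈⇒mod (solve 3 (λ i q x → con (+ 1) :* (con (+ 1) :- i :* (q :* x)) :+ q :* (i :* x :* con (+ 1)) := con (+ 1))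
               ≈-refl i q (q ^ h)) ⟩
        1# ∎
        where
        open mod-Reasoning (suc (suc k))
        S = ∑ (suc h) (term k)
        w = W (suc h) k
        i = ⟦ (0 ℕ.<? suc h) ×-dec ¬? (l ∣? suc h) ⟧

    multiples : ℕ → Series
    multiples zero    = 1#
    multiples (suc h) = multiples h * (1# + - (⟦ l ∣? suc h ⟧ * q ^ suc h))

    -- Each index from 1 to `h` is either a multiple of `l` or not, so exactly one of its two
    -- factors is 1 - q^j and the other one is 1.
    D*multiples : ∀ b h → D b h * multiples h ≈ P 1 h
    D*multiples b zero    = *-identityˡ 1#
    D*multiples b (suc h) = begin
      D b h * (1# + - (⟦ a? ⟧ * q ^ suc h)) * (multiples h * (1# + - (⟦ d? ⟧ * q ^ suc h)))
        ≈⟨ solve 5 (λ d m a b x → d :* (con (+ 1) :- a :* x) :* (m :* (con (+ 1) :- b :* x))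
             := d :* m :* (con (+ 1) :- (a :+ b) :* x :+ a :* b :* x :* x)) ≈-refl
             (D b h) (multiples h) ⟦ a? ⟧ ⟦ d? ⟧ (q ^ suc h) ⟩
      D b h * multiples h * (1# + - ((⟦ a? ⟧ + ⟦ d? ⟧) * q ^ suc h) + ⟦ a? ⟧ * ⟦ d? ⟧ * q ^ suc h * q ^ suc h)
        ≈⟨ *-cong (D*multiples b h) (either a? d? (λ { (_ , l∤) l∣ → l∤ l∣ }) (λ l∤ → s≤s z≤n , l∤)) ⟩
      P 1 h * (1# + - q ^ suc h)
        ≈⟨ *-congˡ (+-congˡ (-‿cong (^-congʳ q (≡.sym (ℕ.*-identityˡ (suc h)))))) ⟩
      P 1 (suc h) ∎
      where
      open ≈-Reasoning
      a? = (0 ℕ.<? suc h) ×-dec ¬? (l ∣? suc h)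
      d? = l ∣? suc h
      either : (a : Dec A) (d : Dec C) → (A → ¬ C) → (¬ C → A) →
        1# + - ((⟦ a ⟧ + ⟦ d ⟧) * q ^ suc h) + ⟦ a ⟧ * ⟦ d ⟧ * q ^ suc h * q ^ suc h ≈ 1# + - q ^ suc h
      either (yes a) (yes c) f g = ⊥-elim (f a c)
      either (no ¬a) (no ¬c) f g = ⊥-elim (¬a (g ¬c))
      either (yes a) (no ¬c) f g = solve 1 (λ x → con (+ 1) :- (con (+ 1) :+ con (+ 0)) :* x :+ con (+ 1) :* con (+ 0) :* x :* x
          := con (+ 1) :- x) ≈-refl (q ^ suc h)
      either (no ¬a) (yes c) f g = solve 1 (λ x → con (+ 1) :- (con (+ 0) :+ con (+ 1)) :* x :+ con (+ 0) :* con (+ 1) :* x :* x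
          := con (+ 1) :- x) ≈-refl (q ^ suc h)

  module _ (l-1 : ℕ) where
    private l = suc l-1

    private
      skip : ∀ n i → i < l → multiples l (i ℕ.+ n ℕ.* l) ≈ multiples l (n ℕ.* l)
      skip n zero    i<l = ≈-refl
      skip n (suc i) i<l = ≈-trans (*-cong (skip n i (ℕ.<⇒≤ i<l))
          (≈-trans (+-congˡ (-‿cong (*-congʳ (⟦⟧-cong (l ∣? _) (no l∤) (λ x → x) (λ x → x)))))
            (solve 1 (λ x → con (+ 1) :- con (+ 0) :* x := con (+ 1)) ≈-refl (q ^ suc (i ℕ.+ n ℕ.* l)))))
        (*-identityʳ (multiples l (n ℕ.* l)))
        where
        l∤ : ¬ l ∣ suc i ℕ.+ n ℕ.* l
        l∤ d = ℕ.<⇒≱ i<l (ℕ∣.∣⇒≤ (ℕ∣.∣m+n∣m⇒∣n (≡.subst (l ∣_) (ℕ.+-comm (suc i) (n ℕ.* l)) d) (ℕ∣.n∣m*n n)))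

    multiples-P : ∀ n → multiples l (n ℕ.* l) ≈ P l n
    multiples-P zero    = ≈-refl
    multiples-P (suc n) = *-cong (≈-trans (skip n l-1 ℕ.≤-refl) (multiples-P n))
      (+-congˡ (-‿cong (≈-trans (*-congʳ (⟦⟧-cong (l ∣? _) (yes (ℕ∣.n∣m*n (suc n))) (λ x → x) (λ x → x)))
        (≈-trans (*-identityˡ _) (^-congʳ q (ℕ.*-comm (suc n) l))))))

    multiples-f : ∀ n → multiples l n ≈ f l mod-q^ suc n
    multiples-f n = begin
      -- Raising the index from `n` to `n * l` changes nothing up to exponent `n`, and at a multiple
      -- of `l` the product is exactly `P l n`.
      multiples l n                            ≈⟨ stable (multiples l) step (n ℕ.* l-1) ⟨
      multiples l (n ℕ.* l-1 ℕ.+ n)            ≡⟨ ≡.cong (multiples l) (≡.trans (ℕ.+-comm (n ℕ.* l-1) n) (≡.sym (ℕ.*-suc n l-1))) ⟩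
      multiples l (n ℕ.* l)                    ≈⟨ ≈⇒mod (multiples-P n) ⟩
      P l n                                    ≈⟨ f≈P l n ⟨
      f l                                      ∎
      where
      open mod-Reasoning (suc n)
      step : ∀ {k} → n ≤ k → multiples l (suc k) ≈ multiples l k mod-q^ suc n
      step {k} n≤k = go (l ∣? suc k)
        where
        go : (d : Dec (l ∣ suc k)) → multiples l k * (1# + - (⟦ d ⟧ * q ^ suc k)) ≈ multiples l k mod-q^ suc n
        go (yes _) = m-trans (≈⇒mod (*-congˡ (+-congˡ (-‿cong (*-identityˡ (q ^ suc k)))))) (*-[1-q^]-mod (multiples l k) (s≤s n≤k))
        go (no  _) = ≈⇒mod (solve 2 (λ m x → m :* (con (+ 1) :- con (+ 0) :* x) := m) ≈-refl (multiples l k) (q ^ suc k))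

    -- After multiplication by f₁, which is `D` times `multiples` to this order, `D` cancels against
    -- the sum over lists and `multiples` remains, an approximation of f_l.
    regularPartitions : ∀ n → ∑ₗ (weight l) (boundedLists n n) ≈ f l / f 1 mod-q^ suc n
    regularPartitions n = *-cancelˡ-mod (f 1) (f-head 1) (begin
      f 1 * ∑ₗ (weight l) L
        ≈⟨ *-mod (f≈P 1 n) (≈⇒mod (∑ₗ-cong L (λ xs∈ → ≈-sym (weight≤≈weight l (boundedLists-≤ l n n xs∈))))) ⟩
      P 1 n * W l n n n
        ≈⟨ ≈⇒mod (*-congʳ (D*multiples l n n)) ⟨
      D l n n * multiples l n * W l n n n
        ≈⟨ ≈⇒mod (solve 3 (λ d m w → d :* m :* w := (w :* d) :* m) ≈-refl (D l n n) (multiples l n) (W l n n n)) ⟩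
      W l n n n * D l n n * multiples l n
        ≈⟨ *-mod (W*D≈1 l n n n ℕ.≤-refl) (multiples-f n) ⟩
      1# * f l
        ≈⟨ ≈⇒mod (*-congʳ (inv-inverse (f 1) (f-head 1))) ⟨
      f 1 * inv (f 1) * f l
        ≈⟨ ≈⇒mod (solve 3 (λ a b c → a :* b :* c := a :* (c :* b)) ≈-refl (f 1) (inv (f 1)) (f l)) ⟩
      f 1 * (f l / f 1) ∎)
      where
      open mod-Reasoning (suc n)
      L = boundedLists n n

  module _ (l m : ℕ) where
    private
      pairWeight : List ℕ × List ℕ → Series
      pairWeight (xs , ys) = weight l xs * weight m ys

      -- A pair contributes its bracket times q^(sum xs + sum ys). Reading off coefficient `n`
      -- imposes the condition on the total size; the bracket imposes all the others.
      coefficient : ∀ n zs → + length (filter (isRegularBipartition? l m n) zs) R.≈ ∑ₗ pairWeight zs n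
      coefficient n [] = R.refl
      coefficient n (z@(xs , ys) ∷ zs) = R.trans (head (isRegularBipartition? l m n z)) (R.reflexive (≡.sym (+-at _ _ n)))
        where
        one : (a : Dec (IsRegularBipartition l m n z)) → + (if does a then 1 else 0) R.≈ pairWeight z n
        one a = R.sym (R.trans (at eq n) (by (isRegularPartition? l xs ×-dec isRegularPartition? m ys) a))
          where
          I = isRegularPartition? l xs
          J = isRegularPartition? m ys
          eq : pairWeight z ≈ ⟦ I ×-dec J ⟧ * q ^ (sum xs ℕ.+ sum ys)
          eq = ≈-trans (solve 4 (λ a b c d → a :* b :* (c :* d) := a :* c :* (b :* d)) ≈-refl ⟦ I ⟧ (q ^ sum xs) ⟦ J ⟧ (q ^ sum ys))
            (*-cong (≈-sym (⟦⟧-× I J)) (≈-sym (^-homo-* q (sum xs) (sum ys))))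
          q^-at : ∀ k → (q ^ k) k R.≈ + 1
          q^-at k = R.trans (R.reflexive (≡.cong (q ^ k) (≡.sym (ℕ.+-identityʳ k))))
            (R.trans (at (≈-sym (*-identityʳ (q ^ k))) (k ℕ.+ 0)) (q^-shift k 1# 0))
          by : (d : Dec ((IsPartition xs × IsRegular l xs) × (IsPartition ys × IsRegular m ys)))
               (a : Dec (IsRegularBipartition l m n z)) →
               (⟦ d ⟧ * q ^ (sum xs ℕ.+ sum ys)) n R.≈ + (if does a then 1 else 0)
          by (yes ((px , rx) , (py , ry))) (yes (_ , ≡.refl , _)) = R.trans (at (*-identityˡ _) n) (q^-at (sum xs ℕ.+ sum ys))
          by (yes ((px , rx) , (py , ry))) (no ¬a) = R.trans (at (*-identityˡ _) n)
            (q^-at≢ (sum xs ℕ.+ sum ys) (λ n≡ → ¬a ((px , py) , ≡.sym n≡ , (rx , ry))))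
          by (no ¬d) (yes ((px , py) , _ , (rx , ry))) = ⊥-elim (¬d ((px , rx) , (py , ry)))
          by (no ¬d) (no ¬a) = R.trans (at (*-congʳ const-0) n) (at (zeroˡ _) n)

        head : Dec (IsRegularBipartition l m n z) →
               + length (filter (isRegularBipartition? l m n) (z ∷ zs)) R.≈ pairWeight z n ℤ.+ ∑ₗ pairWeight zs n
        head (yes a) = R.trans (R.reflexive (≡.cong (λ ws → + length ws) (filter-accept (isRegularBipartition? l m n) a)))
          (R.+-cong (one (yes a)) (coefficient n zs))
        head (no ¬a) = R.trans (R.reflexive (≡.cong (λ ws → + length ws) (filter-reject (isRegularBipartition? l m n) ¬a)))
          (R.trans (R.sym (R.+-identityˡ _)) (R.+-cong (one (no ¬a)) (coefficient n zs)))

    B-coefficient : ∀ n → + B l m n R.≈ (∑ₗ (weight l) (boundedLists n n) * ∑ₗ (weight m) (boundedLists n n)) n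
    B-coefficient n = R.trans (coefficient n (cartesianProduct L L)) (at (begin
      ∑ₗ pairWeight (cartesianProduct L L)
        ≈⟨ ∑ₗ-product pairWeight _,_ L L ⟩
      ∑ₗ (λ xs → ∑ₗ (λ ys → weight l xs * weight m ys) L) L
        ≈⟨ ∑ₗ-cong L (λ {xs} _ → ∑ₗ-*ˡ (weight l xs) L) ⟩
      ∑ₗ (λ xs → weight l xs * ∑ₗ (weight m) L) L
        ≈⟨ ∑ₗ-*ʳ (∑ₗ (weight m) L) L ⟩
      ∑ₗ (weight l) L * ∑ₗ (weight m) L ∎) n)
      where
      open ≈-Reasoning
      L = boundedLists n n

  -- The list of candidates changes with `n`. For each `n` the product of the two sums over lists of
  -- bound `n` is therefore used at coefficient `n` only, where it is accurate.
  B-series : ∀ l m .{{_ : ℕ.NonZero l}} .{{_ : ℕ.NonZero m}} → (λ n → + B l m n) ≈ f l / f 1 * (f m / f 1)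
  B-series (suc l-1) (suc m-1) = ⟨ (λ n → R.trans (B-coefficient (suc l-1) (suc m-1) n)
    (below (*-mod (regularPartitions l-1 n) (regularPartitions m-1 n)) ℕ.≤-refl)) ⟩

-- Euler's pentagonal number theorem

-- The binomial coefficient n(n - 1)/2, kept free of division.
tri : ℕ → ℕ
tri zero    = 0
tri (suc n) = tri n ℕ.+ n

module _ where
  open ℕ.+-*-Solver

  n*n≡ : ∀ n → n ℕ.* n ≡ 2 ℕ.* tri n ℕ.+ n
  n*n≡ zero    = ≡.refl
  n*n≡ (suc n) = ≡.trans (solve 1 (λ n → (con 1 :+ n) :* (con 1 :+ n) := n :* n :+ con 2 :* n :+ con 1) ≡.refl n)
    (≡.trans (≡.cong (λ m → m ℕ.+ 2 ℕ.* n ℕ.+ 1) (n*n≡ n))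
    (solve 2 (λ t n → con 2 :* t :+ n :+ con 2 :* n :+ con 1 := con 2 :* (t :+ n) :+ (con 1 :+ n)) ≡.refl (tri n) n))

  tri-+ : ∀ m n → tri (m ℕ.+ n) ≡ tri m ℕ.+ tri n ℕ.+ m ℕ.* n
  tri-+ zero    n = ≡.sym (ℕ.+-identityʳ (tri n))
  tri-+ (suc m) n = ≡.trans (≡.cong (ℕ._+ (m ℕ.+ n)) (tri-+ m n))
    (solve 4 (λ s t m n → s :+ t :+ m :* n :+ (m :+ n) := s :+ m :+ t :+ (con 1 :+ m) :* n) ≡.refl (tri m) (tri n) m n)

  tri-*5 : ∀ n → tri (n ℕ.* 5) ≡ 25 ℕ.* tri n ℕ.+ 10 ℕ.* n
  tri-*5 zero    = ≡.refl
  tri-*5 (suc n) = ≡.trans (tri-+ 5 (n ℕ.* 5)) (≡.trans (≡.cong (λ m → 10 ℕ.+ m ℕ.+ 5 ℕ.* (n ℕ.* 5)) (tri-*5 n))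
    (solve 2 (λ t n → con 10 :+ (con 25 :* t :+ con 10 :* n) :+ con 5 :* (n :* con 5)
      := con 25 :* (t :+ n) :+ con 10 :* (con 1 :+ n)) ≡.refl (tri n) n))

  tri-+*5 : ∀ r n → tri (r ℕ.+ n ℕ.* 5) ≡ 25 ℕ.* tri n ℕ.+ (10 ℕ.+ 5 ℕ.* r) ℕ.* n ℕ.+ tri r
  tri-+*5 r n = ≡.trans (tri-+ r (n ℕ.* 5)) (≡.trans (≡.cong (λ m → tri r ℕ.+ m ℕ.+ r ℕ.* (n ℕ.* 5)) (tri-*5 n))
    (solve 4 (λ s t n r → s :+ (con 25 :* t :+ con 10 :* n) :+ r :* (n :* con 5)
      := con 25 :* t :+ (con 10 :+ con 5 :* r) :* n :+ s) ≡.refl (tri r) (tri n) n r))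

-- The generalised pentagonal numbers n(3n + 1)/2 and n(3n - 1)/2.
pent⁺ pent⁻ : ℕ → ℕ
pent⁺ n = 3 ℕ.* tri n ℕ.+ 2 ℕ.* n
pent⁻ n = 3 ℕ.* tri n ℕ.+ n

module PentagonalNumbers (p : ℕ) where
  open Series p
  open Sums p
  open EulerProducts p
  private module R = CommutativeRing (Residues.commutativeRing p)

  sgn : ℕ → Series
  sgn n = (- 1#) ^ n

  ι : ℕ → Series
  ι n = inv (P 1 n)

  P*ι : ∀ n → P 1 n * ι n ≈ 1#
  P*ι n = inv-inverse (P 1 n) (P-head 1 n)

  P-suc : ∀ n → P 1 (suc n) ≈ P 1 n * (1# + - q ^ suc n)
  P-suc n = *-congˡ (+-congˡ (-‿cong (^-congʳ q (ℕ.*-identityˡ (suc n)))))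

  ι-suc : ∀ n → ι n ≈ (1# + - q ^ suc n) * ι (suc n)
  ι-suc n = *-cancelˡ (P 1 n) (P-head 1 n) (≈-trans (P*ι n) (≈-sym (≈-trans
    (≈-sym (*-assoc _ _ _)) (≈-trans (*-congʳ (≈-sym (P-suc n))) (P*ι (suc n))))))

  ι-0 : ι 0 ≈ 1#
  ι-0 = ≈-trans (≈-sym (*-identityˡ (ι 0))) (P*ι 0)

  -- Indices k and -(k + 1) of the two-sided pentagonal series are paired, so the terms with k ≥ 0
  -- cover every integer index once.
  pentTerm : ℕ → Series
  pentTerm k = sgn k * (q ^ pent⁺ k + - q ^ pent⁻ (suc k))

  private
    t v : ℕ → ℕ → Series
    t n s = sgn s * ι s * q ^ (s ℕ.* n ℕ.+ tri (suc s))
    v n s = sgn (suc s) * ι s * q ^ (suc s ℕ.* suc n ℕ.+ tri (suc s))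

    -- Each (1 - q^(n+1)) t (n+1) s equals t n s + v n s - v n (s - 1), so only the boundary term
    -- survives. For m = n, multiplication by `P 1 n` clears the denominators of the last summand
    -- and of the boundary term, and their exponents become `pent⁺ n` and `pent⁻ (suc n)`.
    telescope : ∀ n m → (1# + - q ^ suc n) * ∑ (suc m) (t (suc n)) ≈ ∑ (suc m) (t n) + v n m
    telescope n zero = ≈-trans (*-congˡ (+-congʳ (≈-sym const-0))) (≈-trans
      (solve 2 (λ N i → (con (+ 1) :- N) :* (con (+ 0) :+ con (+ 1) :* i :* con (+ 1))
         := con (+ 0) :+ con (+ 1) :* i :* con (+ 1) :+ (:- con (+ 1) :* con (+ 1)) :* i :* N) ≈-refl (q ^ suc n) (ι 0))
      (+-cong (+-congʳ const-0) (*-congˡ (^-congʳ q (≡.sym (≡.trans (ℕ.+-identityʳ _) (ℕ.*-identityˡ (suc n))))))))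
    telescope n (suc m) = begin
      (1# + - N) * (∑ (suc m) (t (suc n)) + t (suc n) (suc m))
        ≈⟨ distribˡ _ _ _ ⟩
      (1# + - N) * ∑ (suc m) (t (suc n)) + (1# + - N) * t (suc n) (suc m)
        ≈⟨ +-cong (telescope n m) (*-congˡ (*-congˡ (exp e₁))) ⟩
      ∑ (suc m) (t n) + v n m + (1# + - N) * (e * i * (Y * M))
        ≈⟨ +-congʳ (+-congˡ (*-cong (*-congˡ (ι-suc m)) (^-congʳ q e₂))) ⟩
      ∑ (suc m) (t n) + e * ((1# + - M) * i) * Y + (1# + - N) * (e * i * (Y * M))
        ≈⟨ solve 6 (λ S e i Y M N → S :+ e :* ((con (+ 1) :- M) :* i) :* Y :+ (con (+ 1) :- N) :* (e :* i :* (Y :* M))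
             := S :+ e :* i :* Y :+ (:- con (+ 1) :* e) :* i :* (Y :* (M :* N))) ≈-refl (∑ (suc m) (t n)) e i Y M N ⟩
      ∑ (suc m) (t n) + e * i * Y + (- 1# * e) * i * (Y * (M * N))
        ≈⟨ +-congˡ (*-congˡ (≈-trans (^-congʳ q e₃) (≈-trans (^-homo-* q y (suc m ℕ.+ suc n)) (*-congˡ (^-homo-* q (suc m) (suc n)))))) ⟨
      ∑ (suc m) (t n) + e * i * Y + v n (suc m) ∎
      where
      open ≈-Reasoning
      open ℕ.+-*-Solver using () renaming (solve to solveℕ; _:=_ to _:≡_; _:+_ to _⊞_; _:*_ to _⊠_; con to #)
      y = suc m ℕ.* n ℕ.+ tri (suc (suc m))
      N = q ^ suc n
      M = q ^ suc m
      Y = q ^ y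
      e = sgn (suc m)
      i = ι (suc m)
      exp : ∀ {x} → x ≡ y ℕ.+ suc m → q ^ x ≈ Y * M
      exp eq = ≈-trans (^-congʳ q eq) (^-homo-* q y (suc m))
      e₁ : suc m ℕ.* suc n ℕ.+ tri (suc (suc m)) ≡ y ℕ.+ suc m
      e₁ = solveℕ 3 (λ m n t → (# 1 ⊞ m) ⊠ (# 1 ⊞ n) ⊞ t :≡ (# 1 ⊞ m) ⊠ n ⊞ t ⊞ (# 1 ⊞ m)) ≡.refl m n (tri (suc (suc m)))
      e₂ : suc m ℕ.* suc n ℕ.+ tri (suc m) ≡ y
      e₂ = solveℕ 3 (λ m n t → (# 1 ⊞ m) ⊠ (# 1 ⊞ n) ⊞ t :≡ (# 1 ⊞ m) ⊠ n ⊞ (t ⊞ (# 1 ⊞ m))) ≡.refl m n (tri (suc m))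
      e₃ : suc (suc m) ℕ.* suc n ℕ.+ tri (suc (suc m)) ≡ y ℕ.+ (suc m ℕ.+ suc n)
      e₃ = solveℕ 3 (λ m n t → (# 2 ⊞ m) ⊠ (# 1 ⊞ n) ⊞ t :≡ (# 1 ⊞ m) ⊠ n ⊞ t ⊞ ((# 1 ⊞ m) ⊞ (# 1 ⊞ n))) ≡.refl m n (tri (suc (suc m)))

    -- Shanks' finite form of Euler's pentagonal number theorem.
    shanks : ∀ n → P 1 n * ∑ n (t n) ≈ ∑ n pentTerm
    shanks zero    = *-identityˡ 0#
    shanks (suc n) = begin
      P 1 (suc n) * ∑ (suc n) (t (suc n))
        ≈⟨ *-congʳ (P-suc n) ⟩
      P 1 n * (1# + - q ^ suc n) * ∑ (suc n) (t (suc n))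
        ≈⟨ *-assoc _ _ _ ⟩
      P 1 n * ((1# + - q ^ suc n) * ∑ (suc n) (t (suc n)))
        ≈⟨ *-congˡ (telescope n n) ⟩
      P 1 n * (∑ n (t n) + sgn n * ι n * q ^ (n ℕ.* n ℕ.+ tri (suc n)) + (- 1# * sgn n) * ι n * q ^ (suc n ℕ.* suc n ℕ.+ tri (suc n)))
        ≈⟨ *-congˡ (+-cong (+-congˡ (*-congˡ (^-congʳ q e₁))) (*-congˡ (^-congʳ q e₂))) ⟩
      P 1 n * (∑ n (t n) + sgn n * ι n * q ^ pent⁺ n + (- 1# * sgn n) * ι n * q ^ pent⁻ (suc n))
        ≈⟨ solve 6 (λ P S s i x y → P :* (S :+ s :* i :* x :+ (:- con (+ 1) :* s) :* i :* y)
             := P :* S :+ P :* i :* (s :* (x :- y))) ≈-refl (P 1 n) (∑ n (t n)) (sgn n) (ι n) (q ^ pent⁺ n) (q ^ pent⁻ (suc n)) ⟩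
      P 1 n * ∑ n (t n) + P 1 n * ι n * pentTerm n
        ≈⟨ +-cong (shanks n) (≈-trans (*-congʳ (P*ι n)) (*-identityˡ (pentTerm n))) ⟩
      ∑ n pentTerm + pentTerm n ∎
      where
      open ≈-Reasoning
      open ℕ.+-*-Solver using () renaming (solve to solveℕ; _:=_ to _:≡_; _:+_ to _⊞_; _:*_ to _⊠_; con to #)
      e₁ : n ℕ.* n ℕ.+ tri (suc n) ≡ pent⁺ n
      e₁ = ≡.trans (≡.cong (ℕ._+ tri (suc n)) (n*n≡ n))
        (solveℕ 2 (λ t n → # 2 ⊠ t ⊞ n ⊞ (t ⊞ n) :≡ # 3 ⊠ t ⊞ # 2 ⊠ n) ≡.refl (tri n) n)
      e₂ : suc n ℕ.* suc n ℕ.+ tri (suc n) ≡ pent⁻ (suc n)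
      e₂ = ≡.trans (≡.cong (ℕ._+ tri (suc n)) (n*n≡ (suc n)))
        (solveℕ 2 (λ t n → # 2 ⊠ t ⊞ n ⊞ t :≡ # 3 ⊠ t ⊞ n) ≡.refl (tri (suc n)) (suc n))

    -- For s ≥ 1 the exponent contains s n, so the summand is divisible by q^n; only s = 0 remains.
    ∑t≈1 : ∀ n m → ∑ (suc m) (t n) ≈ 1# mod-q^ n
    ∑t≈1 n zero = ≈⇒mod (≈-trans (+-identityˡ _) (≈-trans (*-congʳ (*-congˡ ι-0)) (≈-trans (*-identityʳ _) (*-identityʳ _))))
    ∑t≈1 n (suc m) = m-trans (+-mod (∑t≈1 n m)
        (m-trans (≈⇒mod (*-comm _ _)) (q^-small (sgn (suc m) * ι (suc m)) (ℕ.≤-trans (ℕ.m≤m+n n (m ℕ.* n)) (ℕ.m≤m+n (suc m ℕ.* n) _)))))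
      (≈⇒mod (+-identityʳ 1#))

  pentagonal : ∀ n → f 1 ≈ ∑ n pentTerm mod-q^ n
  pentagonal zero      = ⟨ (λ ()) ⟩ₘ
  pentagonal n@(suc m) = begin
    f 1                  ≈⟨ mod-weaken (ℕ.n≤1+n n) (f≈P 1 n) ⟩
    P 1 n                ≈⟨ ≈⇒mod (*-identityʳ (P 1 n)) ⟨
    P 1 n * 1#           ≈⟨ *-mod m-refl (∑t≈1 n m) ⟨
    P 1 n * ∑ n (t n)    ≈⟨ ≈⇒mod (shanks n) ⟩
    ∑ n pentTerm         ∎
    where open mod-Reasoning n

  open Dissection p 4

  V-sgn : ∀ n → V (sgn n) ≈ sgn n
  V-sgn n = ≈-trans (V-^ (- 1#) n) (^-congˡ n (≈-trans (V-neg 1#) (-‿cong (V-const (+ 1)))))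

  private
    -- pent± (r + 5n) is 5 x±ᵣ plus 0 or 2, except that pent⁻ (1 + 5n) = 25 pent⁺ n + 1
    -- and pent⁺ (4 + 5n) = 25 pent⁻ (1 + n) + 1.
    module Blocks (n : ℕ) where
      T = tri n
      x⁺₀ = 15 ℕ.* T ℕ.+ 8 ℕ.* n
      x⁺₁ = 15 ℕ.* T ℕ.+ 11 ℕ.* n
      x⁻₂ = 15 ℕ.* T ℕ.+ 13 ℕ.* n ℕ.+ 1
      x⁺₂ = 15 ℕ.* T ℕ.+ 14 ℕ.* n ℕ.+ 1
      x⁻₃ = 15 ℕ.* T ℕ.+ 16 ℕ.* n ℕ.+ 2
      x⁺₃ = 15 ℕ.* T ℕ.+ 17 ℕ.* n ℕ.+ 3
      x⁻₄ = 15 ℕ.* T ℕ.+ 19 ℕ.* n ℕ.+ 4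
      x⁻₅ = 15 ℕ.* T ℕ.+ 22 ℕ.* n ℕ.+ 7

    -- The powers in the `n`-th block of five terms with exponents 5e, respectively 5e + 2, recorded
    -- with exponent e.
    α β : ℕ → Series
    α n = sgn n * (q ^ x⁺₀ + q ^ x⁻₂ + - q ^ x⁺₃ + - q ^ x⁻₅) where open Blocks n
    β n = sgn n * (- q ^ x⁺₁ + q ^ x⁺₂ + - q ^ x⁻₃ + q ^ x⁻₄) where open Blocks n

    sgn-*5 : ∀ n → sgn (n ℕ.* 5) ≈ sgn n
    sgn-*5 zero    = ≈-refl
    sgn-*5 (suc n) = ≈-trans
      (solve 1 (λ s → :- con (+ 1) :* (:- con (+ 1) :* (:- con (+ 1) :* (:- con (+ 1) :* (:- con (+ 1) :* s)))) := :- con (+ 1)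
          :* s) ≈-refl (sgn (n ℕ.* 5)))
      (*-congˡ (sgn-*5 n))

    q^≈ : ∀ {e} x r → e ≡ 5 ℕ.* x ℕ.+ r → q ^ e ≈ V (q ^ x) * q ^ r
    q^≈ x r e≡ = ≈-trans (^-congʳ q e≡) (≈-trans (^-homo-* q (5 ℕ.* x) r) (*-congʳ (≈-sym (V-q^ x))))

    module _ (n : ℕ) where
      open Blocks n
      open ℕ.+-*-Solver using () renaming (solve to solveℕ; _:=_ to _:≡_; _:+_ to _⊞_; _:*_ to _⊠_; con to #)

      split⁺ : ∀ r x c → 3 ℕ.* (25 ℕ.* T ℕ.+ (10 ℕ.+ 5 ℕ.* r) ℕ.* n ℕ.+ tri r) ℕ.+ 2 ℕ.* (r ℕ.+ n ℕ.* 5) ≡ 5 ℕ.* x ℕ.+ c →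
               q ^ pent⁺ (r ℕ.+ n ℕ.* 5) ≈ V (q ^ x) * q ^ c
      split⁺ r x c eq = q^≈ x c (≡.trans (≡.cong (λ m → 3 ℕ.* m ℕ.+ 2 ℕ.* (r ℕ.+ n ℕ.* 5)) (tri-+*5 r n)) eq)

      split⁻ : ∀ r x c → 3 ℕ.* (25 ℕ.* T ℕ.+ (10 ℕ.+ 5 ℕ.* r) ℕ.* n ℕ.+ tri r) ℕ.+ (r ℕ.+ n ℕ.* 5) ≡ 5 ℕ.* x ℕ.+ c →
               q ^ pent⁻ (r ℕ.+ n ℕ.* 5) ≈ V (q ^ x) * q ^ c
      split⁻ r x c eq = q^≈ x c (≡.trans (≡.cong (λ m → 3 ℕ.* m ℕ.+ (r ℕ.+ n ℕ.* 5)) (tri-+*5 r n)) eq)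

      e⁺₀ : q ^ pent⁺ (0 ℕ.+ n ℕ.* 5) ≈ V (q ^ x⁺₀) * q ^ 0
      e⁺₀ = split⁺ 0 x⁺₀ 0 (solveℕ 2 (λ t n → # 3 ⊠ (# 25 ⊠ t ⊞ # 10 ⊠ n ⊞ # 0) ⊞ # 2 ⊠ (# 0 ⊞ n ⊠ # 5)
        :≡ # 5 ⊠ (# 15 ⊠ t ⊞ # 8 ⊠ n) ⊞ # 0) ≡.refl T n)
      e⁺₁ : q ^ pent⁺ (1 ℕ.+ n ℕ.* 5) ≈ V (q ^ x⁺₁) * q ^ 2
      e⁺₁ = split⁺ 1 x⁺₁ 2 (solveℕ 2 (λ t n → # 3 ⊠ (# 25 ⊠ t ⊞ # 15 ⊠ n ⊞ # 0) ⊞ # 2 ⊠ (# 1 ⊞ n ⊠ # 5)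
        :≡ # 5 ⊠ (# 15 ⊠ t ⊞ # 11 ⊠ n) ⊞ # 2) ≡.refl T n)
      e⁻₂ : q ^ pent⁻ (2 ℕ.+ n ℕ.* 5) ≈ V (q ^ x⁻₂) * q ^ 0
      e⁻₂ = split⁻ 2 x⁻₂ 0 (solveℕ 2 (λ t n → # 3 ⊠ (# 25 ⊠ t ⊞ # 20 ⊠ n ⊞ # 1) ⊞ (# 2 ⊞ n ⊠ # 5)
        :≡ # 5 ⊠ (# 15 ⊠ t ⊞ # 13 ⊠ n ⊞ # 1) ⊞ # 0) ≡.refl T n)
      e⁺₂ : q ^ pent⁺ (2 ℕ.+ n ℕ.* 5) ≈ V (q ^ x⁺₂) * q ^ 2
      e⁺₂ = split⁺ 2 x⁺₂ 2 (solveℕ 2 (λ t n → # 3 ⊠ (# 25 ⊠ t ⊞ # 20 ⊠ n ⊞ # 1) ⊞ # 2 ⊠ (# 2 ⊞ n ⊠ # 5)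
        :≡ # 5 ⊠ (# 15 ⊠ t ⊞ # 14 ⊠ n ⊞ # 1) ⊞ # 2) ≡.refl T n)
      e⁻₃ : q ^ pent⁻ (3 ℕ.+ n ℕ.* 5) ≈ V (q ^ x⁻₃) * q ^ 2
      e⁻₃ = split⁻ 3 x⁻₃ 2 (solveℕ 2 (λ t n → # 3 ⊠ (# 25 ⊠ t ⊞ # 25 ⊠ n ⊞ # 3) ⊞ (# 3 ⊞ n ⊠ # 5)
        :≡ # 5 ⊠ (# 15 ⊠ t ⊞ # 16 ⊠ n ⊞ # 2) ⊞ # 2) ≡.refl T n)
      e⁺₃ : q ^ pent⁺ (3 ℕ.+ n ℕ.* 5) ≈ V (q ^ x⁺₃) * q ^ 0
      e⁺₃ = split⁺ 3 x⁺₃ 0 (solveℕ 2 (λ t n → # 3 ⊠ (# 25 ⊠ t ⊞ # 25 ⊠ n ⊞ # 3) ⊞ # 2 ⊠ (# 3 ⊞ n ⊠ # 5)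
        :≡ # 5 ⊠ (# 15 ⊠ t ⊞ # 17 ⊠ n ⊞ # 3) ⊞ # 0) ≡.refl T n)
      e⁻₄ : q ^ pent⁻ (4 ℕ.+ n ℕ.* 5) ≈ V (q ^ x⁻₄) * q ^ 2
      e⁻₄ = split⁻ 4 x⁻₄ 2 (solveℕ 2 (λ t n → # 3 ⊠ (# 25 ⊠ t ⊞ # 30 ⊠ n ⊞ # 6) ⊞ (# 4 ⊞ n ⊠ # 5)
        :≡ # 5 ⊠ (# 15 ⊠ t ⊞ # 19 ⊠ n ⊞ # 4) ⊞ # 2) ≡.refl T n)
      e⁻₅ : q ^ pent⁻ (5 ℕ.+ n ℕ.* 5) ≈ V (q ^ x⁻₅) * q ^ 0
      e⁻₅ = split⁻ 5 x⁻₅ 0 (solveℕ 2 (λ t n → # 3 ⊠ (# 25 ⊠ t ⊞ # 35 ⊠ n ⊞ # 10) ⊞ (# 5 ⊞ n ⊠ # 5)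
        :≡ # 5 ⊠ (# 15 ⊠ t ⊞ # 22 ⊠ n ⊞ # 7) ⊞ # 0) ≡.refl T n)
      e⁻₁ : q ^ pent⁻ (1 ℕ.+ n ℕ.* 5) ≈ V (V (q ^ pent⁺ n)) * q ^ 1
      e⁻₁ = ≈-trans (split⁻ 1 (5 ℕ.* pent⁺ n) 1 (solveℕ 2 (λ t n → # 3 ⊠ (# 25 ⊠ t ⊞ # 15 ⊠ n ⊞ # 0) ⊞ (# 1 ⊞ n ⊠ # 5)
        :≡ # 5 ⊠ (# 5 ⊠ (# 3 ⊠ t ⊞ # 2 ⊠ n)) ⊞ # 1) ≡.refl T n)) (*-congʳ (V-cong (≈-sym (V-q^ (pent⁺ n)))))
      e⁺₄ : q ^ pent⁺ (4 ℕ.+ n ℕ.* 5) ≈ V (V (q ^ pent⁻ (suc n))) * q ^ 1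
      e⁺₄ = ≈-trans (split⁺ 4 (5 ℕ.* pent⁻ (suc n)) 1 (solveℕ 2 (λ t n → # 3 ⊠ (# 25 ⊠ t ⊞ # 30 ⊠ n ⊞ # 6) ⊞ # 2 ⊠ (# 4 ⊞ n ⊠ # 5)
        :≡ # 5 ⊠ (# 5 ⊠ (# 3 ⊠ (t ⊞ n) ⊞ (# 1 ⊞ n))) ⊞ # 1) ≡.refl T n)) (*-congʳ (V-cong (≈-sym (V-q^ (pent⁻ (suc n))))))

      V-comb : ∀ s a b c d → V (sgn s * (a + b + c + d)) ≈ sgn s * (V a + V b + V c + V d)
      V-comb s a b c d = ≈-trans (V-* (sgn s) (a + b + c + d)) (*-cong (V-sgn s)
        (≈-trans (V-+ (a + b + c) d) (+-congʳ (≈-trans (V-+ (a + b) c) (+-congʳ (V-+ a b))))))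

      V-pentTerm : V (V (- pentTerm n)) ≈ - (sgn n * (V (V (q ^ pent⁺ n)) + - V (V (q ^ pent⁻ (suc n)))))
      V-pentTerm = ≈-trans (V-cong (step (sgn n) (V-sgn n) (q ^ pent⁺ n) (q ^ pent⁻ (suc n))))
        (step (sgn n) (V-sgn n) (V (q ^ pent⁺ n)) (V (q ^ pent⁻ (suc n))))
        where
        step : ∀ s → V s ≈ s → ∀ a b → V (- (s * (a + - b))) ≈ - (s * (V a + - V b))
        step s Vs a b = ≈-trans (V-neg (s * (a + - b))) (-‿cong (≈-trans (V-* s (a + - b))
          (*-cong Vs (≈-trans (V-+ a (- b)) (+-congˡ (V-neg b))))))

      -- The ten exponents fall into the classes 0, 1 and 2 modulo 5. The two in class 1 are 25
      -- times the exponents of `pentTerm n`, plus 1, and they occur with the opposite sign.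
      block : pentTerm (n ℕ.* 5) + pentTerm (1 ℕ.+ n ℕ.* 5) + pentTerm (2 ℕ.+ n ℕ.* 5) + pentTerm (3 ℕ.+ n ℕ.* 5) + pentTerm (4 ℕ.+ n ℕ.* 5)
              ≈ V (α n) + q * V (V (- pentTerm n)) + q * (q * V (β n))
      block = begin
        pentTerm (n ℕ.* 5) + pentTerm (1 ℕ.+ n ℕ.* 5) + pentTerm (2 ℕ.+ n ℕ.* 5) + pentTerm (3 ℕ.+ n ℕ.* 5) + pentTerm (4 ℕ.+ n ℕ.* 5)
          ≈⟨ (+-cong (+-cong (+-cong (+-cong (*-congˡ (+-cong e⁺₀ (-‿cong e⁻₁)))
              (*-congˡ (+-cong e⁺₁ (-‿cong e⁻₂))))
              (*-congˡ (+-cong e⁺₂ (-‿cong e⁻₃))))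
              (*-congˡ (+-cong e⁺₃ (-‿cong e⁻₄))))
              (*-congˡ (+-cong e⁺₄ (-‿cong e⁻₅)))) ⟩
        sgn (0 ℕ.+ n ℕ.* 5) * (X⁺₀ * q ^ 0 + - (X⁻₁ * q ^ 1))
          + sgn (1 ℕ.+ n ℕ.* 5) * (X⁺₁ * q ^ 2 + - (X⁻₂ * q ^ 0))
          + sgn (2 ℕ.+ n ℕ.* 5) * (X⁺₂ * q ^ 2 + - (X⁻₃ * q ^ 2))
          + sgn (3 ℕ.+ n ℕ.* 5) * (X⁺₃ * q ^ 0 + - (X⁻₄ * q ^ 2))
          + sgn (4 ℕ.+ n ℕ.* 5) * (X⁺₄ * q ^ 1 + - (X⁻₅ * q ^ 0))
          ≈⟨ solve 12 (λ q s a b c d e f g h i j →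
               s :* (a :* q :^ 0 :- i :* q :^ 1)
               :+ (:- con (+ 1) :* s) :* (e :* q :^ 2 :- b :* q :^ 0)
               :+ (:- con (+ 1) :* (:- con (+ 1) :* s)) :* (f :* q :^ 2 :- g :* q :^ 2)
               :+ (:- con (+ 1) :* (:- con (+ 1) :* (:- con (+ 1) :* s))) :* (c :* q :^ 0 :- h :* q :^ 2)
               :+ (:- con (+ 1) :* (:- con (+ 1) :* (:- con (+ 1) :* (:- con (+ 1) :* s)))) :* (j :* q :^ 1 :- d :* q :^ 0)
               := s :* (a :+ b :+ :- c :+ :- d) :+ q :* (:- (s :* (i :- j))) :+ q :* (q :* (s :* (:- e :+ f :+ :- g :+ h)))) ≈-refl
               q (sgn (n ℕ.* 5)) X⁺₀ X⁻₂ X⁺₃ X⁻₅ X⁺₁ X⁺₂ X⁻₃ X⁻₄ X⁻₁ X⁺₄ ⟩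
        sgn (n ℕ.* 5) * (X⁺₀ + X⁻₂ + - X⁺₃ + - X⁻₅) + q * (- (sgn (n ℕ.* 5) * (X⁻₁ + - X⁺₄)))
          + q * (q * (sgn (n ℕ.* 5) * (- X⁺₁ + X⁺₂ + - X⁻₃ + X⁻₄)))
          ≈⟨ +-cong (+-cong (*-congʳ s₅) (*-congˡ (-‿cong (*-congʳ s₅)))) (*-congˡ (*-congˡ (*-congʳ s₅))) ⟩
        sgn n * (X⁺₀ + X⁻₂ + - X⁺₃ + - X⁻₅) + q * (- (sgn n * (X⁻₁ + - X⁺₄)))
          + q * (q * (sgn n * (- X⁺₁ + X⁺₂ + - X⁻₃ + X⁻₄)))
          ≈⟨ +-cong (+-cong (*-congˡ (+-cong (+-congˡ (V-neg (q ^ x⁺₃))) (V-neg (q ^ x⁻₅)))) (*-congˡ V-pentTerm))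
                    (*-congˡ (*-congˡ (*-congˡ (+-congʳ (+-cong (+-congʳ (V-neg (q ^ x⁺₁))) (V-neg (q ^ x⁻₃))))))) ⟨
        sgn n * (X⁺₀ + X⁻₂ + V (- q ^ x⁺₃) + V (- q ^ x⁻₅)) + q * V (V (- pentTerm n))
          + q * (q * (sgn n * (V (- q ^ x⁺₁) + X⁺₂ + V (- q ^ x⁻₃) + X⁻₄)))
          ≈⟨ +-cong (+-congʳ (V-comb n (q ^ x⁺₀) (q ^ x⁻₂) (- q ^ x⁺₃) (- q ^ x⁻₅)))
                    (*-congˡ (*-congˡ (V-comb n (- q ^ x⁺₁) (q ^ x⁺₂) (- q ^ x⁻₃) (q ^ x⁻₄)))) ⟨
        V (α n) + q * V (V (- pentTerm n)) + q * (q * V (β n)) ∎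
        where
        open ≈-Reasoning
        s₅ = sgn-*5 n
        X⁺₀ = V (q ^ x⁺₀)
        X⁻₂ = V (q ^ x⁻₂)
        X⁺₃ = V (q ^ x⁺₃)
        X⁻₅ = V (q ^ x⁻₅)
        X⁺₁ = V (q ^ x⁺₁)
        X⁺₂ = V (q ^ x⁺₂)
        X⁻₃ = V (q ^ x⁻₃)
        X⁻₄ = V (q ^ x⁻₄)
        X⁻₁ = V (V (q ^ pent⁺ n))
        X⁺₄ = V (V (q ^ pent⁻ (suc n)))

  pent-dissection : ∀ n → ∑ (n ℕ.* 5) pentTerm ≈ V (∑ n α) + q * V (V (- ∑ n pentTerm)) + q * (q * V (∑ n β))
  pent-dissection zero = ≈-sym (begin
    V 0# + q * V (V (- 0#)) + q * (q * V 0#)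
      ≈⟨ +-cong (+-cong V-0 (*-congˡ (≈-trans (V-cong (V-cong -0≈0)) (≈-trans (V-cong V-0) V-0)))) (*-congˡ (*-congˡ V-0)) ⟩
    0# + q * 0# + q * (q * 0#)
      ≈⟨ +-cong (≈-trans (+-identityˡ _) (zeroʳ q)) (≈-trans (*-congˡ (zeroʳ q)) (zeroʳ q)) ⟩
    0# + 0#
      ≈⟨ +-identityˡ 0# ⟩
    0# ∎)
    where
    open ≈-Reasoning
    V-0 : V 0# ≈ 0#
    V-0 = subst-0# (q ^ 4)
    -0≈0 : - 0# ≈ 0#
    -0≈0 = ≈-trans (≈-sym (+-identityˡ (- 0#))) (-‿inverseʳ 0#)
  pent-dissection (suc n) = begin
    S + t₀ + t₁ + t₂ + t₃ + t₄
      ≈⟨ solve 6 (λ S a b c d e → S :+ a :+ b :+ c :+ d :+ e := S :+ (a :+ b :+ c :+ d :+ e)) ≈-refl S t₀ t₁ t₂ t₃ t₄ ⟩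
    S + (t₀ + t₁ + t₂ + t₃ + t₄)
      ≈⟨ +-cong (pent-dissection n) (block n) ⟩
    V A + q * V (V (- Z)) + q * (q * V B′) + (V (α n) + q * V (V (- z)) + q * (q * V (β n)))
      ≈⟨ solve 7 (λ q a b c d e f → a :+ q :* b :+ q :* (q :* c) :+ (d :+ q :* e :+ q :* (q :* f))
           := (a :+ d) :+ q :* (b :+ e) :+ q :* (q :* (c :+ f))) ≈-refl q (V A) (V (V (- Z))) (V B′) (V (α n)) (V (V (- z))) (V (β n)) ⟩
    (V A + V (α n)) + q * (V (V (- Z)) + V (V (- z))) + q * (q * (V B′ + V (β n)))
      ≈⟨ +-cong (+-cong (V-+ A (α n)) (*-congˡ (≈-trans (V-cong (≈-trans (V-cong neg-+) (V-+ (- Z) (- z)))) (V-+ (V (- Z)) (V (- z))))))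
           (*-congˡ (*-congˡ (V-+ B′ (β n)))) ⟨
    V (∑ (suc n) α) + q * V (V (- ∑ (suc n) pentTerm)) + q * (q * V (∑ (suc n) β)) ∎
    where
    open ≈-Reasoning
    S = ∑ (n ℕ.* 5) pentTerm
    t₀ = pentTerm (n ℕ.* 5)
    t₁ = pentTerm (1 ℕ.+ n ℕ.* 5)
    t₂ = pentTerm (2 ℕ.+ n ℕ.* 5)
    t₃ = pentTerm (3 ℕ.+ n ℕ.* 5)
    t₄ = pentTerm (4 ℕ.+ n ℕ.* 5)
    A = ∑ n α
    B′ = ∑ n β
    Z = ∑ n pentTerm
    z = pentTerm n
    neg-+ : - (Z + z) ≈ - Z + - z
    neg-+ = solve 2 (λ a b → :- (a :+ b) := :- a :+ :- b) ≈-refl Z z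

  private
    module _ (s : ℕ) (s<5 : s < 5) {e₀ e₁ e₂ : Series} (E-1 : E s 1# ≈ e₀) (E-q : E s q ≈ e₁) (E-q² : E s (q * q) ≈ e₂) where
      -- Treats all classes at once: the values of `E s` on 1, q and q² decide which of the three
      -- parts of the dissection survive.
      E-f₁ : ∀ N → E s (f 1) ≈ ∑ (suc N) α * e₀ + - V (f 1) * e₁ + ∑ (suc N) β * e₂ mod-q^ N
      E-f₁ N = begin
        E s (f 1)
          ≈⟨ E-mod s (mod-weaken bound (pentagonal (suc N ℕ.* 5))) ⟩
        E s (∑ (suc N ℕ.* 5) pentTerm)
          ≈⟨ ≈⇒mod (E-cong s (≈-trans (pent-dissection (suc N)) (solve 4 (λ a b c q → a :+ q :* b :+ q :* (q :* c) := a :* con (+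
               1) :+ b :* q :+ c :* (q :* q)) ≈-refl (V A) (V C) (V B′) q))) ⟩
        E s (V A * 1# + V C * q + V B′ * (q * q))
          ≈⟨ ≈⇒mod (≈-trans (E-+ s _ _) (+-congʳ (E-+ s _ _))) ⟩
        E s (V A * 1#) + E s (V C * q) + E s (V B′ * (q * q))
          ≈⟨ ≈⇒mod (+-cong (+-cong (≈-trans (E-V* A 1# s<5) (*-congˡ E-1)) (≈-trans (E-V* C q s<5) (*-congˡ E-q)))
               (≈-trans (E-V* B′ (q * q) s<5) (*-congˡ E-q²))) ⟩
        A * e₀ + C * e₁ + B′ * e₂
          ≈⟨ +-mod (+-mod m-refl (*-mod (m-trans (≈⇒mod (V-neg (∑ (suc N) pentTerm))) (neg-mod (m-sym (V-mod (mod-weaken (ℕ.n≤1+n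
               N) (pentagonal (suc N))))))) m-refl)) m-refl ⟩
        A * e₀ + - V (f 1) * e₁ + B′ * e₂ ∎
        where
        open mod-Reasoning N
        A = ∑ (suc N) α
        B′ = ∑ (suc N) β
        C = V (- ∑ (suc N) pentTerm)
        bound : N ℕ.* 5 ℕ.+ s ≤ suc N ℕ.* 5
        bound = ℕ.≤-trans (ℕ.+-monoʳ-≤ (N ℕ.* 5) (ℕ.<⇒≤ s<5)) (ℕ.≤-reflexive (ℕ.+-comm (N ℕ.* 5) 5))

    E-q : ∀ s → E (suc s) q ≈ E s 1#
    E-q s = ≈-trans (E-cong (suc s) (≈-sym (*-identityʳ q))) (E-q-suc s 1#)

    E-q² : ∀ s → E (suc (suc s)) (q * q) ≈ E s 1#
    E-q² s = ≈-trans (E-q-suc (suc s) q) (E-q s)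

  -- The class 1 terms repeat the whole pentagonal series, so f₁ contains -q f₁(q²⁵). This
  -- self-similarity is what brings f₅ into the dissection.
  E₁-f₁ : E 1 (f 1) ≈ - V (f 1)
  E₁-f₁ = mod-all (λ N → m-trans (E-f₁ 1 (s≤s (s≤s z≤n)) (E-1-suc 0) (≈-trans (E-q 0) E-1-zero)
      (≈-trans (E-q-suc 0 q) (≈-trans (E-cong 0 (≈-sym (*-identityʳ q))) (≈-trans (E-q-zero 1#) (≈-trans (*-congˡ (E-1-suc 3))
          (zeroʳ q))))) N)
    (≈⇒mod (≈-trans (+-cong (+-cong (zeroʳ _) (*-identityʳ _)) (zeroʳ _)) (≈-trans (+-identityʳ _) (+-identityˡ _)))))

  private
    vanish : ∀ s → suc (suc (suc s)) < 5 → E (suc (suc (suc s))) (f 1) ≈ 0#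
    vanish s s<5 = mod-all (λ N → m-trans (E-f₁ (suc (suc (suc s))) s<5 (E-1-suc (suc (suc s)))
        (≈-trans (E-q (suc (suc s))) (E-1-suc (suc s))) (≈-trans (E-q² (suc s)) (E-1-suc s)) N)
      (≈⇒mod (≈-trans (+-cong (≈-trans (+-cong (zeroʳ _) (zeroʳ _)) (+-identityˡ 0#)) (zeroʳ _)) (+-identityˡ 0#))))

  E₃-f₁ : E 3 (f 1) ≈ 0#
  E₃-f₁ = vanish 0 (s≤s (s≤s (s≤s (s≤s z≤n))))

  E₄-f₁ : E 4 (f 1) ≈ 0#
  E₄-f₁ = vanish 1 (s≤s (s≤s (s≤s (s≤s (s≤s z≤n)))))

-- Jacobi's identity for the cube of f₁

-- Raising `n` by 5 adds 5(n + 2), so the residues repeat the pattern 0, 0, 1, 3, 1.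
tri%5≢2 : ∀ n → tri n ℕ.% 5 ≢ 2
tri%5≢2 0 ()
tri%5≢2 1 ()
tri%5≢2 2 ()
tri%5≢2 3 ()
tri%5≢2 4 ()
tri%5≢2 (suc (suc (suc (suc (suc n))))) eq = tri%5≢2 n (≡.trans (≡.sym (ℕ.[m+kn]%n≡m%n (tri n) (n ℕ.+ 2) 5))
  (≡.trans (≡.cong (ℕ._% 5) (solve 2 (λ t n → t :+ (n :+ con 2) :* con 5
     := t :+ n :+ (con 1 :+ n) :+ (con 2 :+ n) :+ (con 3 :+ n) :+ (con 4 :+ n)) ≡.refl (tri n) n)) eq))
  where open ℕ.+-*-Solver

n≤tri[1+n] : ∀ n → n ≤ tri (suc n)
n≤tri[1+n] n = ℕ.m≤n+m n (tri n)

module JacobiCube (p : ℕ) where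
  open Series p
  open Sums p
  open EulerProducts p
  open PentagonalNumbers p
  open Dissection p 4
  private module R = CommutativeRing (Residues.commutativeRing p)

  -- δ n j is 1 / P 1 (n - j), read as 0 when j > n.
  δ : ℕ → ℕ → Series
  δ n       zero    = ι n
  δ zero    (suc j) = 0#
  δ (suc n) (suc j) = δ n j

  δ-zero : ∀ {n j} → n < j → δ n j ≈ 0#
  δ-zero {zero}  {suc j} _         = ≈-refl
  δ-zero {suc n} {suc j} (s≤s n<j) = δ-zero n<j

  -- The factor q^j turns 1 - q^(n+1-j) into q^j - q^(n+1), which avoids a subtraction in the
  -- exponent. At j = n + 1 both sides vanish, so the rule holds without a bound on `j`.
  δ-suc : ∀ n j → q ^ j * δ n j ≈ (q ^ j + - q ^ suc n) * δ (suc n) j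
  δ-suc n       zero    = ≈-trans (*-identityˡ (ι n)) (ι-suc n)
  δ-suc zero (suc zero) = ≈-trans (zeroʳ _) (≈-trans (≈-sym (zeroˡ (ι 0))) (*-congʳ (≈-sym (-‿inverseʳ (q ^ 1)))))
  δ-suc zero (suc (suc j)) = ≈-trans (zeroʳ _) (≈-sym (zeroʳ _))
  δ-suc (suc n) (suc j) = begin
    q * q ^ j * δ n j
      ≈⟨ *-assoc _ _ _ ⟩
    q * (q ^ j * δ n j)
      ≈⟨ *-congˡ (δ-suc n j) ⟩
    q * ((q ^ j + - q ^ suc n) * δ (suc n) j)
      ≈⟨ solve 4 (λ q x y d → q :* ((x :- y) :* d) := (q :* x :- q :* y) :* d) ≈-refl q (q ^ j) (q ^ suc n) (δ (suc n) j) ⟩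
    (q * q ^ j + - (q * q ^ suc n)) * δ (suc n) j ∎
    where open ≈-Reasoning

  -- Up to sign, the coefficient of z^j in the finite Jacobi triple product.
  e : ℕ → ℕ → Series
  e n j = sgn j * q ^ tri j * (P 1 (suc (n ℕ.+ n)) * δ (suc n) j * ι (j ℕ.+ n))

  private
    P-step : ∀ n → P 1 (suc (suc n ℕ.+ suc n)) ≈ P 1 (suc (n ℕ.+ n)) * (1# + - (q ^ suc n * q ^ suc n)) * (1# + - (q * (q ^ suc n
        * q ^ suc n)))
    P-step n = ≈-trans (≈-trans (reindex (≡.cong suc (≡.cong suc (ℕ.+-suc n n)))) (≈-trans (P-suc (suc (suc (n ℕ.+ n)))) (*-congʳ
        (P-suc (suc (n ℕ.+ n))))))
      (*-cong (*-congˡ (+-congˡ (-‿cong sq))) (+-congˡ (-‿cong (*-congˡ sq))))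
      where
      reindex : ∀ {a b} → a ≡ b → P 1 a ≈ P 1 b
      reindex ≡.refl = ≈-refl
      sq : q ^ suc (suc (n ℕ.+ n)) ≈ q ^ suc n * q ^ suc n
      sq = ≈-trans (^-congʳ q (≡.cong suc (≡.sym (ℕ.+-suc n n)))) (^-homo-* q (suc n) (suc n))

  -- With N = q^(n+1), the finite product for `suc n` has the two further factors 1 - zN and 1 -
  -- N/z. Their product 1 + N² - N(z + 1/z) gives the recurrence.
  e-suc : ∀ n j → e (suc n) (suc j) ≈ (1# + q ^ suc n * q ^ suc n) * e n (suc j) + - (q ^ suc n * (e n j + e n (suc (suc j))))
  e-suc n j = begin
    (- 1# * s) * q ^ (tri j ℕ.+ j) * (P 1 (suc (suc n ℕ.+ suc n)) * d₀ * ι (suc j ℕ.+ suc n))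
      ≈⟨ *-cong (*-congˡ Tx) (*-cong (*-congʳ (P-step n)) (reindex (ℕ.+-suc (suc j) n))) ⟩
    (- 1# * s) * (T * x) * (Π * (1# + - (N * N)) * (1# + - (q * (N * N))) * d₀ * i)
      ≈⟨ solve 8 (λ q s T x Π N d i →
           (:- con (+ 1) :* s) :* (T :* x) :* (Π :* (con (+ 1) :- N :* N) :* (con (+ 1) :- q :* (N :* N)) :* d :* i)
           := s :* T :* Π :* i :* (:- (con (+ 1) :+ N :* N) :* (con (+ 1) :- q :* (N :* x)) :* ((x :- N) :* d)
                :- N :* ((con (+ 1) :- N :* x) :* (con (+ 1) :- q :* (N :* x)) :* d :+ (q :* x :- N) :* ((x :- N) :* d))))
           ≈-refl q s T x Π N d₀ i ⟩
    s * T * Π * i * (- (1# + N * N) * (1# + - (q * (N * x))) * ((x + - N) * d₀)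
      + - (N * ((1# + - (N * x)) * (1# + - (q * (N * x))) * d₀ + (q * x + - N) * ((x + - N) * d₀))))
      ≈⟨ *-congˡ (+-cong (*-congˡ rel₁) (-‿cong (*-congˡ (+-congˡ (≈-trans rel₂ (*-congˡ rel₁)))))) ⟨
    s * T * Π * i * (- (1# + N * N) * (1# + - (q * (N * x))) * (x * d₁)
      + - (N * ((1# + - (N * x)) * (1# + - (q * (N * x))) * d₀ + x * (q * x * d₂))))
      ≈⟨ solve 10 (λ q s T x Π N d₀ d₁ d₂ i →
           s :* T :* Π :* i :* (:- (con (+ 1) :+ N :* N) :* (con (+ 1) :- q :* (N :* x)) :* (x :* d₁)
             :- N :* ((con (+ 1) :- N :* x) :* (con (+ 1) :- q :* (N :* x)) :* d₀ :+ x :* (q :* x :* d₂)))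
           := (con (+ 1) :+ N :* N) :* ((:- con (+ 1) :* s) :* (T :* x) :* (Π :* d₁ :* ((con (+ 1) :- q :* (N :* x)) :* i)))
             :- N :* (s :* T :* (Π :* d₀ :* ((con (+ 1) :- N :* x) :* ((con (+ 1) :- q :* (N :* x)) :* i)))
               :+ (:- con (+ 1) :* (:- con (+ 1) :* s)) :* (T :* x :* (q :* x)) :* (Π :* d₂ :* i)))
           ≈-refl q s T x Π N d₀ d₁ d₂ i ⟩
    (1# + N * N) * ((- 1# * s) * (T * x) * (Π * d₁ * ((1# + - (q * (N * x))) * i)))
      + - (N * (s * T * (Π * d₀ * ((1# + - (N * x)) * ((1# + - (q * (N * x))) * i)))
        + (- 1# * (- 1# * s)) * (T * x * (q * x)) * (Π * d₂ * i)))
      ≈⟨ +-cong (*-congˡ (*-cong (*-congˡ Tx) (*-congˡ i₁)))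
           (-‿cong (*-congˡ (+-cong (*-congˡ (*-congˡ i₂)) (*-congʳ (*-congˡ (≈-trans (^-homo-* q (tri (suc j)) (suc j)) (*-congʳ
               Tx))))))) ⟨
    (1# + N * N) * e n (suc j) + - (N * (e n j + e n (suc (suc j)))) ∎
    where
    open ≈-Reasoning
    s = sgn j
    T = q ^ tri j
    x = q ^ j
    N = q ^ suc n
    Π = P 1 (suc (n ℕ.+ n))
    d₀ = δ (suc n) j
    d₁ = δ n j
    d₂ = δ n (suc j)
    i = ι (suc (suc (j ℕ.+ n)))
    reindex : ∀ {a b} → a ≡ b → ι a ≈ ι b
    reindex ≡.refl = ≈-refl
    Tx : q ^ (tri j ℕ.+ j) ≈ T * x
    Tx = ^-homo-* q (tri j) j
    rel₁ : x * d₁ ≈ (x + - N) * d₀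
    rel₁ = δ-suc n j
    rel₂ : x * (q * x * d₂) ≈ (q * x + - N) * (x * d₁)
    rel₂ = ≈-trans (*-congˡ (δ-suc n (suc j)))
      (solve 4 (λ y N x d → x :* ((y :- N) :* d) := (y :- N) :* (x :* d)) ≈-refl (q * x) N x d₁)
    Nx : q ^ suc (j ℕ.+ n) ≈ N * x
    Nx = ≈-trans (^-congʳ q (≡.cong suc (ℕ.+-comm j n))) (^-homo-* q (suc n) j)
    i₁ : ι (suc j ℕ.+ n) ≈ (1# + - (q * (N * x))) * i
    i₁ = ≈-trans (ι-suc (suc (j ℕ.+ n))) (*-congʳ (+-congˡ (-‿cong (*-congˡ Nx))))
    i₂ : ι (j ℕ.+ n) ≈ (1# + - (N * x)) * ((1# + - (q * (N * x))) * i)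
    i₂ = ≈-trans (ι-suc (j ℕ.+ n)) (*-cong (+-congˡ (-‿cong Nx)) i₁)

  e-zero : ∀ {n j} → suc n < j → e n j ≈ 0#
  e-zero {n} {j} n<j = ≈-trans (*-congˡ (≈-trans (*-congʳ (≈-trans (*-congˡ (δ-zero n<j)) (zeroʳ _))) (zeroˡ _))) (zeroʳ _)

  -- The powers j + 1 and -j of z have opposite coefficients in the finite triple product, so in its
  -- derivative at z = 1 they combine with weight (j + 1) + j.
  odd : ℕ → Series
  odd zero    = 1#
  odd (suc j) = odd j + (1# + 1#)

  private
    S : ℕ → ℕ → Series
    S n K = ∑ K (λ j → odd j * e n (suc j))

    W : ℕ → ℕ → Series
    W n K = odd K * e n K + - ((odd K + - (1# + 1#)) * e n (suc K))

    -- Summation by parts: odd is killed by the second difference operator.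
    S-suc : ∀ n K → S (suc n) K ≈ (1# + - q ^ suc n) * (1# + - q ^ suc n) * S n K + q ^ suc n * W n K
    S-suc n zero = ≈-trans (≈-sym const-0) (≈-trans
      (solve 4 (λ N Π a b → con (+ 0) := (con (+ 1) :- N) :* (con (+ 1) :- N) :* con (+ 0)
           :+ N :* (con (+ 1) :* (con (+ 1) :* con (+ 1) :* (Π :* a :* b))
             :- (con (+ 1) :- (con (+ 1) :+ con (+ 1))) :* ((:- con (+ 1) :* con (+ 1)) :* con (+ 1) :* (Π :* b :* a))))
         ≈-refl (q ^ suc n) (P 1 (suc (n ℕ.+ n))) (ι (suc n)) (ι n))
      (+-congʳ (*-congˡ const-0)))
    S-suc n (suc K) = begin
      S (suc n) K + odd K * e (suc n) (suc K)
        ≈⟨ +-cong (S-suc n K) (*-congˡ (e-suc n K)) ⟩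
      (1# + - N) * (1# + - N) * S n K + N * W n K + odd K * ((1# + N * N) * e₁ + - (N * (e₀ + e₂)))
        ≈⟨ solve 6 (λ N S w e₀ e₁ e₂ →
             (con (+ 1) :- N) :* (con (+ 1) :- N) :* S :+ N :* (w :* e₀ :- (w :- (con (+ 1) :+ con (+ 1))) :* e₁)
               :+ w :* ((con (+ 1) :+ N :* N) :* e₁ :- N :* (e₀ :+ e₂))
             := (con (+ 1) :- N) :* (con (+ 1) :- N) :* (S :+ w :* e₁)
               :+ N :* ((w :+ (con (+ 1) :+ con (+ 1))) :* e₁ :- (w :+ (con (+ 1) :+ con (+ 1)) :- (con (+ 1) :+ con (+ 1))) :* e₂))
             ≈-refl N (S n K) (odd K) e₀ e₁ e₂ ⟩
      (1# + - N) * (1# + - N) * S n (suc K) + N * W n (suc K) ∎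
      where
      open ≈-Reasoning
      N = q ^ suc n
      e₀ = e n K
      e₁ = e n (suc K)
      e₂ = e n (suc (suc K))

    S-0 : ∀ d → S 0 (suc d) ≈ - 1#
    S-0 zero = begin
      0# + 1# * ((- 1# * 1#) * 1# * (P 1 1 * ι 0 * ι 1))
        ≈⟨ +-congʳ const-0 ⟨
      const (+ 0) + 1# * ((- 1# * 1#) * 1# * (P 1 1 * ι 0 * ι 1))
        ≈⟨ solve 3 (λ P a b → con (+ 0) :+ con (+ 1) :* ((:- con (+ 1) :* con (+ 1)) :* con (+ 1) :* (P :* a :* b)) := :- (P :* b
             :* a)) ≈-refl (P 1 1) (ι 0) (ι 1) ⟩
      - (P 1 1 * ι 1 * ι 0)
        ≈⟨ -‿cong (≈-trans (*-cong (P*ι 1) ι-0) (*-identityˡ 1#)) ⟩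
      - 1# ∎
      where open ≈-Reasoning
    S-0 (suc d) = ≈-trans (+-cong (S-0 d) (≈-trans (*-congˡ (e-zero {0} {suc (suc d)} (s≤s (s≤s z≤n)))) (zeroʳ _))) (+-identityʳ _)

  -- This is the derivative of the finite triple product at z = 1, where the vanishing factor 1 - z
  -- leaves -(P 1 n)². Differentiation is replaced by the recursion `S-suc`; `K` lies beyond the
  -- support of the coefficients, which removes the boundary term `W n K`.
  P²-expansion : ∀ n K → n < K → ∑ K (λ j → odd j * e n (suc j)) ≈ - (P 1 n * P 1 n)
  P²-expansion zero    (suc d) _   = ≈-trans (S-0 d) (-‿cong (≈-sym (*-identityˡ 1#)))
  P²-expansion (suc n) K       n<K = begin
    S (suc n) K
      ≈⟨ S-suc n K ⟩
    (1# + - N) * (1# + - N) * S n K + N * W n K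
      ≈⟨ +-cong (*-congˡ (P²-expansion n K (ℕ.<⇒≤ n<K))) (≈-trans (*-congˡ W≈0) (zeroʳ N)) ⟩
    (1# + - N) * (1# + - N) * - (P 1 n * P 1 n) + 0#
      ≈⟨ +-identityʳ _ ⟩
    (1# + - N) * (1# + - N) * - (P 1 n * P 1 n)
      ≈⟨ solve 2 (λ N P → (con (+ 1) :- N) :* (con (+ 1) :- N) :* :- (P :* P) := :- (P :* (con (+ 1) :- N) :* (P :* (con (+ 1) :-
           N)))) ≈-refl N (P 1 n) ⟩
    - (P 1 n * (1# + - N) * (P 1 n * (1# + - N)))
      ≈⟨ -‿cong (*-cong (P-suc n) (P-suc n)) ⟨
    - (P 1 (suc n) * P 1 (suc n)) ∎
    where
    open ≈-Reasoning
    N = q ^ suc n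
    W≈0 : W n K ≈ 0#
    W≈0 = ≈-trans (+-cong (≈-trans (*-congˡ (e-zero n<K)) (zeroʳ _)) (-‿cong (≈-trans (*-congˡ (e-zero (ℕ.m≤n⇒m≤1+n n<K))) (zeroʳ _))))
      (-‿inverseʳ 0#)

  private
    f*ι : ∀ n → f 1 * ι n ≈ 1# mod-q^ suc n
    f*ι n = m-trans (*-mod (f≈P 1 n) m-refl) (≈⇒mod (P*ι n))

    f*δ : ∀ d j → f 1 * δ (d ℕ.+ j) j ≈ 1# mod-q^ suc d
    f*δ d zero    = mod-weaken (s≤s (ℕ.m≤m+n d 0)) (f*ι (d ℕ.+ 0))
    f*δ d (suc j) = ≡.subst (λ n → f 1 * δ n (suc j) ≈ 1# mod-q^ suc d) (≡.sym (ℕ.+-suc d j)) (f*δ d j)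

  -- The Gaussian binomial coefficient tends to 1/f₁. It is only accurate up to exponent n - j, but
  -- the power of `q` in front has exponent at least `j` and makes up the difference.
  f*e : ∀ n j → j ≤ n → f 1 * e n (suc j) ≈ sgn (suc j) * q ^ tri (suc j) mod-q^ suc n
  f*e n j j≤n = begin
    f 1 * (sgn (suc j) * q ^ tri (suc j) * (Π * δ n j * i))
      ≈⟨ ≈⇒mod (solve 6 (λ f s x Π d i → f :* (s :* x :* (Π :* d :* i)) := s :* (x :* (f :* d :* (Π :* i)))) ≈-refl
           (f 1) (sgn (suc j)) (q ^ tri (suc j)) Π (δ n j) i) ⟩
    sgn (suc j) * (q ^ tri (suc j) * (f 1 * δ n j * (Π * i)))
      ≈⟨ *-mod m-refl (mod-weaken bound (q^*-mod (tri (suc j)) {N = suc (n ℕ.∸ j)} close)) ⟩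
    sgn (suc j) * (q ^ tri (suc j) * 1#)
      ≈⟨ ≈⇒mod (*-congˡ (*-identityʳ _)) ⟩
    sgn (suc j) * q ^ tri (suc j) ∎
    where
    open mod-Reasoning (suc n)
    Π = P 1 (suc (n ℕ.+ n))
    i = ι (suc j ℕ.+ n)
    bound : suc n ≤ tri (suc j) ℕ.+ suc (n ℕ.∸ j)
    bound = ℕ.≤-trans (ℕ.≤-reflexive (≡.trans (≡.cong suc (≡.sym (ℕ.m+[n∸m]≡n j≤n))) (≡.sym (ℕ.+-suc j (n ℕ.∸ j)))))
      (ℕ.+-monoˡ-≤ (suc (n ℕ.∸ j)) (n≤tri[1+n] j))
    close : f 1 * δ n j * (Π * i) ≈ 1# mod-q^ suc (n ℕ.∸ j)
    close = m-trans (*-mod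
        (≡.subst (λ m → f 1 * δ m j ≈ 1# mod-q^ suc (n ℕ.∸ j)) (ℕ.m∸n+n≡m j≤n) (f*δ (n ℕ.∸ j) j))
        (m-trans (*-mod (mod-weaken (s≤s (ℕ.≤-trans (ℕ.m∸n≤m n j) (ℕ.m≤n⇒m≤1+n (ℕ.m≤m+n n n)))) (m-sym (f≈P 1 (suc (n ℕ.+ n))))) m-refl)
          (mod-weaken (s≤s (ℕ.≤-trans (ℕ.m∸n≤m n j) (ℕ.m≤n+m n (suc j)))) (f*ι (suc j ℕ.+ n)))))
      (≈⇒mod (*-identityˡ 1#))

  private
    V-odd : ∀ j → V (odd j) ≈ odd j
    V-odd zero    = V-const (+ 1)
    V-odd (suc j) = ≈-trans (V-+ (odd j) (1# + 1#)) (+-cong (V-odd j) (≈-trans (V-+ 1# 1#) (+-cong (V-const (+ 1)) (V-const (+ 1)))))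

    E₂-tri : ∀ j → E 2 (q ^ tri j) ≈ 0#
    E₂-tri j = ⟨ (λ n → q^-at≢ (tri j) (λ eq → tri%5≢2 j
      (≡.trans (≡.cong (ℕ._% 5) (≡.trans (≡.sym eq) (ℕ.+-comm (n ℕ.* 5) 2))) (ℕ.[m+kn]%n≡m%n 2 n 5)))) ⟩

    E₂-∑ : ∀ K → E 2 (∑ K (λ j → odd j * (sgn (suc j) * q ^ tri (suc j)))) ≈ 0#
    E₂-∑ zero    = ≈-refl
    E₂-∑ (suc K) = ≈-trans (E-+ 2 _ _) (≈-trans (+-cong (E₂-∑ K) term) (+-identityˡ 0#))
      where
      term : E 2 (odd K * (sgn (suc K) * q ^ tri (suc K))) ≈ 0#
      term = ≈-trans (E-cong 2 (≈-trans (≈-sym (*-assoc _ _ _)) (*-congʳ (≈-sym (≈-trans (V-* (odd K) (sgn (suc K))) (*-cong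
          (V-odd K) (V-sgn (suc K))))))))
        (≈-trans (E-V* (odd K * sgn (suc K)) (q ^ tri (suc K)) (s≤s (s≤s (s≤s z≤n)))) (≈-trans (*-congˡ (E₂-tri (suc K))) (zeroʳ _)))

  -- By Jacobi, f₁³ only involves powers of q with triangular exponents.
  E₂-f₁³ : E 2 (f 1 * (f 1 * f 1)) ≈ 0#
  E₂-f₁³ = mod-all (λ N → let n = N ℕ.* 5 ℕ.+ 2 in m-trans (E-mod 2 (mod-weaken (ℕ.n≤1+n n) (expand n)))
      (≈⇒mod (≈-trans (E-neg 2 _) (≈-trans (-‿cong (E₂-∑ (suc n))) (≈-trans (≈-sym (+-identityˡ (- 0#))) (-‿inverseʳ 0#))))))
    where
    expand : ∀ n → f 1 * (f 1 * f 1) ≈ - ∑ (suc n) (λ j → odd j * (sgn (suc j) * q ^ tri (suc j))) mod-q^ suc n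
    expand n = begin
      f 1 * (f 1 * f 1)
        ≈⟨ *-mod m-refl (*-mod (f≈P 1 n) (f≈P 1 n)) ⟩
      f 1 * (P 1 n * P 1 n)
        ≈⟨ ≈⇒mod (solve 2 (λ f x → f :* x := :- (f :* :- x)) ≈-refl (f 1) (P 1 n * P 1 n)) ⟩
      - (f 1 * - (P 1 n * P 1 n))
        ≈⟨ neg-mod (*-mod m-refl (≈⇒mod (P²-expansion n (suc n) ℕ.≤-refl))) ⟨
      - (f 1 * ∑ (suc n) (λ j → odd j * e n (suc j)))
        ≈⟨ neg-mod (≈⇒mod (∑-*ˡ (suc n) (f 1) (λ j → odd j * e n (suc j)))) ⟨
      - ∑ (suc n) (λ j → f 1 * (odd j * e n (suc j)))
        ≈⟨ neg-mod (∑-mod (suc n) (λ {j} j≤n → m-trans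
             (≈⇒mod (solve 3 (λ f o e → f :* (o :* e) := o :* (f :* e)) ≈-refl (f 1) (odd j) (e n (suc j))))
             (*-mod m-refl (f*e n j (ℕ.≤-pred j≤n))))) ⟩
      - ∑ (suc n) (λ j → odd j * (sgn (suc j) * q ^ tri (suc j))) ∎
      where open mod-Reasoning (suc n)

-- The dissection of f₁ modulo 11

module Modulo11 where
  open Series 11 hiding (solve; _:=_; _:+_; _:*_; _:-_; :-_; _:^_; con)
  open ModularSolver
  open Sums 11
  open EulerProducts 11
  open PentagonalNumbers 11
  open JacobiCube 11
  open Dissection 11 4
  private module R = CommutativeRing (Residues.commutativeRing 11)

  ^-mod : ∀ n {N x y} → x ≈ y mod-q^ N → x ^ n ≈ y ^ n mod-q^ N
  ^-mod zero    e = m-refl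
  ^-mod (suc n) e = *-mod e (^-mod n e)

  -- The solver expands with coefficients reduced modulo 11, where the inner binomial coefficients
  -- vanish. The shape x(1 - y) is the one in which `P` grows.
  frobenius : ∀ x y → (x * (1# + - y)) ^ 11 ≈ x ^ 11 * (1# + - y ^ 11)
  frobenius = solve 2 (λ x y → (x :* (con (+ 1) :- y)) :^ 11 := x :^ 11 :* (con (+ 1) :- y :^ 11)) ≈-refl

  f₁₁ : f 11 ≈ f 1 ^ 11
  f₁₁ = mod-all (λ N → mod-weaken (ℕ.n≤1+n N) (m-trans (f≈P 11 N) (m-trans (≈⇒mod (P₁₁ N)) (^-mod 11 (m-sym (f≈P 1 N))))))
    where
    P₁₁ : ∀ n → P 11 n ≈ P 1 n ^ 11
    P₁₁ zero    = solve 0 (con (+ 1) := con (+ 1) :^ 11) ≈-refl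
    P₁₁ (suc n) = ≈-trans
      (*-cong (P₁₁ n) (+-congˡ (-‿cong (≈-trans (^-congʳ q (≡.trans (≡.cong (11 ℕ.*_) (≡.sym (ℕ.*-identityˡ (suc n)))) (ℕ.*-comm
          11 (1 ℕ.* suc n))))
        (≈-sym (^-assocʳ q (1 ℕ.* suc n) 11))))))
      (≈-sym (frobenius (P 1 n) (q ^ (1 ℕ.* suc n))))

  -- The quotient `w` is the Rogers-Ramanujan continued fraction freed of its factor q^(1/5).
  α w b c : Series
  α = E 0 (f 1)
  b = - E 2 (f 1)
  c = V (f 1)
  w = inv α * c

  α-head : α 0 R.≈ + 1
  α-head = f-head 1

  αw≈c : α * w ≈ c
  αw≈c = ≈-trans (≈-sym (*-assoc α (inv α) c)) (≈-trans (*-congʳ (inv-inverse α α-head)) (*-identityˡ c))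

  E₂-f₁ : E 2 (f 1) ≈ - b
  E₂-f₁ = solve 1 (λ x → x := :- (:- x)) ≈-refl (E 2 (f 1))

  f₁-dissection : f 1 ≈ V α + - (q * V c) + - (q * (q * V b))
  f₁-dissection = begin
    f 1
      ≈⟨ dissect (f 1) ⟩
    0# + 1# * V α + q ^ 1 * V (E 1 (f 1)) + q ^ 2 * V (E 2 (f 1)) + q ^ 3 * V (E 3 (f 1)) + q ^ 4 * V (E 4 (f 1))
      ≈⟨ +-cong (+-cong (+-cong (+-cong (+-identityˡ _) (*-congˡ (≈-trans (V-cong E₁-f₁) (V-neg c))))
           (*-congˡ (≈-trans (V-cong E₂-f₁) (V-neg b)))) (≈-trans (*-congˡ (V≈0 E₃-f₁)) (zeroʳ (q ^ 3)))) (≈-trans (*-congˡ (V≈0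
               E₄-f₁)) (zeroʳ (q ^ 4))) ⟩
    1# * V α + q ^ 1 * - V c + q ^ 2 * - V b + 0# + 0#
      ≈⟨ ≈-trans (+-identityʳ _) (+-identityʳ _) ⟩
    1# * V α + q ^ 1 * - V c + q ^ 2 * - V b
      ≈⟨ solve 4 (λ q x y z → con (+ 1) :* x :+ q :^ 1 :* :- y :+ q :^ 2 :* :- z := x :- q :* y :- q :* (q :* z)) ≈-refl q (V α)
           (V c) (V b) ⟩
    V α + - (q * V c) + - (q * (q * V b)) ∎
    where
    open ≈-Reasoning
    V≈0 : ∀ {g} → g ≈ 0# → V g ≈ 0#
    V≈0 g≈0 = ≈-trans (V-cong g≈0) (subst-0# (q ^ 4))

  private
    E-f₁* : ∀ {s} g → s < 5 → E s (f 1 * g) ≈ α * E s g + - (c * E s (q * g)) + - (b * E s (q * (q * g)))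
    E-f₁* {s} g s<5 = begin
      E s (f 1 * g)
        ≈⟨ E-cong s (≈-trans (*-congʳ f₁-dissection) (solve 5 (λ q x y z g → (x :- q :* y :- q :* (q :* z)) :* g
             := x :* g :- y :* (q :* g) :- z :* (q :* (q :* g))) ≈-refl q (V α) (V c) (V b) g)) ⟩
      E s (V α * g + - (V c * (q * g)) + - (V b * (q * (q * g))))
        ≈⟨ ≈-trans (E-+ s _ _) (+-cong (≈-trans (E-+ s _ _) (+-congˡ (E-neg s _))) (E-neg s _)) ⟩
      E s (V α * g) + - E s (V c * (q * g)) + - E s (V b * (q * (q * g)))
        ≈⟨ +-cong (+-cong (E-V* α g s<5) (-‿cong (E-V* c (q * g) s<5))) (-‿cong (E-V* b (q * (q * g)) s<5)) ⟩
      α * E s g + - (c * E s (q * g)) + - (b * E s (q * (q * g))) ∎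
      where open ≈-Reasoning

    0<5 : 0 < 5
    0<5 = s≤s z≤n
    1<5 : 1 < 5
    1<5 = s≤s (s≤s z≤n)
    2<5 : 2 < 5
    2<5 = s≤s (s≤s (s≤s z≤n))

    F = f 1

    E₀-qF : E 0 (q * F) ≈ 0#
    E₀-qF = ≈-trans (E-q-zero F) (≈-trans (*-congˡ E₄-f₁) (zeroʳ q))

    E₀-F² : E 0 (F * F) ≈ α * α + - (c * const (+ 0)) + - (b * const (+ 0))
    E₀-F² = ≈-trans (E-f₁* F 0<5) (+-cong (+-congˡ (-‿cong (*-congˡ (≈-trans E₀-qF (≈-sym const-0)))))
      (-‿cong (*-congˡ (≈-trans (E-q-zero (q * F)) (≈-trans (*-congˡ (≈-trans (E-q-suc 3 F) E₃-f₁)) (≈-trans (zeroʳ q) (≈-sym const-0)))))))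

    E₁-F² : E 1 (F * F) ≈ α * - c + - (c * α) + - (b * const (+ 0))
    E₁-F² = ≈-trans (E-f₁* F 1<5) (+-cong (+-cong (*-congˡ E₁-f₁) (-‿cong (*-congˡ (E-q-suc 0 F))))
      (-‿cong (*-congˡ (≈-trans (E-q-suc 0 (q * F)) (≈-trans E₀-qF (≈-sym const-0))))))

    E₂-F² : E 2 (F * F) ≈ α * - b + - (c * - c) + - (b * α)
    E₂-F² = ≈-trans (E-f₁* F 2<5) (+-cong (+-cong (*-congˡ E₂-f₁) (-‿cong (*-congˡ (≈-trans (E-q-suc 1 F) E₁-f₁))))
      (-‿cong (*-congˡ (≈-trans (E-q-suc 1 (q * F)) (E-q-suc 0 F)))))

    E₂-F³ : E 2 (F * (F * F)) ≈ const (+ 3) * (α * (c * c) + - (α * (α * b)))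
    E₂-F³ = begin
      E 2 (F * (F * F))
        ≈⟨ E-f₁* (F * F) 2<5 ⟩
      α * E 2 (F * F) + - (c * E 2 (q * (F * F))) + - (b * E 2 (q * (q * (F * F))))
        ≈⟨ +-cong (+-cong (*-congˡ E₂-F²) (-‿cong (*-congˡ (≈-trans (E-q-suc 1 (F * F)) E₁-F²))))
             (-‿cong (*-congˡ (≈-trans (E-q-suc 1 (q * (F * F))) (≈-trans (E-q-suc 0 (F * F)) E₀-F²)))) ⟩
      α * (α * - b + - (c * - c) + - (b * α)) + - (c * (α * - c + - (c * α) + - (b * const (+ 0))))
        + - (b * (α * α + - (c * const (+ 0)) + - (b * const (+ 0))))
        ≈⟨ solve 3 (λ α b c → α :* (α :* :- b :- c :* :- c :- b :* α) :- c :* (α :* :- c :- c :* α :- b :* con (+ 0))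
             :- b :* (α :* α :- c :* con (+ 0) :- b :* con (+ 0)) := con (+ 3) :* (α :* (c :* c) :- α :* (α :* b))) ≈-refl α b c ⟩
      const (+ 3) * (α * (c * c) + - (α * (α * b))) ∎
      where open ≈-Reasoning

  -- By the dissection, class 2 of f₁³ is 3α(c² - αb), which is zero by Jacobi's identity. As 4 · 3
  -- = 1 modulo 11, adding four times this quantity exchanges α²b for αc²; then α, with constant
  -- term 1, is cancelled.
  αb≈c² : α * b ≈ c * c
  αb≈c² = *-cancelˡ α α-head (begin
    α * (α * b)
      ≈⟨ +-identityʳ _ ⟨
    α * (α * b) + 0#
      ≈⟨ +-congˡ (≈-trans (*-congˡ (≈-trans (≈-sym E₂-F³) E₂-f₁³)) (zeroʳ (const (+ 4)))) ⟨
    α * (α * b) + const (+ 4) * (const (+ 3) * (α * (c * c) + - (α * (α * b))))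
      ≈⟨ solve 3 (λ α b c → α :* (α :* b) :+ con (+ 4) :* (con (+ 3) :* (α :* (c :* c) :- α :* (α :* b))) := α :* (c :* c)) ≈-refl α b c ⟩
    α * (c * c) ∎)
    where open ≈-Reasoning

  b≈αw² : b ≈ α * (w * w)
  b≈αw² = *-cancelˡ α α-head (≈-trans αb≈c² (≈-trans (*-cong (≈-sym αw≈c) (≈-sym αw≈c))
    (solve 2 (λ α w → α :* w :* (α :* w) := α :* (α :* (w :* w))) ≈-refl α w)))

  x : Series
  x = q * V w

  f₁-factored : f 1 ≈ V α * (1# + - x + - (x * x))
  f₁-factored = begin
    f 1
      ≈⟨ f₁-dissection ⟩
    V α + - (q * V c) + - (q * (q * V b))
      ≈⟨ +-cong (+-congˡ (-‿cong (*-congˡ (≈-trans (V-cong (≈-sym αw≈c)) (V-* α w)))))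
           (-‿cong (*-congˡ (*-congˡ (≈-trans (V-cong b≈αw²) (≈-trans (V-* α (w * w)) (*-congˡ (V-* w w))))))) ⟩
    V α + - (q * (V α * V w)) + - (q * (q * (V α * (V w * V w))))
      ≈⟨ solve 3 (λ q α w → α :- q :* (α :* w) :- q :* (q :* (α :* (w :* w))) := α :* (con (+ 1) :- q :* w :- q :* w :* (q :*
           w))) ≈-refl q (V α) (V w) ⟩
    V α * (1# + - x + - (x * x)) ∎
    where open ≈-Reasoning

  private
    σ : ℤ → Series → Series
    σ k = subst (const k)

  -- The product over the twists q ↦ kq by the fifth roots of unity k of 𝔽₁₁.
  norm : Series → Series
  norm g = σ (+ 1) g * σ (+ 3) g * σ (+ 9) g * σ (+ 5) g * σ (+ 4) g

  norm-mod : ∀ {N g h} → g ≈ h mod-q^ N → norm g ≈ norm h mod-q^ N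
  norm-mod e = *-mod (*-mod (*-mod (*-mod (t (+ 1)) (t (+ 3))) (t (+ 9))) (t (+ 5))) (t (+ 4))
    where t = λ k → subst-mod (const k) e

  norm-* : ∀ g h → norm (g * h) ≈ norm g * norm h
  norm-* g h = ≈-trans (*-cong (*-cong (*-cong (*-cong (t (+ 1)) (t (+ 3))) (t (+ 9))) (t (+ 5))) (t (+ 4)))
    (solve 10 (λ a b c d e a′ b′ c′ d′ e′ → a :* a′ :* (b :* b′) :* (c :* c′) :* (d :* d′) :* (e :* e′)
      := a :* b :* c :* d :* e :* (a′ :* b′ :* c′ :* d′ :* e′)) ≈-refl
      (σ (+ 1) g) (σ (+ 3) g) (σ (+ 9) g) (σ (+ 5) g) (σ (+ 4) g) (σ (+ 1) h) (σ (+ 3) h) (σ (+ 9) h) (σ (+ 5) h) (σ (+ 4) h))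
    where t = λ k → subst-* (const k) g h

  private
    -- For k⁵ = 1 the twist fixes q⁵. The hypothesis expresses this with one `q` removed, the form
    -- in which `subst-subst` produces it.
    σ-V : ∀ k g → const k * (q * const k) ^ 4 ≈ q ^ 4 → σ k (V g) ≈ V g
    σ-V k g k⁵≈1 = ≈-trans (subst-subst (const k) (q ^ 4) g) (subst-congˡ g
      (≈-trans (*-congˡ (≈-trans (subst-^ (const k) q 4) (^-congˡ 4 (subst-q (const k))))) k⁵≈1))

    σ-f₁ : ∀ k → const k * (q * const k) ^ 4 ≈ q ^ 4 →
           σ k (f 1) ≈ V α * (1# + - (const k * x) + - (const k * x * (const k * x)))
    σ-f₁ k k⁵≈1 = begin
      σ k (f 1)
        ≈⟨ subst-cong y f₁-factored ⟩
      σ k (V α * (1# + - x + - (x * x)))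
        ≈⟨ ≈-trans (subst-* y (V α) (1# + - x + - (x * x))) (*-cong (σ-V k α k⁵≈1) (≈-trans (subst-+ y (1# + - x) (- (x * x)))
             (+-cong (≈-trans (subst-+ y 1# (- x)) (+-cong (subst-const y (+ 1)) (≈-trans (subst-neg y x) (-‿cong σx))))
               (≈-trans (subst-neg y (x * x)) (-‿cong (≈-trans (subst-* y x x) (*-cong σx σx))))))) ⟩
      V α * (1# + - (const k * x) + - (const k * x * (const k * x))) ∎
      where
      open ≈-Reasoning
      y = const k
      σx : σ k x ≈ const k * x
      σx = ≈-trans (subst-* y q (V w)) (≈-trans (*-cong (subst-q y) (σ-V k w k⁵≈1))
        (≈-trans (*-congʳ (*-comm q y)) (*-assoc y q (V w))))

    1⁵ : const (+ 1) * (q * const (+ 1)) ^ 4 ≈ q ^ 4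
    1⁵ = solve 1 (λ q → con (+ 1) :* (q :* con (+ 1)) :^ 4 := q :^ 4) ≈-refl q
    3⁵ : const (+ 3) * (q * const (+ 3)) ^ 4 ≈ q ^ 4
    3⁵ = solve 1 (λ q → con (+ 3) :* (q :* con (+ 3)) :^ 4 := q :^ 4) ≈-refl q
    9⁵ : const (+ 9) * (q * const (+ 9)) ^ 4 ≈ q ^ 4
    9⁵ = solve 1 (λ q → con (+ 9) :* (q :* con (+ 9)) :^ 4 := q :^ 4) ≈-refl q
    5⁵ : const (+ 5) * (q * const (+ 5)) ^ 4 ≈ q ^ 4
    5⁵ = solve 1 (λ q → con (+ 5) :* (q :* con (+ 5)) :^ 4 := q :^ 4) ≈-refl q
    4⁵ : const (+ 4) * (q * const (+ 4)) ^ 4 ≈ q ^ 4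
    4⁵ = solve 1 (λ q → con (+ 4) :* (q :* con (+ 4)) :^ 4 := q :^ 4) ≈-refl q

  z : Series
  z = q * w ^ 5

  -- Over all fifth roots of unity k, the product of 1 - kx - k²x² is 1 - Lx⁵ - x¹⁰ with the Lucas
  -- number L = 11, so modulo 11 only 1 - x¹⁰ is left.
  norm-f₁ : norm (f 1) ≈ V (α ^ 5 * (1# + - (z * z)))
  norm-f₁ = begin
    norm (f 1)
      ≈⟨ *-cong (*-cong (*-cong (*-cong (σ-f₁ (+ 1) 1⁵) (σ-f₁ (+ 3) 3⁵)) (σ-f₁ (+ 9) 9⁵)) (σ-f₁ (+ 5) 5⁵)) (σ-f₁ (+ 4) 4⁵) ⟩
    _
      ≈⟨ solve 3 (λ a q w → let t = λ k → a :* (con (+ 1) :- con (+ k) :* (q :* w) :- con (+ k) :* (q :* w) :* (con (+ k) :* (q :* w))) in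
           t 1 :* t 3 :* t 9 :* t 5 :* t 4 := a :^ 5 :* (con (+ 1) :- q :^ 5 :* w :^ 5 :* (q :^ 5 :* w :^ 5))) ≈-refl (V α) q (V w) ⟩
    V α ^ 5 * (1# + - (q ^ 5 * V w ^ 5 * (q ^ 5 * V w ^ 5)))
      ≈⟨ *-cong (V-^ α 5) (≈-trans (V-+ 1# (- (z * z))) (+-cong (V-const (+ 1)) (≈-trans (V-neg (z * z)) (-‿cong (≈-trans (V-* z
           z) (*-cong Vz Vz)))))) ⟨
    V (α ^ 5) * V (1# + - (z * z))
      ≈⟨ V-* (α ^ 5) (1# + - (z * z)) ⟨
    V (α ^ 5 * (1# + - (z * z))) ∎
    where
    open ≈-Reasoning
    Vz : V z ≈ q ^ 5 * V w ^ 5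
    Vz = ≈-trans (V-* q (w ^ 5)) (*-cong V-q (V-^ w 5))

  V-P : ∀ n → V (P 1 n) ≈ P 5 n
  V-P zero    = V-const (+ 1)
  V-P (suc n) = ≈-trans (V-* (P 1 n) (1# + - q ^ (1 ℕ.* suc n))) (*-cong (V-P n)
    (≈-trans (V-+ 1# _) (+-cong (V-const (+ 1)) (≈-trans (V-neg _) (-‿cong (≈-trans (V-q^ (1 ℕ.* suc n))
      (^-congʳ q (≡.cong (5 ℕ.*_) (ℕ.*-identityˡ (suc n))))))))))

  f₅ : f 5 ≈ c
  f₅ = mod-all (λ N → mod-weaken (ℕ.n≤1+n N) (m-trans (f≈P 5 N) (m-trans (≈⇒mod (≈-sym (V-P N))) (V-mod (m-sym (f≈P 1 N))))))

  private
    σ-q^ : ∀ k r n → const k * (q * const k) ^ 4 ≈ q ^ 4 → σ k (1# + - q ^ (1 ℕ.* (r ℕ.+ n ℕ.* 5))) ≈ 1# + - ((q * const k) ^ r *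
        q ^ (n ℕ.* 5))
    σ-q^ k r n k⁵≈1 = ≈-trans (subst-+ y 1# _) (+-cong (subst-const y (+ 1)) (≈-trans (subst-neg y _) (-‿cong (begin
      σ k (q ^ (1 ℕ.* (r ℕ.+ n ℕ.* 5)))
        ≈⟨ ≈-trans (subst-^ y q (1 ℕ.* (r ℕ.+ n ℕ.* 5))) (^-congˡ (1 ℕ.* (r ℕ.+ n ℕ.* 5)) (subst-q y)) ⟩
      (q * y) ^ (1 ℕ.* (r ℕ.+ n ℕ.* 5))
        ≈⟨ ≈-trans (^-congʳ (q * y) (ℕ.*-identityˡ (r ℕ.+ n ℕ.* 5))) (^-homo-* (q * y) r (n ℕ.* 5)) ⟩
      (q * y) ^ r * (q * y) ^ (n ℕ.* 5)
        ≈⟨ *-congˡ (≈-trans (fifth (q * y)) (≈-trans (^-congˡ n qy⁵) (≈-sym (fifth q)))) ⟩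
      (q * y) ^ r * q ^ (n ℕ.* 5) ∎))))
      where
      open ≈-Reasoning
      y = const k
      fifth : ∀ u → u ^ (n ℕ.* 5) ≈ (u ^ 5) ^ n
      fifth u = ≈-trans (^-congʳ u (ℕ.*-comm n 5)) (≈-sym (^-assocʳ u 5 n))
      qy⁵ : (q * y) ^ 5 ≈ q ^ 5
      qy⁵ = ≈-trans (*-assoc q y _) (*-congˡ k⁵≈1)

    factor : ℕ → ℕ → Series
    factor r n = 1# + - q ^ (1 ℕ.* (r ℕ.+ n ℕ.* 5))

    norm-factor : ∀ r n → norm (factor r n) ≈
      (let t = λ k → 1# + - ((q * const k) ^ r * q ^ (n ℕ.* 5)) in t (+ 1) * t (+ 3) * t (+ 9) * t (+ 5) * t (+ 4))
    norm-factor r n = *-cong (*-cong (*-cong (*-cong (σ-q^ (+ 1) r n 1⁵) (σ-q^ (+ 3) r n 3⁵)) (σ-q^ (+ 9) r n 9⁵)) (σ-q^ (+ 5) r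
        n 5⁵)) (σ-q^ (+ 4) r n 4⁵)

    V-factor : ∀ r n → V (factor r n) ≈ 1# + - (q ^ r * q ^ (n ℕ.* 5)) ^ 5
    V-factor r n = ≈-trans (V-+ 1# _) (+-cong (V-const (+ 1)) (≈-trans (V-neg _) (-‿cong (≈-trans (V-q^ (1 ℕ.* (r ℕ.+ n ℕ.* 5)))
      (≈-trans (^-congʳ q (≡.trans (≡.cong (5 ℕ.*_) (ℕ.*-identityˡ (r ℕ.+ n ℕ.* 5))) (ℕ.*-comm 5 (r ℕ.+ n ℕ.* 5))))
      (≈-trans (≈-sym (^-assocʳ q (r ℕ.+ n ℕ.* 5) 5)) (^-congˡ 5 (^-homo-* q r (n ℕ.* 5)))))))))

    -- For an exponent r prime to 5, k^r runs through all fifth roots of unity, so the five twists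
    -- of a factor 1 - y multiply to 1 - y⁵.
    norm₁ : ∀ n → norm (factor 1 n) ≈ V (factor 1 n)
    norm₁ n = ≈-trans (norm-factor 1 n) (≈-trans (solve 2 (λ q y → let t = λ k → con (+ 1) :- (q :* con (+ k)) :^ 1 :* y in
      t 1 :* t 3 :* t 9 :* t 5 :* t 4 := con (+ 1) :- (q :^ 1 :* y) :^ 5) ≈-refl q (q ^ (n ℕ.* 5))) (≈-sym (V-factor 1 n)))
    norm₂ : ∀ n → norm (factor 2 n) ≈ V (factor 2 n)
    norm₂ n = ≈-trans (norm-factor 2 n) (≈-trans (solve 2 (λ q y → let t = λ k → con (+ 1) :- (q :* con (+ k)) :^ 2 :* y in
      t 1 :* t 3 :* t 9 :* t 5 :* t 4 := con (+ 1) :- (q :^ 2 :* y) :^ 5) ≈-refl q (q ^ (n ℕ.* 5))) (≈-sym (V-factor 2 n)))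
    norm₃ : ∀ n → norm (factor 3 n) ≈ V (factor 3 n)
    norm₃ n = ≈-trans (norm-factor 3 n) (≈-trans (solve 2 (λ q y → let t = λ k → con (+ 1) :- (q :* con (+ k)) :^ 3 :* y in
      t 1 :* t 3 :* t 9 :* t 5 :* t 4 := con (+ 1) :- (q :^ 3 :* y) :^ 5) ≈-refl q (q ^ (n ℕ.* 5))) (≈-sym (V-factor 3 n)))
    norm₄ : ∀ n → norm (factor 4 n) ≈ V (factor 4 n)
    norm₄ n = ≈-trans (norm-factor 4 n) (≈-trans (solve 2 (λ q y → let t = λ k → con (+ 1) :- (q :* con (+ k)) :^ 4 :* y in
      t 1 :* t 3 :* t 9 :* t 5 :* t 4 := con (+ 1) :- (q :^ 4 :* y) :^ 5) ≈-refl q (q ^ (n ℕ.* 5))) (≈-sym (V-factor 4 n)))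
    -- For an exponent divisible by 5 the five twists coincide, whence a fifth power.
    norm₅ : ∀ n → norm (factor 5 n) ≈ (V (1# + - q ^ (1 ℕ.* suc n))) ^ 5
    norm₅ n = ≈-trans (norm-factor 5 n) (≈-trans (solve 2 (λ q y → let t = λ k → con (+ 1) :- (q :* con (+ k)) :^ 5 :* y in
      t 1 :* t 3 :* t 9 :* t 5 :* t 4 := (con (+ 1) :- q :^ 5 :* y) :^ 5) ≈-refl q (q ^ (n ℕ.* 5)))
      (^-congˡ 5 (≈-sym (≈-trans (V-+ 1# _) (+-cong (V-const (+ 1)) (≈-trans (V-neg _) (-‿cong (≈-trans (V-q^ (1 ℕ.* suc n))
        (≈-trans (^-congʳ q (≡.trans (≡.cong (5 ℕ.*_) (ℕ.*-identityˡ (suc n))) (ℕ.*-comm 5 (suc n)))) (^-homo-* q 5 (n ℕ.* 5)))))))))))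

    factor₅ : ∀ n → 1# + - q ^ (5 ℕ.* suc n) ≈ factor 5 n
    factor₅ n = +-congˡ (-‿cong (^-congʳ q (≡.trans (ℕ.*-comm 5 (suc n)) (≡.sym (ℕ.*-identityˡ (suc n ℕ.* 5))))))

    -- Exponents prime to 5 give factors at q⁵, multiples of 5 give fifth powers. Multiplying by
    -- `V (P 5 n)` supplies the factors at multiples of 5 that `V (P 1 (n * 5))` would otherwise
    -- miss. In the limit, norm(f₁) f₁(q²⁵) = f₁(q⁵)⁶.
    norm-P : ∀ n → norm (P 1 (n ℕ.* 5)) * V (P 5 n) ≈ V (P 1 (n ℕ.* 5)) * V (P 1 n) ^ 5
    norm-P zero = begin
      norm 1# * V 1#
        ≈⟨ *-cong (*-cong (*-cong (*-cong (*-cong (t (+ 1)) (t (+ 3))) (t (+ 9))) (t (+ 5))) (t (+ 4))) (V-const (+ 1)) ⟩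
      1# * 1# * 1# * 1# * 1# * 1#
        ≈⟨ solve 0 (con (+ 1) :* con (+ 1) :* con (+ 1) :* con (+ 1) :* con (+ 1) :* con (+ 1) := con (+ 1) :* con (+ 1) :^ 5) ≈-refl ⟩
      1# * 1# ^ 5
        ≈⟨ *-cong (V-const (+ 1)) (^-congˡ 5 (V-const (+ 1))) ⟨
      V 1# * V 1# ^ 5 ∎
      where
      open ≈-Reasoning
      t = λ k → subst-const (const k) (+ 1)
    norm-P (suc n) = begin
      norm (Q * factor 1 n * factor 2 n * factor 3 n * factor 4 n * factor 5 n) * V (P 5 n * (1# + - q ^ (5 ℕ.* suc n)))
        ≈⟨ *-cong expand-norm (≈-trans (V-* (P 5 n) _) (*-congˡ (V-cong (factor₅ n)))) ⟩
      norm Q * v₁ * v₂ * v₃ * v₄ * u ^ 5 * (V (P 5 n) * v₅)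
        ≈⟨ solve 8 (λ a b v₁ v₂ v₃ v₄ u v₅ → a :* v₁ :* v₂ :* v₃ :* v₄ :* u :^ 5 :* (b :* v₅) := a :* b :* (v₁ :* v₂ :* v₃ :* v₄
             :* v₅ :* u :^ 5)) ≈-refl
             (norm Q) (V (P 5 n)) v₁ v₂ v₃ v₄ u v₅ ⟩
      norm Q * V (P 5 n) * (v₁ * v₂ * v₃ * v₄ * v₅ * u ^ 5)
        ≈⟨ *-congʳ (norm-P n) ⟩
      V Q * V (P 1 n) ^ 5 * (v₁ * v₂ * v₃ * v₄ * v₅ * u ^ 5)
        ≈⟨ solve 8 (λ a b v₁ v₂ v₃ v₄ u v₅ → a :* b :^ 5 :* (v₁ :* v₂ :* v₃ :* v₄ :* v₅ :* u :^ 5)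
             := a :* v₁ :* v₂ :* v₃ :* v₄ :* v₅ :* (b :* u) :^ 5) ≈-refl (V Q) (V (P 1 n)) v₁ v₂ v₃ v₄ u v₅ ⟩
      V Q * v₁ * v₂ * v₃ * v₄ * v₅ * (V (P 1 n) * u) ^ 5
        ≈⟨ *-cong expand-V (^-congˡ 5 (V-* (P 1 n) _)) ⟨
      V (P 1 (suc n ℕ.* 5)) * V (P 1 (suc n)) ^ 5 ∎
      where
      open ≈-Reasoning
      Q = P 1 (n ℕ.* 5)
      v₁ = V (factor 1 n)
      v₂ = V (factor 2 n)
      v₃ = V (factor 3 n)
      v₄ = V (factor 4 n)
      v₅ = V (factor 5 n)
      u = V (1# + - q ^ (1 ℕ.* suc n))
      expand-norm : norm (Q * factor 1 n * factor 2 n * factor 3 n * factor 4 n * factor 5 n) ≈ norm Q * v₁ * v₂ * v₃ * v₄ * u ^ 5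
      expand-norm = ≈-trans (norm-* _ (factor 5 n)) (*-cong (≈-trans (norm-* _ (factor 4 n)) (*-cong (≈-trans (norm-* _ (factor 3
          n)) (*-cong
        (≈-trans (norm-* _ (factor 2 n)) (*-cong (≈-trans (norm-* Q (factor 1 n)) (*-congˡ (norm₁ n))) (norm₂ n))) (norm₃ n)))
            (norm₄ n))) (norm₅ n))
      expand-V : V (Q * factor 1 n * factor 2 n * factor 3 n * factor 4 n * factor 5 n) ≈ V Q * v₁ * v₂ * v₃ * v₄ * v₅
      expand-V = ≈-trans (V-* _ (factor 5 n)) (*-congʳ (≈-trans (V-* _ (factor 4 n)) (*-congʳ (≈-trans (V-* _ (factor 3 n)) (*-congʳ
        (≈-trans (V-* _ (factor 2 n)) (*-congʳ (V-* Q (factor 1 n)))))))))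

  -- Compares two evaluations of the norm, by the dissection and by the product. Both sides are
  -- series in q⁵, and `E 0` replaces q⁵ by q.
  f₁⁶ : α ^ 5 * (1# + - (z * z)) * (α * w) ≈ f 1 ^ 6
  f₁⁶ = ≈-trans (≈-sym (E-V _)) (≈-trans (E-cong 0 (begin
    V (α ^ 5 * (1# + - (z * z)) * (α * w))
      ≈⟨ ≈-trans (V-* _ (α * w)) (*-cong (≈-sym norm-f₁) (V-cong (≈-trans αw≈c (≈-sym f₅)))) ⟩
    norm (f 1) * V (f 5)
      ≈⟨ mod-all limit ⟩
    V (f 1) * V (f 1) ^ 5
      ≈⟨ V-^ (f 1) 6 ⟨
    V (f 1 ^ 6) ∎)) (E-V (f 1 ^ 6)))
    where
    open ≈-Reasoning
    limit : ∀ N → norm (f 1) * V (f 5) ≈ V (f 1) * V (f 1) ^ 5 mod-q^ N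
    limit N = m-trans (*-mod (norm-mod big) (V-mod (mod-weaken (ℕ.n≤1+n N) (f≈P 5 N))))
      (m-trans (≈⇒mod (norm-P N)) (*-mod (V-mod (m-sym big)) (^-mod 5 (V-mod (mod-weaken (ℕ.n≤1+n N) (m-sym (f≈P 1 N)))))))
      where
      big : f 1 ≈ P 1 (N ℕ.* 5) mod-q^ N
      big = mod-weaken (ℕ.m≤n⇒m≤1+n (ℕ.m≤m*n N 5)) (f≈P 1 (N ℕ.* 5))

-- Iterated extraction of arithmetic progressions

module Dissections11 where
  open Series 11 hiding (solve; _:=_; _:+_; _:*_; _:-_; :-_; _:^_; con)
  open ModularSolver
  open Sums 11
  open EulerProducts 11 hiding (_/_)
  open GeneratingFunction 11
  open PentagonalNumbers 11
  open Dissection 11 4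
  open Modulo11
  private module R = CommutativeRing (Residues.commutativeRing 11)

  private
    F = f 1
    G = V F

  evaluate : List ℤ → Series → Series
  evaluate []       x = const (+ 0)
  evaluate (k ∷ ks) x = const k + x * evaluate ks x

  -- Each `x` contributes one `q` and, after extraction, one `w`. A class therefore selects every
  -- fifth entry of the coefficient list, with a factor `q` for each wrap-around.
  part : ℕ → List ℤ → Series → Series
  part _       []       g = const (+ 0)
  part zero    (k ∷ ks) g = const k * g + q * part 4 ks (g * w)
  part (suc s) (k ∷ ks) g = part s ks (g * w)

  E-evaluate : ∀ s ks g → s < 5 → E s (V g * evaluate ks x) ≈ part s ks g
  E-evaluate s [] g s<5 = ≈-trans (E-cong s (≈-trans (*-congˡ const-0) (zeroʳ (V g)))) (≈-sym const-0)
  E-evaluate s (k ∷ ks) g s<5 = ≈-trans (E-cong s split) (≈-trans (E-+ s _ _) (rest s s<5))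
    where
    split : V g * evaluate (k ∷ ks) x ≈ V (const k * g) * 1# + q * (V (g * w) * evaluate ks x)
    split = ≈-trans (solve 5 (λ q k g w e → g :* (k :+ q :* w :* e) := k :* g :* con (+ 1) :+ q :* (g :* w :* e)) ≈-refl
        q (const k) (V g) (V w) (evaluate ks x))
      (+-cong (*-congʳ (≈-trans (*-congʳ (≈-sym (V-const k))) (≈-sym (V-* (const k) g)))) (*-congˡ (*-congʳ (≈-sym (V-* g w)))))
    rest : ∀ s → s < 5 → E s (V (const k * g) * 1#) + E s (q * (V (g * w) * evaluate ks x)) ≈ part s (k ∷ ks) g
    rest zero s<5 = +-cong (≈-trans (E-V* (const k * g) 1# s<5) (≈-trans (*-congˡ E-1-zero) (*-identityʳ (const k * g))))
      (≈-trans (E-q-zero _) (*-congˡ (E-evaluate 4 ks (g * w) ℕ.≤-refl)))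
    rest (suc s) s<5 = ≈-trans (+-cong (≈-trans (E-V* (const k * g) 1# s<5) (≈-trans (*-congˡ (E-1-suc s)) (zeroʳ (const k * g))))
      (≈-trans (E-q-suc s _) (E-evaluate s ks (g * w) (ℕ.<⇒≤ s<5)))) (+-identityˡ _)

  private
    u : Series
    u = 1# + - x + - (x * x)

    E-F^ : ∀ s n ks → s < 5 → u ^ n ≈ evaluate ks x → E s (F ^ n) ≈ part s ks (α ^ n)
    E-F^ s n ks s<5 u^n = ≈-trans (E-cong s (≈-trans (^-congˡ n f₁-factored) (≈-trans (^-distrib-* (V α) u n)
      (*-cong (≈-sym (V-^ α n)) u^n)))) (E-evaluate s ks (α ^ n) s<5)
      where open import Algebra.Properties.CommutativeSemiring.Exp commutativeSemiring using (^-distrib-*)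

    -- The list holds the coefficients of (1 - x - x²)³ modulo 11. Its degree is 6, so x³ is alone
    -- in class 3.
    E₃-F³ : E 3 (F ^ 3) ≈ const (+ 5) * G ^ 3
    E₃-F³ = ≈-trans (E-F^ 3 3 (+ 1 ∷ + 8 ∷ + 0 ∷ + 5 ∷ + 0 ∷ + 8 ∷ + 10 ∷ []) (s≤s (s≤s (s≤s (s≤s z≤n))))
        (solve 1 (λ x → (con (+ 1) :- x :- x :* x) :^ 3 := con (+ 1) :+ x :* (con (+ 8) :+ x :* (con (+ 0) :+ x :* (con (+ 5) :+
            x :* (con (+ 0)
          :+ x :* (con (+ 8) :+ x :* (con (+ 10) :+ x :* con (+ 0)))))))) ≈-refl x))
      (≈-trans (solve 3 (λ q α w → con (+ 5) :* (α :^ 3 :* w :* w :* w) :+ q :* con (+ 0) := con (+ 5) :* (α :* w) :^ 3) ≈-refl q α w)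
        (*-congˡ (^-congˡ 3 αw≈c)))

    -- Class 2 consists of x², x⁷ and x¹², with coefficients 3, 4 and 8 = -3. The outer two form
    -- 3α⁷w²(1 - z²), which `f₁⁶` turns into 3 f₁⁶ f₅.
    E₂-F⁷ : E 2 (F ^ 7) ≈ const (+ 3) * (F ^ 6 * G) + const (+ 4) * (q * G ^ 7)
    E₂-F⁷ = ≈-trans (E-F^ 2 7 (+ 1 ∷ + 4 ∷ + 3 ∷ + 7 ∷ + 6 ∷ + 3 ∷ + 0 ∷ + 4 ∷ + 0 ∷ + 3 ∷ + 5 ∷ + 7 ∷ + 8 ∷ + 4 ∷ + 10 ∷ [])
        (s≤s (s≤s (s≤s z≤n)))
        (solve 1 (λ x → (con (+ 1) :- x :- x :* x) :^ 7 :=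
          con (+ 1) :+ x :* (con (+ 4) :+ x :* (con (+ 3) :+ x :* (con (+ 7) :+ x :* (con (+ 6) :+ x :* (con (+ 3) :+ x :* (con
              (+ 0) :+ x :* (con (+ 4)
          :+ x :* (con (+ 0) :+ x :* (con (+ 3) :+ x :* (con (+ 5) :+ x :* (con (+ 7) :+ x :* (con (+ 8) :+ x :* (con (+ 4) :+ x
              :* (con (+ 10)
          :+ x :* con (+ 0))))))))))))))) ) ≈-refl x))
      (≈-trans (solve 3 (λ q α w → con (+ 3) :* (α :^ 7 :* w :* w) :+ q :* (con (+ 4) :* (α :^ 7 :* w :* w :* w :* w :* w :* w :* w)
            :+ q :* (con (+ 8) :* (α :^ 7 :* w :* w :* w :* w :* w :* w :* w :* w :* w :* w :* w :* w) :+ q :* con (+ 0)))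
          := con (+ 3) :* (α :^ 5 :* (con (+ 1) :- q :* w :^ 5 :* (q :* w :^ 5)) :* (α :* w) :* (α :* w)) :+ con (+ 4) :* (q :*
              (α :* w) :^ 7)) ≈-refl q α w)
        (+-cong (*-congˡ (*-cong f₁⁶ αw≈c)) (*-congˡ (*-congˡ (^-congˡ 7 αw≈c)))))

    -- Class 4 consists of x⁴, x⁹ and x¹⁴, with coefficients 9, 2 and 2 = -9. The outer two again
    -- combine through 1 - z², now into 9 f₁⁶ f₅³.
    E₄-F⁹ : E 4 (F ^ 9) ≈ const (+ 9) * (F ^ 6 * G ^ 3) + const (+ 2) * (q * G ^ 9)
    E₄-F⁹ = ≈-trans (E-F^ 4 9 (+ 1 ∷ + 2 ∷ + 5 ∷ + 10 ∷ + 9 ∷ + 5 ∷ + 5 ∷ + 9 ∷ + 4 ∷ + 2 ∷ + 7 ∷ + 9 ∷ + 6 ∷ + 5 ∷ + 2 ∷ + 10 ∷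
        + 6 ∷ + 2 ∷ + 10 ∷ []) ℕ.≤-refl
        (solve 1 (λ x → (con (+ 1) :- x :- x :* x) :^ 9 :=
          con (+ 1) :+ x :* (con (+ 2) :+ x :* (con (+ 5) :+ x :* (con (+ 10) :+ x :* (con (+ 9) :+ x :* (con (+ 5) :+ x :* (con
              (+ 5) :+ x :* (con (+ 9)
          :+ x :* (con (+ 4) :+ x :* (con (+ 2) :+ x :* (con (+ 7) :+ x :* (con (+ 9) :+ x :* (con (+ 6) :+ x :* (con (+ 5) :+ x
              :* (con (+ 2)
          :+ x :* (con (+ 10) :+ x :* (con (+ 6) :+ x :* (con (+ 2) :+ x :* (con (+ 10) :+ x :* con (+ 0))))))))))))))))))) ) ≈-refl x))
      (≈-trans (solve 3 (λ q α w → con (+ 9) :* (α :^ 9 :* w :* w :* w :* w) :+ q :* (con (+ 2) :* (α :^ 9 :* w :* w :* w :* w :*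
          w :* w :* w :* w :* w)
            :+ q :* (con (+ 2) :* (α :^ 9 :* w :* w :* w :* w :* w :* w :* w :* w :* w :* w :* w :* w :* w :* w) :+ q :* con (+ 0)))
          := con (+ 9) :* (α :^ 5 :* (con (+ 1) :- q :* w :^ 5 :* (q :* w :^ 5)) :* (α :* w) :* (α :* w) :^ 3) :+ con (+ 2) :* (q
              :* (α :* w) :^ 9)) ≈-refl q α w)
        (+-cong (*-congˡ (*-cong f₁⁶ (^-congˡ 3 αw≈c))) (*-congˡ (*-congˡ (^-congˡ 9 αw≈c)))))

  v₁ v₂ w₁ w₂ : Series
  v₁ = F ^ 9 * G
  v₂ = q * (F ^ 3 * G ^ 7)
  w₁ = F ^ 7 * G ^ 3
  w₂ = q * (F * G ^ 9)

  private
    V^ : ∀ n {h} → h * G ^ n ≈ V (F ^ n) * h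
    V^ n {h} = ≈-trans (*-comm h (G ^ n)) (*-congʳ (≈-sym (V-^ F n)))

    -- As `G` is a series in q⁵, its powers leave `E s` as powers of `F`, so only pure powers of `F`
    -- have to be dissected.
    E-G^ : ∀ {s} n h → s < 5 → E s (h * G ^ n) ≈ F ^ n * E s h
    E-G^ {s} n h s<5 = ≈-trans (E-cong s (V^ n)) (E-V* (F ^ n) h s<5)

    E-q-G^ : ∀ {s} n h → suc s < 5 → E (suc s) (q * (h * G ^ n)) ≈ F ^ n * E s h
    E-q-G^ {s} n h s<5 = ≈-trans (E-q-suc s _) (E-G^ n h (ℕ.<⇒≤ s<5))

  E₄-v₁ : E 4 v₁ ≈ const (+ 9) * w₁ + const (+ 2) * w₂
  E₄-v₁ = ≈-trans (E-cong 4 (*-comm (F ^ 9) G)) (≈-trans (E-V* F (F ^ 9) ℕ.≤-refl) (≈-trans (*-congˡ E₄-F⁹)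
    (solve 3 (λ q F G → F :* (con (+ 9) :* (F :^ 6 :* G :^ 3) :+ con (+ 2) :* (q :* G :^ 9))
      := con (+ 9) :* (F :^ 7 :* G :^ 3) :+ con (+ 2) :* (q :* (F :* G :^ 9))) ≈-refl q F G)))

  E₄-v₂ : E 4 v₂ ≈ const (+ 5) * w₁
  E₄-v₂ = ≈-trans (E-q-G^ 7 (F ^ 3) ℕ.≤-refl) (≈-trans (*-congˡ E₃-F³)
    (solve 2 (λ F G → F :^ 7 :* (con (+ 5) :* G :^ 3) := con (+ 5) :* (F :^ 7 :* G :^ 3)) ≈-refl F G))

  E₂-w₁ : E 2 w₁ ≈ const (+ 3) * v₁ + const (+ 4) * v₂
  E₂-w₁ = ≈-trans (E-G^ 3 (F ^ 7) (s≤s (s≤s (s≤s z≤n)))) (≈-trans (*-congˡ E₂-F⁷)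
    (solve 3 (λ q F G → F :^ 3 :* (con (+ 3) :* (F :^ 6 :* G) :+ con (+ 4) :* (q :* G :^ 7))
      := con (+ 3) :* (F :^ 9 :* G) :+ con (+ 4) :* (q :* (F :^ 3 :* G :^ 7))) ≈-refl q F G))

  E₂-w₂ : E 2 w₂ ≈ - v₁
  E₂-w₂ = ≈-trans (E-q-G^ 9 F (s≤s (s≤s (s≤s z≤n)))) (≈-trans (*-congˡ E₁-f₁)
    (solve 2 (λ x G → x :* :- G := :- (x :* G)) ≈-refl (F ^ 9) G))

  E₄-w₂ : E 4 w₂ ≈ 0#
  E₄-w₂ = ≈-trans (E-q-G^ 9 F ℕ.≤-refl) (≈-trans (*-congˡ E₃-f₁) (zeroʳ (F ^ 9)))

  E₀-w₂ : E 0 w₂ ≈ 0#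
  E₀-w₂ = ≈-trans (E-q-zero _) (≈-trans (*-congˡ (≈-trans (E-G^ 9 F ℕ.≤-refl) (≈-trans (*-congˡ E₄-f₁) (zeroʳ (F ^ 9))))) (zeroʳ q))

  M : Series → Series
  M g = E 2 (E 4 g)

  private
    infix 6 _v+_ _w+_
    _v+_ _w+_ : ℤ → ℤ → Series
    a v+ b = const a * v₁ + const b * v₂
    a w+ b = const a * w₁ + const b * w₂

    E-linear : ∀ s a b g h → E s (const a * g + const b * h) ≈ const a * E s g + const b * E s h
    E-linear s a b g h = ≈-trans (E-+ s _ _) (+-cong (E-const* s a g) (E-const* s b h))

    E₄-v : ∀ a b → E 4 (a v+ b) ≈ (+ 9 ℤ.* a ℤ.+ + 5 ℤ.* b) w+ (+ 2 ℤ.* a)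
    E₄-v a b = ≈-trans (E-linear 4 a b v₁ v₂) (≈-trans (+-cong (*-congˡ E₄-v₁) (*-congˡ E₄-v₂)) (≈-trans
      (solve 4 (λ a b x y → a :* (con (+ 9) :* x :+ con (+ 2) :* y) :+ b :* (con (+ 5) :* x)
        := (con (+ 9) :* a :+ con (+ 5) :* b) :* x :+ con (+ 2) :* a :* y) ≈-refl (const a) (const b) w₁ w₂)
      (+-cong (*-congʳ (≈-sym (≈-trans (const-+-homo _ _) (+-cong (const-*-homo _ _) (const-*-homo _ _))))) (*-congʳ (≈-sym
          (const-*-homo _ _))))))

    E₂-w : ∀ a b → E 2 (a w+ b) ≈ (+ 3 ℤ.* a ℤ.+ + 10 ℤ.* b) v+ (+ 4 ℤ.* a)
    E₂-w a b = ≈-trans (E-linear 2 a b w₁ w₂) (≈-trans (+-cong (*-congˡ E₂-w₁) (*-congˡ E₂-w₂)) (≈-trans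
      (solve 4 (λ a b x y → a :* (con (+ 3) :* x :+ con (+ 4) :* y) :+ b :* (:- x)
        := (con (+ 3) :* a :+ con (+ 10) :* b) :* x :+ con (+ 4) :* a :* y) ≈-refl (const a) (const b) v₁ v₂)
      (+-cong (*-congʳ (≈-sym (≈-trans (const-+-homo _ _) (+-cong (const-*-homo _ _) (const-*-homo _ _))))) (*-congʳ (≈-sym
          (const-*-homo _ _))))))

    M-step : ∀ {g a b} a′ b′ → g ≈ a v+ b → (+ 3 ℤ.* (+ 9 ℤ.* a ℤ.+ + 5 ℤ.* b) ℤ.+ + 10 ℤ.* (+ 2 ℤ.* a)) R.≈ a′ →
             (+ 4 ℤ.* (+ 9 ℤ.* a ℤ.+ + 5 ℤ.* b)) R.≈ b′ → M g ≈ a′ v+ b′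
    M-step {g} {a} {b} a′ b′ e p r = ≈-trans (E-cong 2 (≈-trans (E-cong 4 e) (E₄-v a b))) (≈-trans (E₂-w _ _)
      (+-cong (*-congʳ (const-cong p)) (*-congʳ (const-cong r))))

    residue : ∀ a → + a R.≈ + (a ℕ.% 11)
    residue a = R.sym (Residues.%-≈ 11 (+ a))

    -- Start of the orbit of (1, 0) under the matrix with rows (3, 4) and (3, 9) modulo 11. In the
    -- steps that follow, the arguments of `residue` are the coordinates before reduction, such as
    -- 47 = 3 · 9 + 10 · 2.
    M⁰ : v₁ ≈ + 1 v+ + 0
    M⁰ = solve 2 (λ x y → x := con (+ 1) :* x :+ con (+ 0) :* y) ≈-refl v₁ v₂
    M¹ : M v₁ ≈ + 3 v+ + 3
    M¹ = M-step _ _ M⁰ (residue 47) (residue 36)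
    M² : M (M v₁) ≈ + 10 v+ + 3
    M² = M-step _ _ M¹ (residue 186) (residue 168)
    M³ : M (M (M v₁)) ≈ + 9 v+ + 2
    M³ = M-step _ _ M² (residue 515) (residue 420)
    M⁴ : M (M (M (M v₁))) ≈ + 2 v+ + 1
    M⁴ = M-step _ _ M³ (residue 453) (residue 364)
    M⁵ : M (M (M (M (M v₁)))) ≈ + 10 v+ + 4
    M⁵ = M-step _ _ M⁴ (residue 109) (residue 92)
    M⁶ : M (M (M (M (M (M v₁))))) ≈ + 2 v+ + 0
    M⁶ = M-step _ _ M⁵ (residue 530) (residue 440)

  M⁶-v₁ : M (M (M (M (M (M v₁))))) ≈ const (+ 2) * v₁
  M⁶-v₁ = ≈-trans M⁶ (solve 2 (λ x y → con (+ 2) :* x :+ con (+ 0) :* y := con (+ 2) :* x) ≈-refl v₁ v₂)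

  -- From the coordinates (10, 4), the coefficient of `w₁` is 9 · 10 + 5 · 4 = 110, a multiple of
  -- 11, and that of `w₂` is 2 · 10 = 20.
  E₄-M⁵-v₁ : E 4 (M (M (M (M (M v₁))))) ≈ const (+ 9) * w₂
  E₄-M⁵-v₁ = ≈-trans (E-cong 4 M⁵) (≈-trans (E₄-v (+ 10) (+ 4)) (≈-trans
    (+-cong (*-congʳ (const-cong (residue 110))) (*-congʳ (const-cong (residue 20))))
    (solve 2 (λ x y → con (+ 0) :* x :+ con (+ 9) :* y := con (+ 9) :* y) ≈-refl w₁ w₂)))

  B≈v₁ : (λ n → + B 5 11 n) ≈ v₁
  B≈v₁ = ≈-trans (B-series 5 11) (≈-trans
    (*-cong (*-congʳ f₅) (*-congʳ f₁₁))
    (≈-trans (solve 3 (λ F G i → G :* i :* (F :^ 11 :* i) := F :^ 9 :* G :* (F :* i) :* (F :* i)) ≈-refl F G (inv F))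
      (≈-trans (*-cong (*-congˡ Fi) Fi) (≈-trans (*-identityʳ _) (*-identityʳ _)))))
    where
    Fi : F * inv F ≈ 1#
    Fi = inv-inverse F (f-head 1)

-- Arithmetic of the indices and the two congruences

module Indices where
  open import Data.Nat using (_+_; _*_; _∸_; _^_; _/_; _%_)
  open Dissections11
  open ℕ.+-*-Solver using (solve; _:=_; _:+_; _:*_; con)
  private
    module R = CommutativeRing (Residues.commutativeRing 11)
    open Series 11 using (Series; at; const-*-at; zeroʳ; *-congˡ)

  -- M g n is g (φ n) by definition.
  φ : ℕ → ℕ
  φ n = (n * 5 + 2) * 5 + 4

  φ^ : ℕ → ℕ → ℕ
  φ^ zero    n = n
  φ^ (suc k) n = φ (φ^ k n)

  -- Under y ↦ 12y + 7 the map `φ` becomes multiplication by 25. Indices are compared after this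
  -- substitution, where no division occurs.
  φ^-affine : ∀ k n → 12 * φ^ k n + 7 ≡ 25 ^ k * (12 * n + 7)
  φ^-affine zero    n = ≡.sym (ℕ.*-identityˡ (12 * n + 7))
  φ^-affine (suc k) n = ≡.trans (solve 1 (λ n → con 12 :* ((n :* con 5 :+ con 2) :* con 5 :+ con 4) :+ con 7 := con 25 :* (con 12
      :* n :+ con 7)) ≡.refl (φ^ k n))
    (≡.trans (≡.cong (25 *_) (φ^-affine k n)) (≡.sym (ℕ.*-assoc 25 (25 ^ k) (12 * n + 7))))

  25^ : ∀ m → 25 ^ (m * 6) ≡ 5 ^ (12 * m)
  25^ m = ≡.trans (ℕ.^-*-assoc 5 2 (m * 6)) (≡.cong (5 ^_) (solve 1 (λ m → con 2 :* (m :* con 6) := con 12 :* m) ≡.refl m))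

  φ^-affine₁₂ : ∀ m n → 12 * φ^ (m * 6) n + 7 ≡ 5 ^ (12 * m) * (12 * n + 7)
  φ^-affine₁₂ m n = ≡.trans (φ^-affine (m * 6) n) (≡.cong (_* (12 * n + 7)) (25^ m))

  cancel : ∀ {a b} → 12 * a + 7 ≡ 12 * b + 7 → a ≡ b
  cancel {a} {b} eq = ℕ.*-cancelˡ-≡ a b 12 (ℕ.+-cancelʳ-≡ 7 (12 * a) (12 * b) eq)

  -- The numerators of the theorem have the form 12y + 7 before 7 is removed, so its truncated
  -- subtraction and its division are both exact.
  quotient : ∀ {y t} → 12 * y + 7 ≡ t → (t ∸ 7) / 12 ≡ y
  quotient {y} ≡.refl = ≡.trans (≡.cong (_/ 12) (≡.trans (ℕ.m+n∸n≡m (12 * y) 7) (ℕ.*-comm 12 y))) (ℕ.m*n/n≡m y 12)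

  index₁ : ∀ n m → 5 ^ (12 * m) * n + (7 * 5 ^ (12 * m) ∸ 7) / 12 ≡ φ^ (m * 6) n
  index₁ n m = ≡.trans (≡.cong (λ i → 5 ^ (12 * m) * n + i) (quotient at-0)) (cancel (≡.trans
    (solve 3 (λ a n y → con 12 :* (a :* n :+ y) :+ con 7 := a :* (con 12 :* n) :+ (con 12 :* y :+ con 7)) ≡.refl (5 ^ (12 * m)) n
        (φ^ (m * 6) 0))
    (≡.trans (≡.cong (λ i → 5 ^ (12 * m) * (12 * n) + i) at-0)
    (≡.trans (solve 2 (λ a n → a :* (con 12 :* n) :+ con 7 :* a := a :* (con 12 :* n :+ con 7)) ≡.refl (5 ^ (12 * m)) n)
      (≡.sym (φ^-affine₁₂ m n))))))
    where
    at-0 : 12 * φ^ (m * 6) 0 + 7 ≡ 7 * 5 ^ (12 * m)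
    at-0 = ≡.trans (φ^-affine₁₂ m 0) (ℕ.*-comm (5 ^ (12 * m)) 7)

  -- The innermost index 5n + 4 belongs to one further extraction `E 4`; by 12(5n + 4) + 7 = 5(12n +
  -- 11) it makes the power of 5 odd.
  φ^-affine-odd : ∀ m k n → 12 * φ^ (m * 6) (φ^ k (n * 5 + 4)) + 7 ≡ 5 ^ (12 * m + (2 * k + 1)) * (12 * n + 11)
  φ^-affine-odd m k n = ≡.trans (φ^-affine₁₂ m (φ^ k (n * 5 + 4))) (≡.trans
    (≡.cong (5 ^ (12 * m) *_) (≡.trans (φ^-affine k (n * 5 + 4)) (≡.cong (_* (12 * (n * 5 + 4) + 7)) (ℕ.^-*-assoc 5 2 k))))
    (≡.trans (solve 3 (λ a c n → a :* (c :* (con 12 :* (n :* con 5 :+ con 4) :+ con 7)) := a :* (c :* con 5) :* (con 12 :* n :+ con 11))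
        ≡.refl (5 ^ (12 * m)) (5 ^ (2 * k)) n)
      (≡.cong (_* (12 * n + 11)) (≡.sym (≡.trans (ℕ.^-distribˡ-+-* 5 (12 * m) (2 * k + 1))
        (≡.cong (5 ^ (12 * m) *_) (ℕ.^-distribˡ-+-* 5 (2 * k) 1)))))))

  -- The outer 6m steps multiply `v₁` by 2^m modulo 11; the inner part reads coefficient `n` of
  -- `E 4` applied to M⁵ v₁.
  ψ : ℕ → ℕ → ℕ
  ψ m n = φ^ (m * 6) (φ^ 5 (n * 5 + 4))

  ψ-affine : ∀ m n → 12 * ψ m n + 7 ≡ 5 ^ (12 * m + 11) * (12 * n + 11)
  ψ-affine m n = φ^-affine-odd m 5 n

  index₂ : ∀ n m k → 5 ^ (12 * m + 12) * n + ((12 * k + 11) * 5 ^ (12 * m + 11) ∸ 7) / 12 ≡ ψ m (n * 5 + k)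
  index₂ n m k = ≡.trans (≡.cong₂ (λ i j → i * n + j) 5^ (quotient at-k)) (cancel (≡.trans
    (solve 3 (λ a n y → con 12 :* (con 5 :* a :* n :+ y) :+ con 7 := a :* (con 60 :* n) :+ (con 12 :* y :+ con 7)) ≡.refl (5 ^
        (12 * m + 11)) n (ψ m k))
    (≡.trans (≡.cong (λ i → 5 ^ (12 * m + 11) * (60 * n) + i) at-k)
    (≡.trans (solve 3 (λ a n k → a :* (con 60 :* n) :+ (con 12 :* k :+ con 11) :* a := a :* (con 12 :* (n :* con 5 :+ k) :+ con
        11)) ≡.refl (5 ^ (12 * m + 11)) n k)
      (≡.sym (ψ-affine m (n * 5 + k)))))))
    where
    at-k : 12 * ψ m k + 7 ≡ (12 * k + 11) * 5 ^ (12 * m + 11)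
    at-k = ≡.trans (ψ-affine m k) (ℕ.*-comm (5 ^ (12 * m + 11)) (12 * k + 11))
    5^ : 5 ^ (12 * m + 12) ≡ 5 * 5 ^ (12 * m + 11)
    5^ = ≡.cong (5 ^_) (ℕ.+-suc (12 * m) 11)

  v₁-φ^ : ∀ m n → v₁ (φ^ (m * 6) n) R.≈ + (2 ^ m) ℤ.* v₁ n
  v₁-φ^ zero    n = R.sym (R.*-identityˡ (v₁ n))
  v₁-φ^ (suc m) n = R.trans (at M⁶-v₁ (φ^ (m * 6) n)) (R.trans (const-*-at (+ 2) v₁ (φ^ (m * 6) n))
    (R.trans (R.*-congˡ {+ 2} (v₁-φ^ m n)) (R.reflexive (≡.trans (≡.sym (ℤ.*-assoc (+ 2) (+ (2 ^ m)) (v₁ n))) (≡.cong (ℤ._* v₁ n)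
        (≡.sym (ℤ.pos-* 2 (2 ^ m))))))))

  -- The value k = 5 is class 0 in the next block: 5n + 5 = 5(n + 1) + 0.
  w₂-vanishes : ∀ n k → (k ≡ 4) ⊎ (k ≡ 5) → w₂ (n * 5 + k) R.≈ + 0
  w₂-vanishes n _ (inj₁ ≡.refl) = at E₄-w₂ n
  w₂-vanishes n _ (inj₂ ≡.refl) = R.trans (R.reflexive (≡.cong w₂ (≡.trans (ℕ.+-comm (n * 5) 5) (≡.sym (ℕ.+-identityʳ (suc n *
      5)))))) (at E₀-w₂ (suc n))

  -- The sign of the integer quotient tells which of `a` and `c` exceeds the other by a multiple of
  -- 11.
  ≈⇒%≡ : ∀ a c → + a R.≈ + c → a % 11 ≡ c % 11
  ≈⇒%≡ a c Residues.⟨ ∣.divides k eq ⟩ = by k eq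
    where
    open ℤ.+-*-Solver using () renaming (solve to solveℤ; _:=_ to _≔_; _:-_ to _⊟_; _:+_ to _⊞_; _:*_ to _⊠_; :-_ to ⊟_; con to #)
    by : ∀ k → + a ℤ.- + c ≡ k ℤ.* + 11 → a % 11 ≡ c % 11
    by (+ j) eq = ≡.trans (≡.cong (_% 11) a≡) (ℕ.[m+kn]%n≡m%n c j 11)
      where
      a≡ : a ≡ c + j * 11
      a≡ = ℤ.+-injective (≡.trans (solveℤ 2 (λ a c → a ≔ c ⊞ (a ⊟ c)) ≡.refl (+ a) (+ c))
        (≡.trans (≡.cong (λ i → + c ℤ.+ i) (≡.trans eq (≡.sym (ℤ.pos-* j 11)))) (≡.sym (ℤ.pos-+ c (j * 11)))))
    by ℤ.-[1+ j ] eq = ≡.sym (≡.trans (≡.cong (_% 11) c≡) (ℕ.[m+kn]%n≡m%n a (suc j) 11))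
      where
      c≡ : c ≡ a + suc j * 11
      c≡ = ℤ.+-injective (≡.trans (solveℤ 2 (λ a c → c ≔ a ⊟ (a ⊟ c)) ≡.refl (+ a) (+ c))
        (≡.trans (≡.cong (λ i → + a ℤ.- i) eq) (≡.sym (ℤ.pos-+ a (suc j * 11)))))

  part₁ : ∀ n m → B 5 11 (5 ^ (12 * m) * n + (7 * 5 ^ (12 * m) ∸ 7) / 12) % 11 ≡ (2 ^ m * B 5 11 n) % 11
  part₁ n m = ≈⇒%≡ _ _ (R.trans (R.reflexive (≡.cong (λ i → + B 5 11 i) (index₁ n m))) (R.trans (at B≈v₁ (φ^ (m * 6) n))
    (R.trans (v₁-φ^ m n) (R.trans (R.*-congˡ {+ (2 ^ m)} (R.sym (at B≈v₁ n))) (R.reflexive (≡.sym (ℤ.pos-* (2 ^ m) (B 5 11 n))))))))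

  part₂ : ∀ n m k → (k ≡ 4) ⊎ (k ≡ 5) → B 5 11 (5 ^ (12 * m + 12) * n + ((12 * k + 11) * 5 ^ (12 * m + 11) ∸ 7) / 12) % 11 ≡ 0
  part₂ n m k k≡ = ≈⇒%≡ _ 0 (R.trans (R.reflexive (≡.cong (λ i → + B 5 11 i) (index₂ n m k))) (R.trans (at B≈v₁ (ψ m N))
    (R.trans (v₁-φ^ m (φ^ 5 (N * 5 + 4))) (R.trans (R.*-congˡ {+ (2 ^ m)} (R.trans (at E₄-M⁵-v₁ N) (R.trans (const-*-at (+ 9) w₂ N)
      (R.trans (R.*-congˡ {+ 9} (w₂-vanishes n k k≡)) (R.zeroʳ (+ 9)))))) (R.zeroʳ (+ (2 ^ m)))))))
    where N = n * 5 + k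

open import Data.Nat using (_+_; _*_; _∸_; _^_; _/_; _%_)

theorem1p3 : (n m : ℕ) →
    (B 5 11 (5 ^ (12 * m) * n + (7 * 5 ^ (12 * m) ∸ 7) / 12) % 11 ≡ (2 ^ m * B 5 11 n) % 11)
    ×
    ((k : ℕ) → (k ≡ 4) ⊎ (k ≡ 5) →
    B 5 11 (5 ^ (12 * m + 12) * n + ((12 * k + 11) * 5 ^ (12 * m + 11) ∸ 7) / 12) % 11 ≡ 0)
theorem1p3 n m = Indices.part₁ n m , Indices.part₂ n m
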